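{- Let $s,t\geq 1$ be integers and let $p,q,l$ be three distinct primes with $p,q$ odd, $p\equiv 3 \pmod 4$, $\mathrm{ord}_{p^s}(l)=\phi(p^s)/2$, $\mathrm{ord}_{q^t}(l)=\phi(q^t)$ and $\gcd(\phi(p^s),\phi(q^t))=2$. Let $0\leq i\leq s-1$ and $0\leq j<j'\leq t$. Then in the ring $\mathbb{F}_l[x]/\langle x^{p^sq^t}-1\rangle$: (i) If $q$ is a quadratic residue modulo $p$, then \[\chi_{ij}^*\chi_{ij'}^*=\frac{p-3}{4}p^{s-i-1}\phi(q^{t-j'})\chi_{ij}^*+\frac{p+1}{4}p^{s-i-1}\phi(q^{t-j'})\chi_{ij}.\] (ii) If $q$ is a quadratic nonresidue modulo $p$ and $2\mid j'-j$, then \[\chi_{ij}^*\chi_{ij'}^*=\frac{p-3}{4}p^{s-i-1}\phi(q^{t-j'})\chi_{ij}^*+\frac{p+1}{4}p^{s-i-1}\phi(q^{t-j'})\chi_{ij}.\] (iii) If $q$ is a quadratic nonresidue modulo $p$ and $2\nmid j'-j$, then \[\chi_{ij}^*\chi_{ij'}^*=\frac{p-3}{4}p^{s-i-1}\phi(q^{t-j'})(\chi_{ij}+\chi_{ij}^*)+\frac{\phi(p^{s-i})}{2}\phi(q^{t-j'})\Big(\sum_{i< k\leq s-1}(\chi_{kj}+\chi_{kj}^*)+\chi_{sj}\Big).\]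
   Context: Here $\phi$ is Euler's phi function (with $\phi(1)=1$) and $\mathrm{ord}_m(k)$ is the multiplicative order of $k$ modulo $m$. Put $n=p^sq^t$. Fix an integer $g$ that is a primitive root both modulo $p^s$ and modulo $q^t$. For an integer $\gamma$, $C_\gamma=\{\gamma l^r \bmod n: r\geq 0\}\subseteq \mathbb{Z}_n$ is the $l$-cyclotomic coset modulo $n$ containing $\gamma$. For $0\leq i\leq s$, $0\leq j\leq t$ set $C_{ij}=C_{p^iq^j}$ and $C_{ij}^*=C_{p^iq^jg}$; in particular $C_{sj}=C_{sj}^*$ and $C_{st}=C_0=\{0\}$. Define elements of $\mathbb{F}_l[x]/\langle x^{n}-1\rangle$ by $\chi_{ij}=\sum_{\alpha\in C_{ij}}x^\alpha$ and $\chi_{ij}^*=\sum_{\alpha\in C_{ij}^*}x^\alpha$; in particular $\chi_{sj}=\chi_{sj}^*$ and $\chi_{st}=1$. Integer coefficients are read in $\mathbb{F}_l$, and empty sums are $0$. -}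

module Defs where

open import Algebra.Bundles using (CommutativeRing)
import Algebra.Properties.Ring as RingProperties
import Algebra.Properties.CommutativeSemigroup as CSProperties
import Algebra.Solver.Ring.NaturalCoefficients.Default as SemiringSolver
open import Data.Fin.Base using (Fin; toℕ; fromℕ<)
open import Data.Fin.Properties using (nonZeroIndex; any?; pigeonhole; toℕ<n; toℕ-fromℕ<)
open import Data.Integer.Base as ℤ using (ℤ; +_)
open import Data.Integer.DivMod using (_%ℕ_; _/ℕ_; n%ℕd<d; a≡a%ℕn+[a/ℕn]*n)
import Data.Integer.Divisibility.Signed as ℤ∣
import Data.Integer.Properties as ℤₚ
open import Data.Integer.Solver renaming (module +-*-Solver to ℤ-Solver)
open import Data.List.Base using (List; []; _∷_; _++_; map; filter; foldr; length; replicate; upTo; allFin)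
open import Data.Nat.Base as ℕ using (ℕ; zero; suc; _∸_; NonZero; _≤_; _<_)
open import Data.Nat.Coprimality using (Coprime; coprime?)
open import Data.Nat.Induction using (<-rec)
import Data.Nat.Properties as ℕₚ
open import Data.Product.Base using (∃-syntax; _×_; _,_)
open import Level using (_⊔_)
open import Relation.Binary.Bundles using (Setoid)
open import Relation.Binary.PropositionalEquality as ≡ using (_≡_)
open import Relation.Nullary using (¬_; Dec; yes; no)
open import Relation.Nullary.Decidable using (map′)
import Relation.Binary.Reasoning.Setoid as SetoidReasoning

-- The quotient R/⟨m⟩ of a commutative ring by a principal ideal: the carrier
-- and operations of R, with equality coarsened to congruence modulo m.

module Quotient {c ℓ} (R : CommutativeRing c ℓ) (m : CommutativeRing.Carrier R) where

  open CommutativeRing R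
  open RingProperties ring
  open SetoidReasoning setoid
  open SemiringSolver commutativeSemiring using (solve; _:=_; _:+_; _:*_)

  infix 4 _≈ₘ_
  record _≈ₘ_ (a b : Carrier) : Set (c ⊔ ℓ) where
    constructor mk≈ₘ
    field
      quotient : Carrier
      equality : a ≈ b + quotient * m

  ≈⇒≈ₘ : ∀ {a b} → a ≈ b → a ≈ₘ b
  ≈⇒≈ₘ {a} {b} a≈b = mk≈ₘ 0# (begin
    a           ≈⟨ a≈b ⟩
    b           ≈⟨ +-identityʳ b ⟨
    b + 0#      ≈⟨ +-congˡ (zeroˡ m) ⟨
    b + 0# * m  ∎)

  ≈ₘ-sym : ∀ {a b} → a ≈ₘ b → b ≈ₘ a
  ≈ₘ-sym {a} {b} (mk≈ₘ h a≈) = mk≈ₘ (- h) (begin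
    b                          ≈⟨ +-identityʳ b ⟨
    b + 0#                     ≈⟨ +-congˡ (-‿inverseʳ (h * m)) ⟨
    b + (h * m + - (h * m))    ≈⟨ +-assoc b _ _ ⟨
    (b + h * m) + - (h * m)    ≈⟨ +-cong (sym a≈) (-‿distribˡ-* h m) ⟩
    a + - h * m                ∎)

  ≈ₘ-trans : ∀ {a b c} → a ≈ₘ b → b ≈ₘ c → a ≈ₘ c
  ≈ₘ-trans {a} {b} {c} (mk≈ₘ h a≈) (mk≈ₘ k b≈) = mk≈ₘ (k + h) (begin
    a                    ≈⟨ a≈ ⟩
    b + h * m            ≈⟨ +-congʳ b≈ ⟩
    (c + k * m) + h * m  ≈⟨ solve 4 (λ c k h m → (c :+ k :* m) :+ h :* m := c :+ (k :+ h) :* m) refl c k h m ⟩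
    c + (k + h) * m      ∎)

  +-congₘ : ∀ {a b c d} → a ≈ₘ b → c ≈ₘ d → a + c ≈ₘ b + d
  +-congₘ {a} {b} {c} {d} (mk≈ₘ h a≈) (mk≈ₘ k c≈) = mk≈ₘ (h + k) (begin
    a + c                      ≈⟨ +-cong a≈ c≈ ⟩
    (b + h * m) + (d + k * m)  ≈⟨ solve 5 (λ b d h k m → (b :+ h :* m) :+ (d :+ k :* m) := (b :+ d) :+ (h :+ k) :* m) refl b d h k m ⟩
    (b + d) + (h + k) * m      ∎)

  *-congₘ : ∀ {a b c d} → a ≈ₘ b → c ≈ₘ d → a * c ≈ₘ b * d
  *-congₘ {a} {b} {c} {d} (mk≈ₘ h a≈) (mk≈ₘ k c≈) = mk≈ₘ ((h * d + b * k) + h * m * k) (begin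
    a * c                      ≈⟨ *-cong a≈ c≈ ⟩
    (b + h * m) * (d + k * m)  ≈⟨ solve 5 (λ b d h k m → (b :+ h :* m) :* (d :+ k :* m) := (b :* d) :+ ((h :* d :+ b :* k) :+ h :* m :* k) :* m) refl b d h k m ⟩
    b * d + ((h * d + b * k) + h * m * k) * m  ∎)

  -‿congₘ : ∀ {a b} → a ≈ₘ b → - a ≈ₘ - b
  -‿congₘ {a} {b} (mk≈ₘ h a≈) = mk≈ₘ (- h) (begin
    - a                ≈⟨ -‿cong a≈ ⟩
    - (b + h * m)      ≈⟨ -‿+-comm b (h * m) ⟨
    - b + - (h * m)    ≈⟨ +-congˡ (-‿distribˡ-* h m) ⟩
    - b + - h * m      ∎)

  quotientRing : CommutativeRing c (c ⊔ ℓ)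
  quotientRing = record
    { Carrier = Carrier
    ; _≈_     = _≈ₘ_
    ; _+_     = _+_
    ; _*_     = _*_
    ; -_      = -_
    ; 0#      = 0#
    ; 1#      = 1#
    ; isCommutativeRing = record
      { isRing = record
        { +-isAbelianGroup = record
          { isGroup = record
            { isMonoid = record
              { isSemigroup = record
                { isMagma = record
                  { isEquivalence = record
                    { refl = ≈⇒≈ₘ refl ; sym = ≈ₘ-sym ; trans = ≈ₘ-trans }
                  ; ∙-cong = +-congₘ
                  }
                ; assoc = λ a b c → ≈⇒≈ₘ (+-assoc a b c)
                }
              ; identity = (λ a → ≈⇒≈ₘ (+-identityˡ a)) , (λ a → ≈⇒≈ₘ (+-identityʳ a))
              }
            ; inverse = (λ a → ≈⇒≈ₘ (-‿inverseˡ a)) , (λ a → ≈⇒≈ₘ (-‿inverseʳ a))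
            ; ⁻¹-cong = -‿congₘ
            }
          ; comm = λ a b → ≈⇒≈ₘ (+-comm a b)
          }
        ; *-cong = *-congₘ
        ; *-assoc = λ a b c → ≈⇒≈ₘ (*-assoc a b c)
        ; *-identity = (λ a → ≈⇒≈ₘ (*-identityˡ a)) , (λ a → ≈⇒≈ₘ (*-identityʳ a))
        ; distrib = (λ a b c → ≈⇒≈ₘ (distribˡ a b c)) , (λ a b c → ≈⇒≈ₘ (distribʳ a b c))
        }
      ; *-comm = λ a b → ≈⇒≈ₘ (*-comm a b)
      }
    }

-- Polynomials over a commutative ring A, as lists of coefficients with the
-- constant term first. Trailing zeros are allowed, so equality is equality of
-- all coefficients rather than equality of lists.

module Polynomial {c ℓ} (A : CommutativeRing c ℓ) where

  private
    module A = CommutativeRing A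
    module AP = RingProperties A.ring
    module A+ = CSProperties A.+-commutativeSemigroup
    module A* = CSProperties A.*-commutativeSemigroup

  Poly : Set c
  Poly = List A.Carrier

  coeff : Poly → ℕ → A.Carrier
  coeff []      _       = A.0#
  coeff (a ∷ f) zero    = a
  coeff (a ∷ f) (suc k) = coeff f k

  infix  4 _≈_
  infixl 6 _+_
  infixl 7 _*_
  infixr 8 _·_
  infix  9 -_

  -- A record, so that the two polynomials can be inferred from a proof.
  record _≈_ (f g : Poly) : Set ℓ where
    constructor mk≈
    field coeff-≈ : ∀ k → coeff f k A.≈ coeff g k
  open _≈_ public

  _+_ : Poly → Poly → Poly
  []      + g       = g
  (a ∷ f) + []      = a ∷ f
  (a ∷ f) + (b ∷ g) = (a A.+ b) ∷ (f + g)

  _·_ : A.Carrier → Poly → Poly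
  a · f = map (a A.*_) f

  -_ : Poly → Poly
  -_ = map (λ a → A.- a)

  _*_ : Poly → Poly → Poly
  []      * g = []
  (a ∷ f) * g = a · g + (A.0# ∷ f * g)

  0ₚ 1ₚ : Poly
  0ₚ = []
  1ₚ = A.1# ∷ []

  x^_ : ℕ → Poly
  x^ k = replicate k A.0# ++ 1ₚ

  coeff-+ : ∀ f g k → coeff (f + g) k A.≈ coeff f k A.+ coeff g k
  coeff-+ []      g       k       = A.sym (A.+-identityˡ _)
  coeff-+ (a ∷ f) []      k       = A.sym (A.+-identityʳ _)
  coeff-+ (a ∷ f) (b ∷ g) zero    = A.refl
  coeff-+ (a ∷ f) (b ∷ g) (suc k) = coeff-+ f g k

  coeff-· : ∀ a f k → coeff (a · f) k A.≈ a A.* coeff f k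
  coeff-· a []      k       = A.sym (A.zeroʳ a)
  coeff-· a (b ∷ f) zero    = A.refl
  coeff-· a (b ∷ f) (suc k) = coeff-· a f k

  coeff-neg : ∀ f k → coeff (- f) k A.≈ A.- coeff f k
  coeff-neg []      k       = A.sym AP.-0#≈0#
  coeff-neg (a ∷ f) zero    = A.refl
  coeff-neg (a ∷ f) (suc k) = coeff-neg f k

  ≈-refl : ∀ {f} → f ≈ f
  ≈-refl = mk≈ λ k → A.refl

  ≈-sym : ∀ {f g} → f ≈ g → g ≈ f
  ≈-sym e = mk≈ λ k → A.sym (coeff-≈ e k)

  ≈-trans : ∀ {f g h} → f ≈ g → g ≈ h → f ≈ h
  ≈-trans e e′ = mk≈ λ k → A.trans (coeff-≈ e k) (coeff-≈ e′ k)

  ≈-setoid : Setoid c ℓ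
  ≈-setoid = record
    { Carrier = Poly ; _≈_ = _≈_
    ; isEquivalence = record { refl = ≈-refl ; sym = ≈-sym ; trans = ≈-trans } }

  ∷-cong : ∀ {a b f g} → a A.≈ b → f ≈ g → a ∷ f ≈ b ∷ g
  ∷-cong a≈b f≈g = mk≈ λ { zero → a≈b ; (suc k) → coeff-≈ f≈g k }

  0∷-zero : ∀ {f} → f ≈ [] → A.0# ∷ f ≈ []
  0∷-zero e = mk≈ λ { zero → A.refl ; (suc k) → coeff-≈ e k }

  +-cong : ∀ {f f′ g g′} → f ≈ f′ → g ≈ g′ → f + g ≈ f′ + g′
  +-cong {f} {f′} {g} {g′} e e′ = mk≈ λ k → A.trans (coeff-+ f g k)
    (A.trans (A.+-cong (coeff-≈ e k) (coeff-≈ e′ k)) (A.sym (coeff-+ f′ g′ k)))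

  +-assoc : ∀ f g h → (f + g) + h ≈ f + (g + h)
  +-assoc f g h = mk≈ λ k → begin
    coeff ((f + g) + h) k                         ≈⟨ coeff-+ (f + g) h k ⟩
    coeff (f + g) k A.+ coeff h k                 ≈⟨ A.+-congʳ (coeff-+ f g k) ⟩
    (coeff f k A.+ coeff g k) A.+ coeff h k       ≈⟨ A.+-assoc _ _ _ ⟩
    coeff f k A.+ (coeff g k A.+ coeff h k)       ≈⟨ A.+-congˡ (coeff-+ g h k) ⟨
    coeff f k A.+ coeff (g + h) k                 ≈⟨ coeff-+ f (g + h) k ⟨
    coeff (f + (g + h)) k                         ∎
    where open SetoidReasoning A.setoid

  +-comm : ∀ f g → f + g ≈ g + f
  +-comm f g = mk≈ λ k → A.trans (coeff-+ f g k)
    (A.trans (A.+-comm _ _) (A.sym (coeff-+ g f k)))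

  +-identityʳ : ∀ f → f + [] ≈ f
  +-identityʳ f = +-comm f []

  -‿inverseʳ : ∀ f → f + - f ≈ []
  -‿inverseʳ f = mk≈ λ k → A.trans (coeff-+ f (- f) k)
    (A.trans (A.+-congˡ (coeff-neg f k)) (A.-‿inverseʳ _))

  -‿cong : ∀ {f g} → f ≈ g → - f ≈ - g
  -‿cong {f} {g} e = mk≈ λ k → A.trans (coeff-neg f k)
    (A.trans (A.-‿cong (coeff-≈ e k)) (A.sym (coeff-neg g k)))

  +-interchange : ∀ f g h k → (f + g) + (h + k) ≈ (f + h) + (g + k)
  +-interchange f g h k = mk≈ λ i → begin
    coeff ((f + g) + (h + k)) i  ≈⟨ expand f g h k i ⟩
    _                            ≈⟨ A+.interchange _ _ _ _ ⟩
    _                            ≈⟨ expand f h g k i ⟨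
    coeff ((f + h) + (g + k)) i  ∎
    where
    open SetoidReasoning A.setoid
    expand : ∀ f g h k i → coeff ((f + g) + (h + k)) i A.≈
             (coeff f i A.+ coeff g i) A.+ (coeff h i A.+ coeff k i)
    expand f g h k i = A.trans (coeff-+ (f + g) (h + k) i) (A.+-cong (coeff-+ f g i) (coeff-+ h k i))

  ·-cong : ∀ {a b f g} → a A.≈ b → f ≈ g → a · f ≈ b · g
  ·-cong {a} {b} {f} {g} e e′ = mk≈ λ k → A.trans (coeff-· a f k)
    (A.trans (A.*-cong e (coeff-≈ e′ k)) (A.sym (coeff-· b g k)))

  ·-distribˡ : ∀ a f g → a · (f + g) ≈ a · f + a · g
  ·-distribˡ a f g = mk≈ λ k → begin
    coeff (a · (f + g)) k                        ≈⟨ coeff-· a (f + g) k ⟩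
    a A.* coeff (f + g) k                        ≈⟨ A.*-congˡ (coeff-+ f g k) ⟩
    a A.* (coeff f k A.+ coeff g k)              ≈⟨ A.distribˡ _ _ _ ⟩
    a A.* coeff f k A.+ a A.* coeff g k          ≈⟨ A.+-cong (coeff-· a f k) (coeff-· a g k) ⟨
    coeff (a · f) k A.+ coeff (a · g) k          ≈⟨ coeff-+ (a · f) (a · g) k ⟨
    coeff (a · f + a · g) k                      ∎
    where open SetoidReasoning A.setoid

  ·-distribʳ : ∀ a b f → (a A.+ b) · f ≈ a · f + b · f
  ·-distribʳ a b f = mk≈ λ k → begin
    coeff ((a A.+ b) · f) k                      ≈⟨ coeff-· (a A.+ b) f k ⟩
    (a A.+ b) A.* coeff f k                      ≈⟨ A.distribʳ _ _ _ ⟩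
    a A.* coeff f k A.+ b A.* coeff f k          ≈⟨ A.+-cong (coeff-· a f k) (coeff-· b f k) ⟨
    coeff (a · f) k A.+ coeff (b · f) k          ≈⟨ coeff-+ (a · f) (b · f) k ⟨
    coeff (a · f + b · f) k                      ∎
    where open SetoidReasoning A.setoid

  ·-assoc : ∀ a b f → (a A.* b) · f ≈ a · (b · f)
  ·-assoc a b f = mk≈ λ k → begin
    coeff ((a A.* b) · f) k      ≈⟨ coeff-· (a A.* b) f k ⟩
    (a A.* b) A.* coeff f k      ≈⟨ A.*-assoc _ _ _ ⟩
    a A.* (b A.* coeff f k)      ≈⟨ A.*-congˡ (coeff-· b f k) ⟨
    a A.* coeff (b · f) k        ≈⟨ coeff-· a (b · f) k ⟨
    coeff (a · (b · f)) k        ∎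
    where open SetoidReasoning A.setoid

  ·-zeroˡ : ∀ f → A.0# · f ≈ []
  ·-zeroˡ f = mk≈ λ k → A.trans (coeff-· A.0# f k) (A.zeroˡ _)

  ·-identityˡ : ∀ f → A.1# · f ≈ f
  ·-identityˡ f = mk≈ λ k → A.trans (coeff-· A.1# f k) (A.*-identityˡ _)

  open SetoidReasoning ≈-setoid

  *-congˡ : ∀ f {g g′} → g ≈ g′ → f * g ≈ f * g′
  *-congˡ []      e = ≈-refl
  *-congˡ (a ∷ f) e = +-cong (·-cong A.refl e) (∷-cong A.refl (*-congˡ f e))

  *-zeroʳ : ∀ f → f * [] ≈ []
  *-zeroʳ []      = ≈-refl
  *-zeroʳ (a ∷ f) = 0∷-zero (*-zeroʳ f)

  0∷-distrib : ∀ f g → A.0# ∷ (f + g) ≈ (A.0# ∷ f) + (A.0# ∷ g)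
  0∷-distrib f g = ∷-cong (A.sym (A.+-identityˡ _)) ≈-refl

  *-distribˡ : ∀ f g h → f * (g + h) ≈ f * g + f * h
  *-distribˡ []      g h = ≈-refl
  *-distribˡ (a ∷ f) g h = begin
    a · (g + h) + (A.0# ∷ f * (g + h))
      ≈⟨ +-cong (·-distribˡ a g h) (≈-trans (∷-cong A.refl (*-distribˡ f g h)) (0∷-distrib (f * g) (f * h))) ⟩
    (a · g + a · h) + ((A.0# ∷ f * g) + (A.0# ∷ f * h))
      ≈⟨ +-interchange (a · g) (a · h) _ _ ⟩
    (a · g + (A.0# ∷ f * g)) + (a · h + (A.0# ∷ f * h)) ∎

  *-∷ : ∀ f b g → f * (b ∷ g) ≈ b · f + (A.0# ∷ f * g)
  *-∷ []      b g = ≈-sym (0∷-zero ≈-refl)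
  *-∷ (a ∷ f) b g = ∷-cong (A.+-congʳ (A.*-comm a b)) (begin
    a · g + f * (b ∷ g)               ≈⟨ +-cong ≈-refl (*-∷ f b g) ⟩
    a · g + (b · f + (A.0# ∷ f * g))  ≈⟨ +-assoc (a · g) (b · f) _ ⟨
    (a · g + b · f) + (A.0# ∷ f * g)  ≈⟨ +-cong (+-comm (a · g) (b · f)) ≈-refl ⟩
    (b · f + a · g) + (A.0# ∷ f * g)  ≈⟨ +-assoc (b · f) (a · g) _ ⟩
    b · f + (a · g + (A.0# ∷ f * g))  ∎)

  *-comm : ∀ f g → f * g ≈ g * f
  *-comm []      g = ≈-sym (*-zeroʳ g)
  *-comm (a ∷ f) g = begin
    a · g + (A.0# ∷ f * g)  ≈⟨ +-cong ≈-refl (∷-cong A.refl (*-comm f g)) ⟩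
    a · g + (A.0# ∷ g * f)  ≈⟨ *-∷ g a f ⟨
    g * (a ∷ f)             ∎

  *-cong : ∀ {f f′ g g′} → f ≈ f′ → g ≈ g′ → f * g ≈ f′ * g′
  *-cong {f} {f′} {g} {g′} e e′ = begin
    f * g    ≈⟨ *-congˡ f e′ ⟩
    f * g′   ≈⟨ *-comm f g′ ⟩
    g′ * f   ≈⟨ *-congˡ g′ e ⟩
    g′ * f′  ≈⟨ *-comm g′ f′ ⟩
    f′ * g′  ∎

  *-distribʳ : ∀ h f g → (f + g) * h ≈ f * h + g * h
  *-distribʳ h f g = begin
    (f + g) * h    ≈⟨ *-comm (f + g) h ⟩
    h * (f + g)    ≈⟨ *-distribˡ h f g ⟩
    h * f + h * g  ≈⟨ +-cong (*-comm h f) (*-comm h g) ⟩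
    f * h + g * h  ∎

  ·-*-assoc : ∀ a f g → (a · f) * g ≈ a · (f * g)
  ·-*-assoc a []      g = ≈-refl
  ·-*-assoc a (b ∷ f) g = begin
    (a A.* b) · g + (A.0# ∷ (a · f) * g)
      ≈⟨ +-cong (·-assoc a b g) (∷-cong (A.sym (A.zeroʳ a)) (·-*-assoc a f g)) ⟩
    a · (b · g) + a · (A.0# ∷ f * g)
      ≈⟨ ·-distribˡ a (b · g) _ ⟨
    a · (b · g + (A.0# ∷ f * g)) ∎

  0∷-* : ∀ f g → (A.0# ∷ f) * g ≈ A.0# ∷ f * g
  0∷-* f g = +-cong (·-zeroˡ g) ≈-refl

  *-assoc : ∀ f g h → (f * g) * h ≈ f * (g * h)
  *-assoc []      g h = ≈-refl
  *-assoc (a ∷ f) g h = begin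
    (a · g + (A.0# ∷ f * g)) * h        ≈⟨ *-distribʳ h (a · g) _ ⟩
    (a · g) * h + (A.0# ∷ f * g) * h    ≈⟨ +-cong (·-*-assoc a g h) (0∷-* (f * g) h) ⟩
    a · (g * h) + (A.0# ∷ (f * g) * h)  ≈⟨ +-cong ≈-refl (∷-cong A.refl (*-assoc f g h)) ⟩
    a · (g * h) + (A.0# ∷ f * (g * h))  ∎

  *-identityˡ : ∀ f → 1ₚ * f ≈ f
  *-identityˡ f = begin
    A.1# · f + (A.0# ∷ [])  ≈⟨ +-cong (·-identityˡ f) (0∷-zero ≈-refl) ⟩
    f + []                  ≈⟨ +-identityʳ f ⟩
    f                       ∎

  polynomialRing : CommutativeRing c ℓ
  polynomialRing = record
    { Carrier = Poly
    ; _≈_     = _≈_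
    ; _+_     = _+_
    ; _*_     = _*_
    ; -_      = -_
    ; 0#      = 0ₚ
    ; 1#      = 1ₚ
    ; isCommutativeRing = record
      { isRing = record
        { +-isAbelianGroup = record
          { isGroup = record
            { isMonoid = record
              { isSemigroup = record
                { isMagma = record
                  { isEquivalence = Setoid.isEquivalence ≈-setoid
                  ; ∙-cong = +-cong
                  }
                ; assoc = +-assoc
                }
              ; identity = (λ f → ≈-refl) , +-identityʳ
              }
            ; inverse = (λ f → ≈-trans (+-comm (- f) f) (-‿inverseʳ f)) , -‿inverseʳ
            ; ⁻¹-cong = -‿cong
            }
          ; comm = +-comm
          }
        ; *-cong = *-cong
        ; *-assoc = *-assoc
        ; *-identity = *-identityˡ , (λ f → ≈-trans (*-comm f 1ₚ) (*-identityˡ f))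
        ; distrib = *-distribˡ , *-distribʳ
        }
      ; *-comm = *-comm
      }
    }

-- Its carrier is ℤ, so an integer is read in ℤ/m as itself.
ℤ/ : ℕ → CommutativeRing _ _
ℤ/ m = Quotient.quotientRing ℤₚ.+-*-commutativeRing (+ m)

infix 4 _≡_[mod_]
_≡_[mod_] : ℤ → ℤ → ℕ → Set
a ≡ b [mod m ] = CommutativeRing._≈_ (ℤ/ m) a b

φ : ℕ → ℕ
φ n = length (filter (λ k → coprime? k n) (map suc (upTo n)))

-- ord_m(k) = d.
record IsOrder (m : ℕ) (k : ℤ) (d : ℕ) : Set where
  field
    positive : 1 ≤ d
    k^d≡1    : (k ℤ.^ d) ≡ + 1 [mod m ]
    minimal  : ∀ e → 1 ≤ e → (k ℤ.^ e) ≡ + 1 [mod m ] → d ≤ e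

IsPrimitiveRoot : ℕ → ℤ → Set
IsPrimitiveRoot m g = IsOrder m g (φ m)

QuadraticResidue : ℕ → ℕ → Set
QuadraticResidue m a = Coprime a m × ∃[ x ] (x ℤ.* x) ≡ + a [mod m ]

QuadraticNonresidue : ℕ → ℕ → Set
QuadraticNonresidue m a = Coprime a m × ¬ (∃[ x ] (x ℤ.* x) ≡ + a [mod m ])

module Cyclotomic (l n : ℕ) where

  -- α ∈C γ : the least nonnegative residue α lies in C_γ = {γ lʳ mod n : r ≥ 0}.
  infix 4 _∈C_
  _∈C_ : Fin n → ℤ → Set
  α ∈C γ = ∃[ r ] (+ toℕ α) ≡ γ ℤ.* (+ l) ℤ.^ r [mod n ]

  private
    open Quotient ℤₚ.+-*-commutativeRing (+ n) using (mk≈ₘ)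

    _≡?_ : ∀ a b → Dec (a ≡ b [mod n ])
    a ≡? b = map′ to from (+ n ℤ∣.∣? (a ℤ.- b))
      where
      to : + n ℤ∣.∣ (a ℤ.- b) → a ≡ b [mod n ]
      to (ℤ∣.divides h e) = mk≈ₘ h (≡.trans
        (solve 2 (λ a b → a := b :+ (a :- b)) ≡.refl a b) (≡.cong (λ c → b ℤ.+ c) e))
        where open ℤ-Solver
      from : a ≡ b [mod n ] → + n ℤ∣.∣ (a ℤ.- b)
      from (mk≈ₘ h e) = ℤ∣.divides h (≡.trans (≡.cong (λ c → c ℤ.- b) e)
        (solve 2 (λ b c → (b :+ c) :- b := c) ≡.refl b (h ℤ.* + n)))
        where open ℤ-Solver

    module _ .{{_ : NonZero n}} (γ : ℤ) where
      open CommutativeRing (ℤ/ n) using (_≈_; sym; trans; reflexive; *-cong; refl)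

      term : ℕ → ℤ
      term r = γ ℤ.* (+ l) ℤ.^ r

      residue : ℤ → Fin n
      residue a = fromℕ< (n%ℕd<d a n)

      residue-≈ : ∀ a → a ≈ + toℕ (residue a)
      residue-≈ a = mk≈ₘ (a /ℕ n) (≡.trans (a≡a%ℕn+[a/ℕn]*n a n)
        (≡.cong (λ m → + m ℤ.+ (a /ℕ n) ℤ.* + n) (≡.sym (toℕ-fromℕ< (n%ℕd<d a n)))))

      term-+ : ∀ i d → term (i ℕ.+ d) ≡ term i ℤ.* (+ l) ℤ.^ d
      term-+ i d = ≡.trans (≡.cong (γ ℤ.*_) (ℤₚ.^-distribˡ-+-* (+ l) i d))
        (≡.sym (ℤₚ.*-assoc γ _ _))

      collision : ∃[ i ] ∃[ j ] i < j × j ≤ n × term i ≈ term j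
      collision with i , j , i<j , e ← pigeonhole (ℕₚ.n<1+n n) (λ r → residue (term (toℕ r))) =
        toℕ i , toℕ j , i<j , ℕₚ.≤-pred (toℕ<n j) ,
        trans (residue-≈ _) (trans (reflexive (≡.cong (λ r → + toℕ r) e)) (sym (residue-≈ _)))

      term-shift : ∀ {i j} d → term i ≈ term j → term (i ℕ.+ d) ≈ term (j ℕ.+ d)
      term-shift {i} {j} d e = trans (reflexive (term-+ i d))
        (trans (*-cong e (refl {(+ l) ℤ.^ d})) (sym (reflexive (term-+ j d))))

      ReducesTo< : ℕ → Set
      ReducesTo< r = ∃[ r′ ] r′ < n × term r ≈ term r′

      -- By pigeonhole every element of C_γ is already γ lʳ for some r < n.
      reduce : ∀ r → ReducesTo< r
      reduce = <-rec ReducesTo< λ r ih → step r ih collision (r ℕₚ.<? n)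
        where
        step : ∀ r → (∀ {k} → k < r → ReducesTo< k) →
               ∃[ i ] ∃[ j ] i < j × j ≤ n × term i ≈ term j → Dec (r < n) → ReducesTo< r
        step r ih _ (yes r<n) = r , r<n , refl
        step r ih (i , j , i<j , j≤n , eq) (no r≮n) = conclude (ih i+d<r)
          where
          d : ℕ
          d = r ∸ j
          j+d≡r : j ℕ.+ d ≡ r
          j+d≡r = ℕₚ.m+[n∸m]≡n (ℕₚ.≤-trans j≤n (ℕₚ.≮⇒≥ r≮n))
          i+d<r : i ℕ.+ d < r
          i+d<r = ≡.subst (i ℕ.+ d <_) j+d≡r (ℕₚ.+-monoˡ-< d i<j)
          conclude : ReducesTo< (i ℕ.+ d) → ReducesTo< r
          conclude (r′ , r′<n , e) = r′ , r′<n ,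
            trans (reflexive (≡.cong term (≡.sym j+d≡r))) (trans (term-shift {j} {i} d (sym eq)) e)

      search : ∀ α → Dec (α ∈C γ)
      search α = map′ (λ (r , e) → toℕ r , e) (λ (r , e) → bound {r} e (reduce r))
                      (any? λ r → (+ toℕ α) ≡? term (toℕ r))
        where
        bound : ∀ {r} → (+ toℕ α) ≈ term r → ReducesTo< r → ∃[ r′ ] (+ toℕ α) ≈ term (toℕ {n} r′)
        bound e (r′ , r′<n , e′) = fromℕ< r′<n ,
          trans e (trans e′ (reflexive (≡.cong term (≡.sym (toℕ-fromℕ< r′<n)))))

  _∈C?_ : ∀ α γ → Dec (α ∈C γ)
  α ∈C? γ = search {{nonZeroIndex α}} γ α

  private
    module 𝔽ₗ[x] = Polynomial (ℤ/ l)

  -- 𝔽ₗ[x]/⟨xⁿ - 1⟩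
  R : CommutativeRing _ _
  R = Quotient.quotientRing 𝔽ₗ[x].polynomialRing (𝔽ₗ[x].x^ n 𝔽ₗ[x].+ 𝔽ₗ[x].- 𝔽ₗ[x].1ₚ)

  open CommutativeRing R public using (Carrier; _≈_; _+_; _*_; 0#)
  open 𝔽ₗ[x] public using (_·_)

  ∑ : ∀ {A : Set} → List A → (A → Carrier) → Carrier
  ∑ xs f = foldr _+_ 0# (map f xs)

  χ[_] : ℤ → Carrier
  χ[ γ ] = ∑ (filter (_∈C? γ) (allFin n)) (λ α → 𝔽ₗ[x].x^ toℕ α)

module Setup (p q l s t : ℕ) (g : ℤ) where

  open Cyclotomic l (p ℕ.^ s ℕ.* q ℕ.^ t) public

  χ χ* : ℕ → ℕ → Carrier
  χ  i j = χ[ + (p ℕ.^ i ℕ.* q ℕ.^ j) ]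
  χ* i j = χ[ + (p ℕ.^ i ℕ.* q ℕ.^ j) ℤ.* g ]

  -- ∑[ i < k < b ] f k is the sum over all k strictly between i and b.
  ∑-between : ℕ → ℕ → (ℕ → Carrier) → Carrier
  ∑-between i b = ∑ (filter (i ℕₚ.<?_) (upTo b))

  infixr 7 ∑-between
  syntax ∑-between i b (λ k → e) = ∑[ i < k < b ] e

{-# OPTIONS --safe #-}

-- Modulo pˢ the powers of l are the quadratic residues (l has odd order φ(pˢ)/2, and g is not
-- one of its powers), and modulo qᵗ they are all units; as the two orders are coprime, the
-- Chinese remainder theorem shows that the indicator function of the coset of pⁱ qʲ or pⁱ qʲ g
-- factors into a function of the residue modulo pˢ (divisibility by pⁱ and the Legendre symbol
-- of the cofactor) and one of the residue modulo qᵗ (the q-adic valuation). Multiplication in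
-- 𝔽ₗ[x]/⟨xⁿ - 1⟩ convolves indicator functions, and the convolution factors in the same way.
-- For j < j′ the q-part contributes φ(qᵗ⁻ʲ′) and keeps the valuation j; the p-part is counted by
-- the cyclotomic numbers of order two modulo p. The p-cofactors of the two cosets have equal
-- Legendre symbols in (i) and (ii) and opposite ones in (iii); as -1 is a nonresidue, only in
-- (iii) do sums divisible by pⁱ⁺¹ occur.

module Submission where

open import Defs
open import Algebra.Bundles using (CommutativeRing; CommutativeMonoid)
import Algebra.Properties.AbelianGroup as AbelianGroupProperties
import Algebra.Properties.CommutativeSemigroup as CommutativeSemigroupProperties
open import Data.Fin.Base as Fin using (Fin; toℕ; fromℕ<)
open import Data.Fin.Permutation using (permutation)
import Data.Fin.Properties as Finₚ
open import Data.Integer.Base as ℤ using (ℤ; +_; ∣_∣)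
import Data.Integer.Divisibility.Signed as ℤ∣
open import Data.Integer.DivMod using (_%ℕ_; _/ℕ_; n%ℕd<d; a≡a%ℕn+[a/ℕn]*n)
import Data.Integer.Properties as ℤₚ
open import Data.Integer.Tactic.RingSolver using (solve-∀)
open import Data.List.Base using (List; []; _∷_; _++_; applyUpTo; filter; length; map; tabulate; upTo)
open import Data.List.Membership.Propositional using (_∈_)
open import Data.List.Membership.Propositional.Properties using (∈-filter⁺; ∈-map⁺; ∈-upTo⁺)
open import Data.List.Membership.Setoid.Properties using (index-injective)
open import Data.List.Properties using (filter-++; filter-accept; filter-none; filter-reject; map-upTo; upTo-∷ʳ)
open import Data.List.Relation.Unary.All.Properties using (applyUpTo⁺₁)
open import Data.List.Relation.Unary.Any using (index)
open import Data.Nat.Base as ℕ using (ℕ; zero; suc; NonZero; _∸_; _^_; _/_; _%_; _≤_; _<_; s≤s; z≤n)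
open import Data.Nat.Coprimality as Coprimality using (Coprime; coprime?; coprime-Bézout)
open import Data.Nat.Divisibility as ℕ∣ using (_∣_; _∤_)
open import Data.Nat.DivMod using (m*n/n≡m; m≡m%n+[m/n]*n; m%n<n)
open import Data.Nat.GCD using (gcd; gcd-greatest; module Bézout)
open import Data.Nat.Primality using (Prime; irreducible[2]; prime⇒irreducible; prime⇒nonTrivial; prime⇒nonZero)
import Data.Nat.Properties as ℕₚ
import Data.Nat.Tactic.RingSolver as ℕRing
open import Data.Product.Base using (∃-syntax; _×_; _,_; proj₁; proj₂)
open import Data.Sign.Base as Sign using (Sign; opposite)
open import Data.Sum.Base using ([_,_]′; _⊎_; inj₁; inj₂)
open import Function.Base using (_∘_; id)
open import Relation.Binary.PropositionalEquality as ≡ using (_≡_; _≢_; refl; sym; trans; cong; cong₂; subst)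
import Relation.Binary.Reasoning.Setoid as SetoidReasoning
open import Relation.Nullary using (¬_; Dec; yes; no; contradiction)
open import Relation.Nullary.Decidable using (map′; ¬?; _×-dec_; _→-dec_)
open import Relation.Unary using (Decidable)

-- The obstacle is that dividing pⁱ qʲ x by pⁱ leaves qʲ x, whose Legendre symbol modulo p is that
-- of x times the j-th power of the symbol of q. Each factor q thus twists the class seen by the
-- p-part, and comparing the twists for j and j′ brings in the quadratic character of q and the
-- parity of j′ - j. Counting is done with integer-valued functions on ℤ; coefficients are read
-- modulo l only when such a function is turned into a polynomial. With p = 4k + 3 the numbers of
-- ways to write 1 as a sum of two elements of given classes follow from symmetries, without
-- character sums: all are k = (p - 3)/4, except that two nonresidues sum to 1 in k + 1 = (p + 1)/4
-- ways. The factor pˢ⁻ⁱ⁻¹ arises because cofactors of pⁱ run modulo pˢ⁻ⁱ while their class depends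
-- only on the residue modulo p. In (iii) the p-part also yields all multiples of pⁱ⁺¹; sorting
-- these by p-adic valuation gives the sum over k and the last coset sum, that of pˢ qʲ.

private
  module ℤ+ = AbelianGroupProperties ℤₚ.+-0-abelianGroup
  module ℕ* = CommutativeSemigroupProperties ℕₚ.*-commutativeSemigroup
  module ℤ* = CommutativeSemigroupProperties ℤₚ.*-commutativeSemigroup

-- Congruences and Bézout coprimality over ℤ.

module Congruence where

  open import Data.Integer.Base using (_+_; _*_; -_; _-_)
  open Quotient ℤₚ.+-*-commutativeRing using (mk≈ₘ)

  module _ {m : ℕ} where
    open CommutativeRing (ℤ/ m) public using () renaming
      ( refl to mod-refl; sym to mod-sym; trans to mod-trans; reflexive to mod-reflexive
      ; +-cong to mod-+; *-cong to mod-*; -‿cong to mod-neg; setoid to mod-setoid )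

  mod-- : ∀ {m a b c d} → a ≡ b [mod m ] → c ≡ d [mod m ] → a - c ≡ b - d [mod m ]
  mod-- a≡b c≡d = mod-+ a≡b (mod-neg c≡d)

  mod-^ : ∀ {m a b} k → a ≡ b [mod m ] → a ℤ.^ k ≡ b ℤ.^ k [mod m ]
  mod-^ zero    a≡b = mod-refl
  mod-^ (suc k) a≡b = mod-* a≡b (mod-^ k a≡b)

  mod⇒∣ : ∀ {m a b} → a ≡ b [mod m ] → + m ℤ∣.∣ a - b
  mod⇒∣ {m} {a} {b} (mk≈ₘ h e) = ℤ∣.divides h (trans (cong (_- b) e) (lemma b (h * + m)))
    where
    lemma : ∀ b c → b + c - b ≡ c
    lemma = solve-∀

  ∣⇒mod : ∀ {m a b} → + m ℤ∣.∣ a - b → a ≡ b [mod m ]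
  ∣⇒mod {m} {a} {b} (ℤ∣.divides h e) = mk≈ₘ h (trans (lemma a b) (cong (λ c → b + c) e))
    where
    lemma : ∀ a b → a ≡ b + (a - b)
    lemma = solve-∀

  mod0⇒∣ : ∀ {m a} → a ≡ + 0 [mod m ] → + m ℤ∣.∣ a
  mod0⇒∣ {m} (mk≈ₘ h e) = ℤ∣.divides h (trans e (ℤₚ.+-identityˡ _))

  ∣⇒mod0 : ∀ {m a} → + m ℤ∣.∣ a → a ≡ + 0 [mod m ]
  ∣⇒mod0 (ℤ∣.divides h e) = mk≈ₘ h (trans e (sym (ℤₚ.+-identityˡ _)))

  abstract
    mod? : ∀ m a b → Dec (a ≡ b [mod m ])
    mod? m a b = map′ ∣⇒mod mod⇒∣ (+ m ℤ∣.∣? (a - b))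

  mod-weaken : ∀ {m n a b} → m ∣ n → a ≡ b [mod n ] → a ≡ b [mod m ]
  mod-weaken m∣n a≡b = ∣⇒mod (ℤ∣.∣-trans (ℤ∣.∣ᵤ⇒∣ m∣n) (mod⇒∣ a≡b))

  mod-step : ∀ {m} k → + m * k ≡ + 0 [mod m ]
  mod-step {m} k = mk≈ₘ k (trans (ℤₚ.*-comm (+ m) k) (sym (ℤₚ.+-identityˡ _)))

  abstract
    residue : (m : ℕ) .{{_ : NonZero m}} → ℤ → Fin m
    residue m a = fromℕ< (n%ℕd<d a m)

    residue-mod : ∀ m .{{_ : NonZero m}} a → + toℕ (residue m a) ≡ a [mod m ]
    residue-mod m a = mod-sym (mk≈ₘ (a /ℕ m) (trans (a≡a%ℕn+[a/ℕn]*n a m)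
      (cong (λ r → + r + (a /ℕ m) * + m) (sym (Finₚ.toℕ-fromℕ< (n%ℕd<d a m))))))

  mod⇒∣∸ : ∀ {m a b} → b ≤ a → + a ≡ + b [mod m ] → m ∣ a ∸ b
  mod⇒∣∸ {m} {a} {b} b≤a e =
    subst (m ∣_) (cong ∣_∣ (trans (ℤₚ.m-n≡m⊖n a b) (ℤₚ.⊖-≥ b≤a))) (ℤ∣.∣⇒∣ᵤ (mod⇒∣ e))

  mod⇒≡ : ∀ {m a b} → a < m → b < m → + a ≡ + b [mod m ] → a ≡ b
  mod⇒≡ {m} a<m b<m e = ℕₚ.≤-antisym (half a<m e) (half b<m (mod-sym e))
    where
    half : ∀ {a b} → a < m → + a ≡ + b [mod m ] → a ≤ b
    half {a} {b} a<m e with a ℕₚ.≤? b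
    ... | yes a≤b = a≤b
    ... | no a≰b = contradiction (ℕ∣.∣⇒≤ {{ℕ.≢-nonZero (ℕₚ.m>n⇒m∸n≢0 b<a)}} (mod⇒∣∸ (ℕₚ.<⇒≤ b<a) e))
                     (ℕₚ.<⇒≱ (ℕₚ.≤-<-trans (ℕₚ.m∸n≤m a b) a<m))
      where
      b<a : b < a
      b<a = ℕₚ.≰⇒> a≰b

  -- Bézout coprimality, which unlike Coprime is directly usable over ℤ.
  Comaximal : ℤ → ℤ → Set
  Comaximal a b = ∃[ x ] ∃[ y ] x * a + y * b ≡ + 1

  comaximal-sym : ∀ {a b} → Comaximal a b → Comaximal b a
  comaximal-sym (x , y , e) = y , x , trans (ℤₚ.+-comm (y * _) (x * _)) e

  -- Multiply the two Bézout identities: every term except `x * u * (a * b)` contains the factor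
  -- `c`.
  comaximal-* : ∀ {a b c} → Comaximal a c → Comaximal b c → Comaximal (a * b) c
  comaximal-* {a} {b} {c} (x , y , e) (u , v , f) =
    x * u , x * a * v + y * u * b + y * c * v , trans (lemma x u a b c v y) (cong₂ _*_ e f)
    where
    lemma : ∀ x u a b c v y → x * u * (a * b) + (x * a * v + y * u * b + y * c * v) * c ≡ (x * a + y * c) *
        (u * b + v * c)
    lemma = solve-∀

  comaximal-1 : ∀ {c} → Comaximal (+ 1) c
  comaximal-1 {c} = + 1 , + 0 , refl

  comaximal-^ : ∀ {a c} k → Comaximal a c → Comaximal (a ℤ.^ k) c
  comaximal-^ zero    _ = comaximal-1
  comaximal-^ (suc k) h = comaximal-* h (comaximal-^ k h)

  comaximal-mod : ∀ {a b m} → a ≡ b [mod m ] → Comaximal b (+ m) → Comaximal a (+ m)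
  comaximal-mod {a} {b} {m} (mk≈ₘ h e) (x , y , f) = x , y - x * h ,
    trans (cong (λ c → x * c + (y - x * h) * + m) e) (trans (lemma x y b h (+ m)) f)
    where
    lemma : ∀ x y b h m → x * (b + h * m) + (y - x * h) * m ≡ x * b + y * m
    lemma = solve-∀

  mod-inverse : ∀ {a m} → Comaximal a (+ m) → ∃[ x ] x * a ≡ + 1 [mod m ]
  mod-inverse {a} {m} (x , y , e) = x , mk≈ₘ (- y) (trans (lemma (x * a) y (+ m)) (cong (_+ - y * + m) e))
    where
    lemma : ∀ z y m → z ≡ z + y * m + - y * m
    lemma = solve-∀

  inverse⇒comaximal : ∀ {a m} x → x * a ≡ + 1 [mod m ] → Comaximal a (+ m)
  inverse⇒comaximal {a} {m} x (mk≈ₘ h e) = x , - h , trans (cong (_+ - h * + m) e) (lemma h (+ m))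
    where
    lemma : ∀ h m → + 1 + h * m + - h * m ≡ + 1
    lemma = solve-∀

  mod-cancel : ∀ {m a b} c → Comaximal c (+ m) → c * a ≡ c * b [mod m ] → a ≡ b [mod m ]
  mod-cancel {m} {a} {b} c cop e with x , xc≡1 ← mod-inverse cop = mod-trans (mod-sym (undo a))
      (mod-trans (mod-* (mod-refl {x = x}) e) (undo b))
    where
    undo : ∀ a → x * (c * a) ≡ a [mod m ]
    undo a = mod-trans (mod-reflexive (sym (ℤₚ.*-assoc x c a)))
        (mod-trans (mod-* xc≡1 mod-refl) (mod-reflexive (ℤₚ.*-identityˡ a)))

  -- Multiply `a - b` by the Bézout identity; in each summand write `a - b` as a multiple of the
  -- modulus that is not yet a factor.
  mod-combine : ∀ {m n a b} → Comaximal (+ m) (+ n) → a ≡ b [mod m ] → a ≡ b [mod n ] → a ≡ b [mod m ℕ.* n ]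
  mod-combine {m} {n} {a} {b} (x , y , e) a≡b₁ a≡b₂
    with ℤ∣.divides h f ← mod⇒∣ a≡b₁ | ℤ∣.divides k g ← mod⇒∣ a≡b₂ =
    ∣⇒mod (ℤ∣.divides (x * k + y * h) (begin
      a - b                                           ≡⟨ ℤₚ.*-identityʳ (a - b) ⟨
      (a - b) * + 1                                   ≡⟨ cong ((a - b) *_) e ⟨
      (a - b) * (x * + m + y * + n)                   ≡⟨ ℤₚ.*-distribˡ-+ (a - b) (x * + m) (y * + n) ⟩
      (a - b) * (x * + m) + (a - b) * (y * + n)       ≡⟨ cong₂ (λ c d → c * (x * + m) + d * (y * + n)) g f ⟩
      k * + n * (x * + m) + h * + m * (y * + n)       ≡⟨ lemma x y h k (+ m) (+ n) ⟩
      (x * k + y * h) * (+ m * + n)                   ≡⟨ cong ((x * k + y * h) *_) (ℤₚ.pos-* m n) ⟨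
      (x * k + y * h) * + (m ℕ.* n)                   ∎))
    where
    open ≡.≡-Reasoning
    lemma : ∀ x y h k m n → k * n * (x * m) + h * m * (y * n) ≡ (x * k + y * h) * (m * n)
    lemma = solve-∀

  comaximal-∣∣ : ∀ {a c} → Comaximal (+ ∣ a ∣) c → Comaximal a c
  comaximal-∣∣ {a} {c} h with ℤₚ.+∣i∣≡i⊎+∣i∣≡-i a
  ... | inj₁ e = subst (λ z → Comaximal z c) e h
  ... | inj₂ e with x , y , f ← subst (λ z → Comaximal z c) e h = - x , y , trans (cong (_+ y * c) (lemma x a)) f
    where
    lemma : ∀ x a → - x * a ≡ x * - a
    lemma = solve-∀

  bézout⇒comaximal : ∀ x y m n → 1 ℕ.+ y ℕ.* n ≡ x ℕ.* m → Comaximal (+ m) (+ n)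
  bézout⇒comaximal x y m n e = + x , - (+ y) ,
    trans (cong (_+ - (+ y) * + n) x*m≡1+y*n) (lemma (+ y) (+ n))
    where
    x*m≡1+y*n : + x * + m ≡ + 1 + + y * + n
    x*m≡1+y*n = trans (sym (ℤₚ.pos-* x m)) (trans (cong +_ (sym e)) (cong (λ z → + 1 + z) (ℤₚ.pos-* y n)))
    lemma : ∀ y n → + 1 + y * n + - y * n ≡ + 1
    lemma = solve-∀

  coprime⇒comaximal : ∀ {m n} → Coprime m n → Comaximal (+ m) (+ n)
  coprime⇒comaximal {m} {n} c with coprime-Bézout c
  ... | Bézout.+- x y e = bézout⇒comaximal x y m n e
  ... | Bézout.-+ x y e = comaximal-sym (bézout⇒comaximal y x n m e)

  comaximal⇒coprime : ∀ {a n} → Comaximal a (+ n) → Coprime ∣ a ∣ n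
  comaximal⇒coprime {a} {n} (x , y , e) {d} (d∣a , d∣n) =
    ℕ∣.∣1⇒≡1 (ℤ∣.∣⇒∣ᵤ (subst (+ d ℤ∣.∣_) e
      (ℤ∣.∣m∣n⇒∣m+n (ℤ∣.∣n⇒∣m*n x (ℤ∣.∣ᵤ⇒∣ d∣a)) (ℤ∣.∣n⇒∣m*n y (ℤ∣.∣ᵤ⇒∣ d∣n)))))

  prime-comaximal : ∀ {p} → Prime p → ∀ a → (+ p ℤ∣.∣ a) ⊎ Comaximal a (+ p)
  prime-comaximal {p} pr a with + p ℤ∣.∣? a
  ... | yes p∣a = inj₁ p∣a
  ... | no p∤a = inj₂ (comaximal-∣∣ (coprime⇒comaximal λ {d} (d∣a , d∣p) → go d∣a (prime⇒irreducible pr d∣p)))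
    where
    go : ∀ {d} → d ∣ ∣ a ∣ → d ≡ 1 ⊎ d ≡ p → d ≡ 1
    go d∣a (inj₁ e) = e
    go d∣a (inj₂ e) = contradiction (ℤ∣.∣ᵤ⇒∣ (subst (_∣ ∣ a ∣) e d∣a)) p∤a

  pos-^ : ∀ a k → + (a ^ k) ≡ (+ a) ℤ.^ k
  pos-^ a zero    = refl
  pos-^ a (suc k) = trans (ℤₚ.pos-* a (a ^ k)) (cong (+ a *_) (pos-^ a k))

  comaximal-pow : ∀ {a p} k → Comaximal a (+ p) → Comaximal a (+ (p ^ k))
  comaximal-pow {a} {p} k h = comaximal-sym (subst (λ z → Comaximal z a) (sym (pos-^ p k))
      (comaximal-^ k (comaximal-sym h)))

  ^-distribʳ-* : ∀ a b k → (a * b) ℤ.^ k ≡ a ℤ.^ k * b ℤ.^ k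
  ^-distribʳ-* a b zero    = refl
  ^-distribʳ-* a b (suc k) = trans (cong (a * b *_) (^-distribʳ-* a b k)) (lemma a b (a ℤ.^ k) (b ℤ.^ k))
    where
    lemma : ∀ a b c d → a * b * (c * d) ≡ a * c * (b * d)
    lemma = solve-∀

  comaximal⇒∤ : ∀ {p x} → Prime p → Comaximal x (+ p) → ¬ (+ p ℤ∣.∣ x)
  comaximal⇒∤ {p} pr c p∣x = ℕ.nonTrivial⇒≢1 {{prime⇒nonTrivial pr}} (comaximal⇒coprime c (ℤ∣.∣⇒∣ᵤ p∣x , ℕ∣.∣-refl))

  comaximal-∣ : ∀ {m n x} → m ∣ n → Comaximal x (+ n) → Comaximal x (+ m)
  comaximal-∣ {m} {x = x} (ℕ∣.divides c refl) (u , v , e) = u , v * + c ,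
    trans (cong (λ z → u * x + z) (trans (ℤₚ.*-assoc v (+ c) (+ m)) (cong (v *_) (sym (ℤₚ.pos-* c m))))) e

  ∤⇒comaximal : ∀ {p x} → Prime p → ¬ (+ p ℤ∣.∣ x) → Comaximal x (+ p)
  ∤⇒comaximal {p} {x} pr p∤x with prime-comaximal pr x
  ... | inj₁ p∣x = contradiction p∣x p∤x
  ... | inj₂ c   = c

  comaximal-∣* : ∀ {p x y} → Comaximal y (+ p) → + p ℤ∣.∣ x * y → + p ℤ∣.∣ x
  comaximal-∣* {p} {x} {y} c p∣xy = mod0⇒∣ (mod-cancel y c (mod-trans (mod-reflexive (ℤₚ.*-comm y x))
    (mod-trans (∣⇒mod0 p∣xy) (mod-reflexive (sym (ℤₚ.*-zeroʳ y))))))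

  comaximal-∣∣⇒*∣ : ∀ {m n x} → Comaximal (+ m) (+ n) → + m ℤ∣.∣ x → + n ℤ∣.∣ x → + (m ℕ.* n) ℤ∣.∣ x
  comaximal-∣∣⇒*∣ c m∣x n∣x = mod0⇒∣ (mod-combine c (∣⇒mod0 m∣x) (∣⇒mod0 n∣x))

open Congruence

-- Multiplicative orders and the group of units.

module Order where

  open import Data.Integer.Base using (_+_; _*_; -_; _-_)

  order-unit : ∀ {m k d} → IsOrder m k d → Comaximal k (+ m)
  order-unit {m} {k} {zero}  o = contradiction (IsOrder.positive o) λ ()
  order-unit {m} {k} {suc d} o = inverse⇒comaximal (k ℤ.^ d)
    (mod-trans (mod-reflexive (ℤₚ.*-comm (k ℤ.^ d) k)) (IsOrder.k^d≡1 o))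

  ^-multiple : ∀ {m k d} → k ℤ.^ d ≡ + 1 [mod m ] → ∀ r → k ℤ.^ (d ℕ.* r) ≡ + 1 [mod m ]
  ^-multiple {m} {k} {d} e r = mod-trans (mod-reflexive (sym (ℤₚ.^-*-assoc k d r)))
    (mod-trans (mod-^ r e) (mod-reflexive (ℤₚ.^-zeroˡ r)))

  order-injective : ∀ {m k d} → IsOrder m k d → ∀ {r r′} → r < d → r′ < d →
                    k ℤ.^ r ≡ k ℤ.^ r′ [mod m ] → r ≡ r′
  order-injective {m} {k} {d} o r<d r′<d e = ℕₚ.≤-antisym (half r<d e) (half r′<d (mod-sym e))
    where
    half : ∀ {r r′} → r < d → k ℤ.^ r ≡ k ℤ.^ r′ [mod m ] → r ≤ r′
    half {r} {r′} r<d e with r ℕₚ.≤? r′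
    ... | yes r≤r′ = r≤r′
    ... | no r≰r′ = contradiction (IsOrder.minimal o (r ∸ r′) (ℕₚ.m<n⇒0<n∸m r′<r) k^[r∸r′]≡1)
                      (ℕₚ.<⇒≱ (ℕₚ.≤-<-trans (ℕₚ.m∸n≤m r r′) r<d))
      where
      r′<r : r′ < r
      r′<r = ℕₚ.≰⇒> r≰r′
      k^[r∸r′]≡1 : k ℤ.^ (r ∸ r′) ≡ + 1 [mod m ]
      k^[r∸r′]≡1 = mod-cancel (k ℤ.^ r′) (comaximal-^ r′ (order-unit o))
        (mod-trans (mod-reflexive (trans (sym (ℤₚ.^-distribˡ-+-* k r′ (r ∸ r′)))
                                         (cong (k ℤ.^_) (ℕₚ.m+[n∸m]≡n (ℕₚ.<⇒≤ r′<r)))))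
          (mod-trans e (mod-reflexive (sym (ℤₚ.*-identityʳ _)))))

  -- This is literally the list measured by `φ`, so positions in it have type `Fin (φ m)` and the
  -- pigeonhole principle applies to them directly.
  units : ℕ → List ℕ
  units m = filter (λ k → coprime? k m) (map suc (upTo m))

  abstract
    ∈-units : ∀ {m} .{{_ : NonZero m}} {z} → Comaximal z (+ m) →
              ∃[ k ] k ∈ units m × + k ≡ z [mod m ]
    ∈-units {m} {z} unit = k , ∈-filter⁺ (λ k → coprime? k m) (∈-map⁺ suc (∈-upTo⁺ (Finₚ.toℕ<n ρ)))
      (comaximal⇒coprime (comaximal-mod k≡z unit)) , k≡z
      where
      -- The list runs over 1,...,m instead of 0,...,m-1, so the representative is one more than the
      -- residue of `z - 1`.
      ρ : Fin m
      ρ = residue m (z - + 1)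
      k : ℕ
      k = suc (toℕ ρ)
      lemma : ∀ z → + 1 + (z - + 1) ≡ z
      lemma = solve-∀
      k≡z : + k ≡ z [mod m ]
      k≡z = mod-trans (mod-+ (mod-refl {x = + 1}) (residue-mod m (z - + 1))) (mod-reflexive (lemma z))

  -- Pigeonhole: φ m pairwise incongruent units exhaust the units.
  units-covered : ∀ {m} .{{_ : NonZero m}} (f : ℕ → ℤ) → (∀ r → Comaximal (f r) (+ m)) →
    (∀ {r r′} → r < φ m → r′ < φ m → f r ≡ f r′ [mod m ] → r ≡ r′) →
    ∀ z → Comaximal z (+ m) → ∃[ r ] r < φ m × f r ≡ z [mod m ]
  units-covered {m} f unit inj z z-unit = search (Finₚ.any? {n = φ m} (λ i → mod? m (f (toℕ i)) z))
    where
    h : Fin (suc (φ m)) → ℤ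
    h Fin.zero    = z
    h (Fin.suc i) = f (toℕ i)
    h-unit : ∀ i → Comaximal (h i) (+ m)
    h-unit Fin.zero    = z-unit
    h-unit (Fin.suc i) = unit (toℕ i)
    represent : ∀ i → ∃[ k ] k ∈ units m × + k ≡ h i [mod m ]
    represent i = ∈-units (h-unit i)
    position : Fin (suc (φ m)) → Fin (φ m)
    position i = index (proj₁ (proj₂ (represent i)))
    position-mod : ∀ i j → position i ≡ position j → h i ≡ h j [mod m ]
    position-mod i j e = mod-trans (mod-sym (proj₂ (proj₂ (represent i))))
      (mod-trans (mod-reflexive (cong +_ (index-injective (≡.setoid ℕ) (proj₁ (proj₂ (represent i)))
          (proj₁ (proj₂ (represent j))) e)))
        (proj₂ (proj₂ (represent j))))
    Found : Set
    Found = ∃[ r ] r < φ m × f r ≡ z [mod m ]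
    collision : ∀ i j → i Fin.< j → h i ≡ h j [mod m ] → Found
    collision Fin.zero (Fin.suc j) _ e = toℕ j , Finₚ.toℕ<n j , mod-sym e
    collision (Fin.suc i) (Fin.suc j) i<j e =
      contradiction (inj (Finₚ.toℕ<n i) (Finₚ.toℕ<n j) e) (ℕₚ.<⇒≢ (ℕₚ.≤-pred i<j))
    search : Dec (∃[ i ] f (toℕ i) ≡ z [mod m ]) → Found
    search (yes (i , e)) = toℕ i , Finₚ.toℕ<n i , e
    search (no ∄) with i , j , i<j , e ← Finₚ.pigeonhole (ℕₚ.n<1+n (φ m)) position =
      collision i j i<j (position-mod i j e)

  primitive-orbit : ∀ {m k} .{{_ : NonZero m}} → IsOrder m k (φ m) → ∀ a → Comaximal a (+ m) →
                    ∀ z → Comaximal z (+ m) → ∃[ r ] a * k ℤ.^ r ≡ z [mod m ]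
  primitive-orbit {m} {k} o a a-unit z z-unit =
    let r , _ , e = units-covered (λ r → a * k ℤ.^ r)
          (λ r → comaximal-* a-unit (comaximal-^ r (order-unit o)))
          (λ r< r′< e → order-injective o r< r′< (mod-cancel a a-unit e)) z z-unit
    in r , e

  private
    -- With index set {0,…,2d-1}: the first half runs over ⟨l⟩, the second over g⟨l⟩.
    coset : ∀ l g d r → Dec (r < d) → ℤ
    coset l g d r (yes _) = l ℤ.^ r
    coset l g d r (no  _) = g * l ℤ.^ (r ∸ d)

  -- Both ⟨l⟩ and g⟨l⟩ contain `d` units modulo `m`. Being disjoint, they have φ(m) elements
  -- together and exhaust the units.
  half-orbit : ∀ {m l g d} .{{_ : NonZero m}} → IsOrder m l d → φ m ≡ d ℕ.+ d → IsOrder m g (φ m) →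
               ∀ z → Comaximal z (+ m) → (∃[ r ] l ℤ.^ r ≡ z [mod m ]) ⊎ (∃[ r ] g * l ℤ.^ r ≡ z [mod m ])
  half-orbit {m} {l} {g} {d} ol φ≡2d og z z-unit =
    let r , _ , e = units-covered (λ r → coset l g d r (r ℕₚ.<? d)) (λ r → unit r (r ℕₚ.<? d))
          (λ {r} {r′} r< r′< → inj r< r′< (r ℕₚ.<? d) (r′ ℕₚ.<? d)) z z-unit
    in conclude r (r ℕₚ.<? d) e
    where
    unit : ∀ r r<?d → Comaximal (coset l g d r r<?d) (+ m)
    unit r (yes _) = comaximal-^ r (order-unit ol)
    unit r (no  _) = comaximal-* (order-unit og) (comaximal-^ (r ∸ d) (order-unit ol))
    l^[r*d]≡1 : ∀ r → (l ℤ.^ r) ℤ.^ d ≡ + 1 [mod m ]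
    l^[r*d]≡1 r = mod-trans (mod-reflexive (trans (ℤₚ.^-*-assoc l r d) (cong (l ℤ.^_) (ℕₚ.*-comm r d))))
                          (^-multiple {k = l} {d} (IsOrder.k^d≡1 ol) r)
    d<φ : d < φ m
    d<φ = subst (d <_) (sym φ≡2d) (ℕₚ.m<m+n d (IsOrder.positive ol))
    -- The d-th power of any power of `l` is 1, so a common element would give `g^d ≡ 1` with
    -- `0 < d < φ m`, against the primitivity of `g`.
    disjoint : ∀ r r′ → ¬ (l ℤ.^ r ≡ g * l ℤ.^ r′ [mod m ])
    disjoint r r′ e = ℕₚ.<⇒≱ d<φ (IsOrder.minimal og d (IsOrder.positive ol) (mod-sym (begin
      + 1                              ≈⟨ l^[r*d]≡1 r ⟨
      (l ℤ.^ r) ℤ.^ d                  ≈⟨ mod-^ d e ⟩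
      (g * l ℤ.^ r′) ℤ.^ d             ≡⟨ ^-distribʳ-* g (l ℤ.^ r′) d ⟩
      g ℤ.^ d * (l ℤ.^ r′) ℤ.^ d       ≈⟨ mod-* (mod-refl {x = g ℤ.^ d}) (l^[r*d]≡1 r′) ⟩
      g ℤ.^ d * + 1                    ≡⟨ ℤₚ.*-identityʳ _ ⟩
      g ℤ.^ d                          ∎)))
      where open SetoidReasoning (mod-setoid {m})
    r∸d<d : ∀ {r} → d ≤ r → r < φ m → r ∸ d < d
    r∸d<d {r} d≤r r<φ = ℕₚ.+-cancelˡ-< d _ _ (subst (ℕ._< d ℕ.+ d) (sym (ℕₚ.m+[n∸m]≡n d≤r)) (subst (r <_) φ≡2d r<φ))
    inj : ∀ {r r′} → r < φ m → r′ < φ m → ∀ r? r′? → coset l g d r r? ≡ coset l g d r′ r′? [mod m ] → r ≡ r′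
    inj r< r′< (yes r<d) (yes r′<d) e = order-injective ol r<d r′<d e
    inj {r} {r′} r< r′< (yes r<d) (no r′≮d) e = contradiction e (disjoint r (r′ ∸ d))
    inj {r} {r′} r< r′< (no r≮d) (yes r′<d) e = contradiction (mod-sym e) (disjoint r′ (r ∸ d))
    inj r< r′< (no r≮d) (no r′≮d) e = ℕₚ.∸-cancelʳ-≡ (ℕₚ.≮⇒≥ r≮d) (ℕₚ.≮⇒≥ r′≮d)
      (order-injective ol (r∸d<d (ℕₚ.≮⇒≥ r≮d) r<) (r∸d<d (ℕₚ.≮⇒≥ r′≮d) r′<) (mod-cancel g (order-unit og) e))
    conclude : ∀ r r? → coset l g d r r? ≡ z [mod m ] →
               (∃[ r ] l ℤ.^ r ≡ z [mod m ]) ⊎ (∃[ r ] g * l ℤ.^ r ≡ z [mod m ])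
    conclude r (yes _) e = inj₁ (r , e)
    conclude r (no  _) e = inj₂ (r ∸ d , e)

  crt : ∀ {m n} → Comaximal (+ m) (+ n) → ∀ a b → ∃[ z ] z ≡ a [mod m ] × z ≡ b [mod n ]
  -- `x * + m` is 0 modulo `m` and, by the Bézout identity, 1 modulo `n`.
  crt {m} {n} (x , y , e) a b = a + (b - a) * (x * + m) ,
    ∣⇒mod (ℤ∣.divides ((b - a) * x) (lemma₁ a b x (+ m))) ,
    ∣⇒mod (ℤ∣.divides ((a - b) * y) (trans (lemma₂ a b x y (+ m) (+ n))
        (trans (cong (λ c → (b - a) * (c - + 1) + (a - b) * y * + n) e) (lemma₃ a b _))))
    where
    lemma₁ : ∀ a b x m → a + (b - a) * (x * m) - a ≡ (b - a) * x * m
    lemma₁ = solve-∀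
    lemma₂ : ∀ a b x y m n → a + (b - a) * (x * m) - b ≡ (b - a) * (x * m + y * n - + 1) + (a - b) * y * n
    lemma₂ = solve-∀
    lemma₃ : ∀ a b c → (b - a) * (+ 1 - + 1) + c ≡ c
    lemma₃ = solve-∀

  exponent-reduce : ∀ {m k d e e′} → k ℤ.^ d ≡ + 1 [mod m ] → e′ ≤ e → + e ≡ + e′ [mod d ] →
                    k ℤ.^ e ≡ k ℤ.^ e′ [mod m ]
  exponent-reduce {m} {k} {d} {e} {e′} k^d≡1 e′≤e e≡e′ with ℕ∣.divides c f ← mod⇒∣∸ e′≤e e≡e′ = begin
    k ℤ.^ e                          ≡⟨ cong (k ℤ.^_) (ℕₚ.m+[n∸m]≡n e′≤e) ⟨
    k ℤ.^ (e′ ℕ.+ (e ∸ e′))          ≡⟨ ℤₚ.^-distribˡ-+-* k e′ (e ∸ e′) ⟩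
    k ℤ.^ e′ * k ℤ.^ (e ∸ e′)        ≡⟨ cong (λ c → k ℤ.^ e′ * k ℤ.^ c) (trans f (ℕₚ.*-comm c d)) ⟩
    k ℤ.^ e′ * k ℤ.^ (d ℕ.* c)       ≈⟨ mod-* (mod-refl {x = k ℤ.^ e′}) (^-multiple {k = k} {d} k^d≡1 c) ⟩
    k ℤ.^ e′ * + 1                   ≡⟨ ℤₚ.*-identityʳ _ ⟩
    k ℤ.^ e′                         ∎
    where open SetoidReasoning (mod-setoid {m})

  exponent-mod : ∀ {m k d e e′} → k ℤ.^ d ≡ + 1 [mod m ] → + e ≡ + e′ [mod d ] → k ℤ.^ e ≡ k ℤ.^ e′ [mod m ]
  exponent-mod {m} {k} {d} {e} {e′} k^d≡1 e≡e′ with ℕₚ.≤-total e e′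
  ... | inj₁ e≤e′ = mod-sym (exponent-reduce k^d≡1 e≤e′ (mod-sym e≡e′))
  ... | inj₂ e′≤e = exponent-reduce k^d≡1 e′≤e e≡e′

  -- Modulo `m` a power of `k` depends only on the exponent modulo `d`, and modulo `n` only on the
  -- exponent modulo `e`. So the Chinese remainder theorem is applied to the exponents.
  exponent-crt : ∀ {k m n d e} .{{_ : NonZero d}} .{{_ : NonZero e}} → Comaximal (+ d) (+ e) →
    k ℤ.^ d ≡ + 1 [mod m ] → k ℤ.^ e ≡ + 1 [mod n ] →
    ∀ u v → ∃[ r ] k ℤ.^ r ≡ k ℤ.^ u [mod m ] × k ℤ.^ r ≡ k ℤ.^ v [mod n ]
  exponent-crt {k} {m} {n} {d} {e} cop k^d≡1 k^e≡1 u v with z , z≡u , z≡v ← crt cop (+ u) (+ v) =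
    r , exponent-mod k^d≡1 (mod-trans (mod-weaken (ℕ∣.m∣m*n e) r≡z) z≡u)
      , exponent-mod k^e≡1 (mod-trans (mod-weaken (ℕ∣.n∣m*n d) r≡z) z≡v)
    where
    instance
      de≢0 : NonZero (d ℕ.* e)
      de≢0 = ℕₚ.m*n≢0 d e
    r : ℕ
    r = toℕ (residue (d ℕ.* e) z)
    r≡z : + r ≡ z [mod d ℕ.* e ]
    r≡z = residue-mod (d ℕ.* e) z

-- Sums over a complete residue system.

module RangeSum {c ℓ} (M : CommutativeMonoid c ℓ) where

  open import Data.Integer.Base using (_+_; _*_; -_; _-_)
  open CommutativeMonoid M using (Carrier; _≈_; _∙_; ∙-cong; setoid; identityˡ; assoc; reflexive)
    renaming (refl to ≈-refl; sym to ≈-sym; trans to ≈-trans)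
  open import Algebra.Properties.CommutativeMonoid.Sum M
  open SetoidReasoning setoid

  -- Summands live on all of ℤ, so that arguments can be shifted and scaled without reduction; for
  -- an m-periodic summand this is the sum over ℤ/m. A general monoid is allowed because the same
  -- rules serve integer counts and sums in the polynomial quotient.
  range : ℕ → (ℤ → Carrier) → Carrier
  range m F = sum {m} (λ i → F (+ toℕ i))

  range-cong : ∀ m {F G : ℤ → Carrier} → (∀ x → F x ≈ G x) → range m F ≈ range m G
  range-cong m F≈G = sum-cong-≋ {m} (λ i → F≈G (+ toℕ i))

  range-distrib : ∀ m (F G : ℤ → Carrier) → range m (λ x → F x ∙ G x) ≈ range m F ∙ range m G
  range-distrib m F G = ∑-distrib-+ {m} (λ i → F (+ toℕ i)) (λ i → G (+ toℕ i))

  range-swap : ∀ m n (F : ℤ → ℤ → Carrier) →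
               range m (λ x → range n (λ y → F x y)) ≈ range n (λ y → range m (λ x → F x y))
  range-swap m n F = ∑-comm {m} {n} (λ i j → F (+ toℕ i) (+ toℕ j))

  -- `f` and `g` induce mutually inverse permutations of the residues; periodicity of `F` allows
  -- replacing `f x` by its residue.
  range-reindex : ∀ m .{{_ : NonZero m}} {F : ℤ → Carrier} → (∀ {x y} → x ≡ y [mod m ] → F x ≈ F y) →
    (f g : ℤ → ℤ) → (∀ {x y} → x ≡ y [mod m ] → f x ≡ f y [mod m ]) →
    (∀ {x y} → x ≡ y [mod m ] → g x ≡ g y [mod m ]) →
    (∀ x → f (g x) ≡ x [mod m ]) → (∀ x → g (f x) ≡ x [mod m ]) →
    range m (λ x → F (f x)) ≈ range m F
  range-reindex m {F} F-cong f g f-cong g-cong fg gf = begin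
    sum {m} (λ i → F (f (+ toℕ i)))       ≈⟨ sum-cong-≋ {m} (λ i → F-cong (residue-mod m (f (+ toℕ i)))) ⟨
    sum {m} (λ i → F (+ toℕ (on f i)))    ≈⟨ ∑-permute {m} (λ i → F (+ toℕ i))
        (permutation (on f) (on g) (inverse f g f-cong fg) (inverse g f g-cong gf)) ⟨
    sum {m} (λ i → F (+ toℕ i))           ∎
    where
    on : (ℤ → ℤ) → Fin m → Fin m
    on h i = residue m (h (+ toℕ i))
    inverse : ∀ h k → (∀ {x y} → x ≡ y [mod m ] → h x ≡ h y [mod m ]) →
              (∀ x → h (k x) ≡ x [mod m ]) → ∀ i → on h (on k i) ≡ i
    inverse h k h-cong hk i = Finₚ.toℕ-injective (mod⇒≡ (Finₚ.toℕ<n _) (Finₚ.toℕ<n i)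
      (mod-trans (residue-mod m _) (mod-trans (h-cong (residue-mod m (k (+ toℕ i)))) (hk (+ toℕ i)))))

  module _ (m : ℕ) .{{_ : NonZero m}} {F : ℤ → Carrier} (F-cong : ∀ {x y} → x ≡ y [mod m ] → F x ≈ F y) where

    range-affine : ∀ {w} → Comaximal w (+ m) → ∀ c → range m (λ x → F (w * x + c)) ≈ range m F
    range-affine {w} w-unit c = range-reindex m F-cong (λ x → w * x + c) (λ x → v * (x - c))
      (λ e → mod-+ (mod-* (mod-refl {x = w}) e) (mod-refl {x = c}))
      (λ e → mod-* (mod-refl {x = v}) (mod-- e (mod-refl {x = c})))
      (λ x → mod-trans (mod-reflexive (lemma₁ w v x c))
        (mod-trans (mod-+ (mod-* v*w≡1 (mod-refl {x = x - c})) (mod-refl {x = c})) (mod-reflexive (lemma₂ x c))))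
      (λ x → mod-trans (mod-reflexive (lemma₃ w v x c))
          (mod-trans (mod-* v*w≡1 (mod-refl {x = x})) (mod-reflexive (ℤₚ.*-identityˡ x))))
      where
      v : ℤ
      v = proj₁ (mod-inverse w-unit)
      v*w≡1 : v * w ≡ + 1 [mod m ]
      v*w≡1 = proj₂ (mod-inverse w-unit)
      lemma₁ : ∀ w v x c → w * (v * (x - c)) + c ≡ v * w * (x - c) + c
      lemma₁ = solve-∀
      lemma₂ : ∀ x c → + 1 * (x - c) + c ≡ x
      lemma₂ = solve-∀
      lemma₃ : ∀ w v x c → v * (w * x + c - c) ≡ v * w * x
      lemma₃ = solve-∀

    range-scale : ∀ {w} → Comaximal w (+ m) → range m (λ x → F (w * x)) ≈ range m F
    range-scale {w} w-unit = ≈-trans (range-cong m (λ x → reflexive (cong F (sym (ℤₚ.+-identityʳ (w * x))))))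
                                     (range-affine w-unit (+ 0))

    range-translate : ∀ c → range m (λ x → F (x + c)) ≈ range m F
    range-translate c = ≈-trans (range-cong m (λ x → reflexive (cong (λ y → F (y + c)) (sym (ℤₚ.*-identityˡ x)))))
                                (range-affine comaximal-1 c)

    range-reflect : ∀ c → range m (λ x → F (c - x)) ≈ range m F
    range-reflect c = ≈-trans (range-cong m (λ x → reflexive (cong F (lemma c x))))
                              (range-affine { - + 1} (- + 1 , + 0 , refl) c)
      where
      lemma : ∀ c x → c - x ≡ - + 1 * x + c
      lemma = solve-∀

  range-+ : ∀ m n (F : ℤ → Carrier) → range (m ℕ.+ n) F ≈ range m F ∙ range n (λ x → F (+ m + x))
  range-+ zero n F = ≈-trans (range-cong n (λ x → reflexive (cong F (sym (ℤₚ.+-identityˡ x))))) (≈-sym (identityˡ _))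
  range-+ (suc m) n F = begin
    F (+ 0) ∙ range (m ℕ.+ n) (λ x → F (+ 1 + x))
      ≈⟨ ∙-cong ≈-refl (range-+ m n (λ x → F (+ 1 + x))) ⟩
    F (+ 0) ∙ (range m (λ x → F (+ 1 + x)) ∙ range n (λ x → F (+ 1 + (+ m + x))))
      ≈⟨ assoc _ _ _ ⟨
    range (suc m) F ∙ range n (λ x → F (+ 1 + (+ m + x)))
      ≈⟨ ∙-cong ≈-refl (range-cong n (λ x → reflexive (cong F (sym (ℤₚ.+-assoc (+ 1) (+ m) x))))) ⟩
    range (suc m) F ∙ range n (λ x → F (+ suc m + x)) ∎

  -- Division with remainder: the index is written as `b * m + a`.
  range-* : ∀ k m (F : ℤ → Carrier) →
            range (k ℕ.* m) F ≈ range k (λ b → range m (λ a → F (b * + m + a)))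
  range-* zero    m F = ≈-refl
  range-* (suc k) m F = begin
    range (m ℕ.+ k ℕ.* m) F
      ≈⟨ range-+ m (k ℕ.* m) F ⟩
    range m F ∙ range (k ℕ.* m) (λ x → F (+ m + x))
      ≈⟨ ∙-cong (range-cong m (λ a → reflexive (cong F (lemma₀ (+ m) a)))) (≈-trans (range-* k m (λ x → F (+ m + x)))
           (range-cong k (λ b → range-cong m (λ a → reflexive (cong F (lemma (+ m) b a)))))) ⟩
    range (suc k) (λ b → range m (λ a → F (b * + m + a))) ∎
    where
    lemma₀ : ∀ m a → a ≡ + 0 * m + a
    lemma₀ = solve-∀
    lemma : ∀ m b a → m + (b * m + a) ≡ (+ 1 + b) * m + a
    lemma = solve-∀

-- Integer-valued periodic functions, extension by zero, and convolution.

module IntegerSum where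

  open import Data.Integer.Base using (_+_; _*_; -_; _-_)
  open RangeSum ℤₚ.+-0-commutativeMonoid public
  open import Algebra.Properties.Semiring.Sum ℤₚ.+-*-semiring using (*-distribˡ-sum; *-distribʳ-sum)
  open ≡.≡-Reasoning

  range-*ˡ : ∀ m c (F : ℤ → ℤ) → range m (λ x → c * F x) ≡ c * range m F
  range-*ˡ m c F = sym (*-distribˡ-sum {m} c (λ i → F (+ toℕ i)))

  range-*ʳ : ∀ m c (F : ℤ → ℤ) → range m (λ x → F x * c) ≡ range m F * c
  range-*ʳ m c F = sym (*-distribʳ-sum {m} c (λ i → F (+ toℕ i)))

  range-1 : ∀ m → range m (λ _ → + 1) ≡ + m
  range-1 zero    = refl
  range-1 (suc m) = cong (λ z → + 1 + z) (range-1 m)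

  range-const : ∀ m c → range m (λ _ → c) ≡ + m * c
  range-const m c = begin
    range m (λ _ → c)        ≡⟨ range-cong m (λ _ → sym (ℤₚ.*-identityˡ c)) ⟩
    range m (λ _ → + 1 * c)  ≡⟨ range-*ʳ m c (λ _ → + 1) ⟩
    range m (λ _ → + 1) * c  ≡⟨ cong (_* c) (range-1 m) ⟩
    + m * c                  ∎

  range-0 : ∀ m → range m (λ _ → + 0) ≡ + 0
  range-0 m = trans (range-const m (+ 0)) (ℤₚ.*-zeroʳ (+ m))

  Periodic : ℕ → (ℤ → ℤ) → Set
  Periodic m F = ∀ {x y} → x ≡ y [mod m ] → F x ≡ F y

  periodic-step : ∀ {m F} → Periodic m F → ∀ b a → F (b * + m + a) ≡ F a
  periodic-step {m} F-per b a = F-per (mod-trans (mod-+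
      (mod-trans (mod-reflexive (ℤₚ.*-comm b (+ m))) (mod-step b)) (mod-refl {x = a}))
    (mod-reflexive (ℤₚ.+-identityˡ a)))

  range-periodic : ∀ k m {F} → Periodic m F → range (k ℕ.* m) F ≡ + k * range m F
  range-periodic k m {F} F-per = begin
    range (k ℕ.* m) F                                   ≡⟨ range-* k m F ⟩
    range k (λ b → range m (λ a → F (b * + m + a)))     ≡⟨ range-cong k (λ b → range-cong m (periodic-step F-per b)) ⟩
    range k (λ _ → range m F)                           ≡⟨ range-const k (range m F) ⟩
    + k * range m F                                     ∎

  -- In the index `b * m + a` the factor `G` sees only `a`; for fixed `a`, the map `b ↦ b * m + a`
  -- permutes the residues modulo `k`, since `m` is a unit there.
  range-crt : ∀ k m .{{_ : NonZero k}} {F G} → Comaximal (+ m) (+ k) → Periodic k F → Periodic m G →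
              range (k ℕ.* m) (λ x → F x * G x) ≡ range k F * range m G
  range-crt k m {F} {G} cop F-per G-per = begin
    range (k ℕ.* m) (λ x → F x * G x)
      ≡⟨ range-* k m (λ x → F x * G x) ⟩
    range k (λ b → range m (λ a → F (b * + m + a) * G (b * + m + a)))
      ≡⟨ range-cong k (λ b → range-cong m (λ a → cong (F (b * + m + a) *_) (periodic-step G-per b a))) ⟩
    range k (λ b → range m (λ a → F (b * + m + a) * G a))
      ≡⟨ range-swap k m (λ b a → F (b * + m + a) * G a) ⟩
    range m (λ a → range k (λ b → F (b * + m + a) * G a))
      ≡⟨ range-cong m (λ a → range-*ʳ k (G a) (λ b → F (b * + m + a))) ⟩
    range m (λ a → range k (λ b → F (b * + m + a)) * G a)
      ≡⟨ range-cong m (λ a → cong (_* G a) (trans (range-cong k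
          (λ b → cong (λ c → F (c + a)) (ℤₚ.*-comm b (+ m)))) (range-affine k F-per cop a))) ⟩
    range m (λ a → range k F * G a)
      ≡⟨ range-*ˡ m (range k F) G ⟩
    range k F * range m G ∎

  ⟦_⟧ : ∀ {P : Set} → Dec P → ℤ
  ⟦ yes _ ⟧ = + 1
  ⟦ no  _ ⟧ = + 0

  ⟦⟧-true : ∀ {P : Set} (P? : Dec P) → P → ⟦ P? ⟧ ≡ + 1
  ⟦⟧-true (yes _) p = refl
  ⟦⟧-true (no ¬p) p = contradiction p ¬p

  ⟦⟧-false : ∀ {P : Set} (P? : Dec P) → ¬ P → ⟦ P? ⟧ ≡ + 0
  ⟦⟧-false (yes p) ¬p = contradiction p ¬p
  ⟦⟧-false (no _)  ¬p = refl

  ⟦⟧-cong : ∀ {P Q : Set} (P? : Dec P) (Q? : Dec Q) → (P → Q) → (Q → P) → ⟦ P? ⟧ ≡ ⟦ Q? ⟧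
  ⟦⟧-cong (yes p) Q? f g = sym (⟦⟧-true Q? (f p))
  ⟦⟧-cong (no ¬p) Q? f g = sym (⟦⟧-false Q? (λ q → ¬p (g q)))

  private
    liftAt : ∀ {m x} → (ℤ → ℤ) → Dec (+ m ℤ∣.∣ x) → ℤ
    liftAt F (yes (ℤ∣.divides u _)) = F u
    liftAt F (no _)                 = + 0

  abstract
    -- Moves `F` to the multiples of `m` by `u * m ↦ F u` and extends by zero. In this way a
    -- condition on the cofactor of a prime power becomes a function of the number itself.
    lift : ℕ → (ℤ → ℤ) → ℤ → ℤ
    lift m F x = liftAt F (+ m ℤ∣.∣? x)

    lift-multiple : ∀ m .{{_ : NonZero m}} F u → lift m F (u * + m) ≡ F u
    lift-multiple m F u with + m ℤ∣.∣? (u * + m)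
    ... | yes (ℤ∣.divides v e) = cong F (sym (ℤₚ.*-cancelʳ-≡ u v (+ m) {{ℕ.≢-nonZero (ℕ.≢-nonZero⁻¹ m)}} e))
    ... | no m∤u*m = contradiction (ℤ∣.divides u refl) m∤u*m

    lift-nonmultiple : ∀ m F {x} → ¬ (+ m ℤ∣.∣ x) → lift m F x ≡ + 0
    lift-nonmultiple m F {x} m∤x with + m ℤ∣.∣? x
    ... | yes m∣x = contradiction m∣x m∤x
    ... | no _    = refl

    -- Characterises `lift` by its values on and off the multiples of `m`; identities between lifted
    -- functions are checked on these two cases.
    ≡lift : ∀ m .{{_ : NonZero m}} {F} (G : ℤ → ℤ) → (∀ u → G (u * + m) ≡ F u) → (∀ x → ¬ (+ m ℤ∣.∣ x) → G x ≡ + 0) →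
            ∀ x → G x ≡ lift m F x
    ≡lift m G on off x with + m ℤ∣.∣? x
    ... | yes (ℤ∣.divides u e) = trans (cong G e) (on u)
    ... | no m∤x = off x m∤x

    lift-cong : ∀ m {F G : ℤ → ℤ} → (∀ x → F x ≡ G x) → ∀ x → lift m F x ≡ lift m G x
    lift-cong m F≡G x with + m ℤ∣.∣? x
    ... | yes (ℤ∣.divides u _) = F≡G u
    ... | no _ = refl

    lift-+ : ∀ m F G x → lift m (λ x → F x + G x) x ≡ lift m F x + lift m G x
    lift-+ m F G x with + m ℤ∣.∣? x
    ... | yes _ = refl
    ... | no _ = refl

    lift-* : ∀ m a F x → lift m (λ x → a * F x) x ≡ a * lift m F x
    lift-* m a F x with + m ℤ∣.∣? x
    ... | yes _ = refl
    ... | no _ = sym (ℤₚ.*-zeroʳ a)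

  ∣-mod : ∀ {m x y} → x ≡ y [mod m ] → + m ℤ∣.∣ y → + m ℤ∣.∣ x
  ∣-mod x≡y m∣y = mod0⇒∣ (mod-trans x≡y (∣⇒mod0 m∣y))

  lift-periodic : ∀ k m .{{_ : NonZero m}} {F} → Periodic k F → Periodic (k ℕ.* m) (lift m F)
  lift-periodic k m {F} F-per {x} {y} x≡y with + m ℤ∣.∣? y
  ... | no m∤y = trans (lift-nonmultiple m F λ m∣x → m∤y (∣-mod (mod-sym (mod-weaken (ℕ∣.n∣m*n k) x≡y)) m∣x))
                       (sym (lift-nonmultiple m F m∤y))
  ... | yes (ℤ∣.divides v e) with Quotient.mk≈ₘ h f ← x≡y = begin
    lift m F x                    ≡⟨ cong (lift m F)
        (trans f (trans (cong (_+ h * + (k ℕ.* m)) e)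
            (trans (cong (λ z → v * + m + h * z) (ℤₚ.pos-* k m)) (lemma v h (+ m) (+ k))))) ⟩
    lift m F ((h * + k + v) * + m)  ≡⟨ lift-multiple m F _ ⟩
    F (h * + k + v)               ≡⟨ periodic-step F-per h v ⟩
    F v                           ≡⟨ lift-multiple m F v ⟨
    lift m F (v * + m)            ≡⟨ cong (lift m F) e ⟨
    lift m F y                    ∎
    where
    lemma : ∀ v h m k → v * m + h * (k * m) ≡ (h * k + v) * m
    lemma = solve-∀

  lift-lift : ∀ k m .{{_ : NonZero k}} .{{_ : NonZero m}} F x →
              lift m (lift k F) x ≡ lift (k ℕ.* m) F x
  lift-lift k m F = ≡lift (k ℕ.* m) {{ℕₚ.m*n≢0 k m}} (lift m (lift k F)) on off
    where
    on : ∀ u → lift m (lift k F) (u * + (k ℕ.* m)) ≡ F u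
    on u = begin
      lift m (lift k F) (u * + (k ℕ.* m))    ≡⟨ cong (λ z → lift m (lift k F) (u * z)) (ℤₚ.pos-* k m) ⟩
      lift m (lift k F) (u * (+ k * + m))    ≡⟨ cong (lift m (lift k F)) (ℤₚ.*-assoc u (+ k) (+ m)) ⟨
      lift m (lift k F) (u * + k * + m)      ≡⟨ lift-multiple m (lift k F) (u * + k) ⟩
      lift k F (u * + k)                     ≡⟨ lift-multiple k F u ⟩
      F u                                    ∎
    off : ∀ x → ¬ (+ (k ℕ.* m) ℤ∣.∣ x) → lift m (lift k F) x ≡ + 0
    off x km∤x with + m ℤ∣.∣? x
    ... | no m∤x = lift-nonmultiple m (lift k F) m∤x
    ... | yes (ℤ∣.divides u e) = trans (cong (lift m (lift k F)) e) (trans (lift-multiple m (lift k F) u)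
      (lift-nonmultiple k F λ (ℤ∣.divides v f) → km∤x (ℤ∣.divides v
        (trans e (trans (cong (_* + m) f) (trans (ℤₚ.*-assoc v (+ k) (+ m)) (cong (v *_) (sym (ℤₚ.pos-* k m)))))))))

  -- In each block of consecutive indices `b * m + a` only `a = 0` gives a multiple of `m`.
  range-lift : ∀ k m .{{_ : NonZero m}} F → range (k ℕ.* m) (lift m F) ≡ range k F
  range-lift k (suc m) F = begin
    range (k ℕ.* suc m) (lift (suc m) F)
      ≡⟨ range-* k (suc m) (lift (suc m) F) ⟩
    range k (λ b → lift (suc m) F (b * + suc m + + 0) + range m (λ a → lift (suc m) F (b * + suc m + (+ 1 + a))))
      ≡⟨ range-cong k (λ b → cong₂ _+_ (trans (cong (lift (suc m) F) (ℤₚ.+-identityʳ (b * + suc m)))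
          (lift-multiple (suc m) F b))
                                        (trans (off b) (range-0 m))) ⟩
    range k (λ b → F b + + 0)
      ≡⟨ range-cong k (λ b → ℤₚ.+-identityʳ (F b)) ⟩
    range k F ∎
    where
    off : ∀ b → range m (λ a → lift (suc m) F (b * + suc m + (+ 1 + a))) ≡ range m (λ _ → + 0)
    off b = sum-cong-≗ {m} λ i → lift-nonmultiple (suc m) F λ d →
      ℕₚ.<⇒≱ (s≤s (Finₚ.toℕ<n i)) (ℕ∣.∣⇒≤ (ℤ∣.∣⇒∣ᵤ (ℤ∣.∣m+n∣m⇒∣n {n = + suc (toℕ i)} d (ℤ∣.divides b refl))))
      where open import Algebra.Properties.CommutativeMonoid.Sum ℤₚ.+-0-commutativeMonoid using (sum-cong-≗)

  lift-1-periodic : ∀ p .{{_ : NonZero p}} → Periodic p (lift p (λ _ → + 1))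
  lift-1-periodic p = subst (λ m → Periodic m (lift p (λ _ → + 1))) (ℕₚ.*-identityˡ p)
    (lift-periodic 1 p (λ _ → refl))

  range-lift-1 : ∀ p .{{_ : NonZero p}} → range p (lift p (λ _ → + 1)) ≡ + 1
  range-lift-1 p = trans (cong (λ m → range m (lift p (λ _ → + 1))) (sym (ℕₚ.*-identityˡ p)))
    (range-lift 1 p (λ _ → + 1))

  convolve : ℕ → (ℤ → ℤ) → (ℤ → ℤ) → ℤ → ℤ
  convolve n F G c = range n (λ b → F (c - b) * G b)

  -- Only multiples `b` of `m` contribute, and for these `c - b` is a multiple of `m` exactly when
  -- `c` is; the sum then runs over the cofactors.
  convolve-lift : ∀ k m .{{_ : NonZero m}} F G c →
                  convolve (k ℕ.* m) (lift m F) (lift m G) c ≡ lift m (convolve k F G) c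
  convolve-lift k m F G c = trans (trans (range-cong (k ℕ.* m) lifted) (range-lift k m _))
      (≡lift m (λ c → range k (λ u → lift m F (c - u * + m) * G u)) on off c)
    where
    lifted : ∀ b → lift m F (c - b) * lift m G b ≡ lift m (λ u → lift m F (c - u * + m) * G u) b
    lifted = ≡lift m (λ b → lift m F (c - b) * lift m G b)
        (λ u → cong (lift m F (c - u * + m) *_) (lift-multiple m G u))
      (λ b m∤b → trans (cong (lift m F (c - b) *_) (lift-nonmultiple m G m∤b)) (ℤₚ.*-zeroʳ (lift m F (c - b))))
    on : ∀ v → range k (λ u → lift m F (v * + m - u * + m) * G u) ≡ convolve k F G v
    on v = range-cong k λ u → cong (_* G u) (trans (cong (lift m F) (lemma v u (+ m))) (lift-multiple m F (v - u)))
      where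
      lemma : ∀ v u m → v * m - u * m ≡ (v - u) * m
      lemma = solve-∀
    off : ∀ x → ¬ (+ m ℤ∣.∣ x) → range k (λ u → lift m F (x - u * + m) * G u) ≡ + 0
    off x m∤x = trans (range-cong k λ u → cong (_* G u) (lift-nonmultiple m F λ d →
        m∤x (subst (+ m ℤ∣.∣_) (lemma x (u * + m)) (ℤ∣.∣m∣n⇒∣m+n {m = x - u * + m} d (ℤ∣.divides u refl)))))
      (trans (range-cong k (λ u → ℤₚ.*-zeroˡ (G u))) (range-0 k))
      where
      lemma : ∀ x y → x - y + y ≡ x
      lemma = solve-∀

-- Generating functions in 𝔽ₗ[x]/⟨xⁿ - 1⟩.

x≈1+1*[x-1] : ∀ {c ℓ} (R : CommutativeRing c ℓ) → let open CommutativeRing R in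
  ∀ x → x ≈ 1# + 1# * (x + - 1#)
x≈1+1*[x-1] R x = begin
  x                     ≈⟨ +-identityʳ x ⟨
  x + 0#                ≈⟨ +-congˡ (-‿inverseˡ 1#) ⟨
  x + (- 1# + 1#)       ≈⟨ +-assoc x (- 1#) 1# ⟨
  x + - 1# + 1#         ≈⟨ +-comm (x + - 1#) 1# ⟩
  1# + (x + - 1#)       ≈⟨ +-congˡ (*-identityˡ (x + - 1#)) ⟨
  1# + 1# * (x + - 1#)  ∎
  where
  open CommutativeRing R
  open SetoidReasoning setoid

module GeneratingFunction (l n : ℕ) .{{_ : NonZero n}} where

  open Cyclotomic l n
  private
    module A = CommutativeRing (ℤ/ l)
    module 𝔽ₗ[x] = Polynomial (ℤ/ l)
  open CommutativeRing R using (1#; setoid; +-cong; *-cong; +-identityˡ; *-identityˡ; +-commutativeMonoid; semiring)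
    renaming (refl to ≈-refl; sym to ≈-sym; trans to ≈-trans; reflexive to ≈-reflexive; *-assoc to *ᴿ-assoc)
  open import Algebra.Properties.Semiring.Sum semiring using (sum; sum-cong-≋; *-distribˡ-sum; *-distribʳ-sum)
  open IntegerSum using (⟦_⟧; ⟦⟧-true; ⟦⟧-false; Periodic; convolve) renaming (range to rangeℤ)
  open RangeSum +-commutativeMonoid
  open SetoidReasoning setoid
  open Quotient 𝔽ₗ[x].polynomialRing (𝔽ₗ[x].x^ n 𝔽ₗ[x].+ 𝔽ₗ[x].- 𝔽ₗ[x].1ₚ) using (mk≈ₘ; ≈⇒≈ₘ)

  private
    m : Carrier
    m = (𝔽ₗ[x].x^ n) 𝔽ₗ[x].+ 𝔽ₗ[x].- 𝔽ₗ[x].1ₚ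

  ·-congʳ : ∀ a {f g} → f ≈ g → a · f ≈ a · g
  ·-congʳ a {f} {g} (mk≈ₘ h e) = mk≈ₘ (a · h) (𝔽ₗ[x].≈-trans (𝔽ₗ[x].·-cong (A.refl {a}) e)
    (𝔽ₗ[x].≈-trans (𝔽ₗ[x].·-distribˡ a g (h * m))
      (𝔽ₗ[x].+-cong (𝔽ₗ[x].≈-refl {a · g}) (𝔽ₗ[x].≈-sym (𝔽ₗ[x].·-*-assoc a h m)))))

  ·-*-interchange : ∀ a b f g → (a · f) * (b · g) ≈ (a ℤ.* b) · (f * g)
  ·-*-interchange a b f g = begin
    (a · f) * (b · g)    ≈⟨ ≈⇒≈ₘ (𝔽ₗ[x].·-*-assoc a f (b · g)) ⟩
    a · (f * (b · g))    ≈⟨ ≈⇒≈ₘ (𝔽ₗ[x].·-cong (A.refl {a}) (𝔽ₗ[x].*-comm f (b · g))) ⟩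
    a · ((b · g) * f)    ≈⟨ ≈⇒≈ₘ (𝔽ₗ[x].·-cong (A.refl {a}) (𝔽ₗ[x].·-*-assoc b g f)) ⟩
    a · (b · (g * f))    ≈⟨ ≈⇒≈ₘ (𝔽ₗ[x].·-assoc a b (g * f)) ⟨
    (a ℤ.* b) · (g * f)  ≈⟨ ≈⇒≈ₘ (𝔽ₗ[x].·-cong (A.refl {a ℤ.* b}) (𝔽ₗ[x].*-comm g f)) ⟩
    (a ℤ.* b) · (f * g)  ∎

  x^-+ : ∀ a b → (𝔽ₗ[x].x^ a) * (𝔽ₗ[x].x^ b) ≈ 𝔽ₗ[x].x^ (a ℕ.+ b)
  x^-+ a b = ≈⇒≈ₘ (polynomial a)
    where
    polynomial : ∀ a → (𝔽ₗ[x].x^ a) 𝔽ₗ[x].* (𝔽ₗ[x].x^ b) 𝔽ₗ[x].≈ 𝔽ₗ[x].x^ (a ℕ.+ b)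
    polynomial zero    = 𝔽ₗ[x].*-identityˡ _
    polynomial (suc a) = 𝔽ₗ[x].≈-trans (𝔽ₗ[x].0∷-* (𝔽ₗ[x].x^ a) _) (𝔽ₗ[x].∷-cong A.refl (polynomial a))

  x^n≈1 : 𝔽ₗ[x].x^ n ≈ 1#
  x^n≈1 = mk≈ₘ 𝔽ₗ[x].1ₚ (x≈1+1*[x-1] 𝔽ₗ[x].polynomialRing (𝔽ₗ[x].x^ n))

  x^-multiple : ∀ c → 𝔽ₗ[x].x^ (c ℕ.* n) ≈ 1#
  x^-multiple zero    = ≈-refl
  x^-multiple (suc c) = begin
    𝔽ₗ[x].x^ (n ℕ.+ c ℕ.* n)             ≈⟨ x^-+ n (c ℕ.* n) ⟨
    (𝔽ₗ[x].x^ n) * (𝔽ₗ[x].x^ (c ℕ.* n))  ≈⟨ *-cong x^n≈1 (x^-multiple c) ⟩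
    1# * 1#                              ≈⟨ *-identityˡ 1# ⟩
    1#                                   ∎

  x^-reduce : ∀ {a b} → b ≤ a → n ∣ a ∸ b → 𝔽ₗ[x].x^ a ≈ 𝔽ₗ[x].x^ b
  x^-reduce {a} {b} b≤a (ℕ∣.divides c e) = begin
    𝔽ₗ[x].x^ a                           ≡⟨ cong 𝔽ₗ[x].x^_ (trans (sym (ℕₚ.m∸n+n≡m b≤a)) (cong (ℕ._+ b) e)) ⟩
    𝔽ₗ[x].x^ (c ℕ.* n ℕ.+ b)             ≈⟨ x^-+ (c ℕ.* n) b ⟨
    (𝔽ₗ[x].x^ (c ℕ.* n)) * (𝔽ₗ[x].x^ b)  ≈⟨ *-cong (x^-multiple c) (≈-refl {𝔽ₗ[x].x^ b}) ⟩
    1# * (𝔽ₗ[x].x^ b)                    ≈⟨ *-identityˡ (𝔽ₗ[x].x^ b) ⟩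
    𝔽ₗ[x].x^ b                           ∎

  x^-mod : ∀ {a b} → + a ≡ + b [mod n ] → 𝔽ₗ[x].x^ a ≈ 𝔽ₗ[x].x^ b
  x^-mod {a} {b} a≡b =
    [ (λ b≤a → x^-reduce b≤a (mod⇒∣∸ b≤a a≡b))
    , (λ a≤b → ≈-sym (x^-reduce a≤b (mod⇒∣∸ a≤b (mod-sym a≡b))))
    ]′ (ℕₚ.≤-total b a)

  X : ℤ → Carrier
  X z = 𝔽ₗ[x].x^ toℕ (residue n z)

  X-cong : ∀ {a b} → a ≡ b [mod n ] → X a ≈ X b
  X-cong {a} {b} a≡b = x^-mod {toℕ (residue n a)} {toℕ (residue n b)}
    (mod-trans (residue-mod n a) (mod-trans a≡b (mod-sym (residue-mod n b))))

  X-+ : ∀ a b → X a * X b ≈ X (a ℤ.+ b)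
  X-+ a b = ≈-trans (x^-+ (toℕ (residue n a)) (toℕ (residue n b)))
    (x^-mod {toℕ (residue n a) ℕ.+ toℕ (residue n b)} {toℕ (residue n (a ℤ.+ b))}
      (mod-trans (mod-+ (residue-mod n a) (residue-mod n b)) (mod-sym (residue-mod n (a ℤ.+ b)))))

  -- Since the carrier of `ℤ/ l` is `ℤ`, the values of `F` serve as coefficients unchanged, and
  -- pointwise identities over `ℤ` carry over by `gen-cong`.
  gen : (ℤ → ℤ) → Carrier
  gen F = range n (λ α → F α · X α)

  gen-cong : ∀ {F G} → (∀ x → F x ≡ G x) → gen F ≈ gen G
  gen-cong F≡G = range-cong n (λ x → ≈-reflexive (cong (_· X x) (F≡G x)))

  gen-+ : ∀ F G → gen (λ x → F x ℤ.+ G x) ≈ gen F + gen G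
  gen-+ F G = ≈-trans (range-cong n (λ x → ≈⇒≈ₘ (𝔽ₗ[x].·-distribʳ (F x) (G x) (X x))))
                      (range-distrib n (λ x → F x · X x) (λ x → G x · X x))

  ·-sum : ∀ m a (f : Fin m → Carrier) → a · sum f ≈ sum (λ i → a · f i)
  ·-sum zero    a f = ≈-refl
  ·-sum (suc m) a f = ≈-trans (≈⇒≈ₘ (𝔽ₗ[x].·-distribˡ a (f Fin.zero) (sum (f ∘ Fin.suc))))
    (+-cong ≈-refl (·-sum m a (f ∘ Fin.suc)))

  gen-· : ∀ c F → gen (λ x → c ℤ.* F x) ≈ c · gen F
  gen-· c F = ≈-trans (range-cong n (λ x → ≈⇒≈ₘ (𝔽ₗ[x].·-assoc c (F x) (X x))))
    (≈-sym (·-sum n c (λ i → F (+ toℕ i) · X (+ toℕ i))))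

  gen-linear : ∀ a b F G → gen (λ x → a ℤ.* F x ℤ.+ b ℤ.* G x) ≈ a · gen F + b · gen G
  gen-linear a b F G = ≈-trans (gen-+ (λ x → a ℤ.* F x) (λ x → b ℤ.* G x)) (+-cong (gen-· a F) (gen-· b G))

  range-· : ∀ m (F : ℤ → ℤ) f → rangeℤ m F · f ≈ range m (λ x → F x · f)
  range-· zero    F f = ≈⇒≈ₘ (𝔽ₗ[x].·-zeroˡ f)
  range-· (suc m) F f = ≈-trans (≈⇒≈ₘ (𝔽ₗ[x].·-distribʳ (F (+ 0)) _ f))
      (+-cong ≈-refl (range-· m (λ x → F (+ 1 ℤ.+ x)) f))

  gen-* : ∀ {F} G → Periodic n F → gen F * gen G ≈ gen (convolve n F G)
  gen-* {F} G F-per = begin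
    gen F * gen G
      ≈⟨ *-distribˡ-sum {n} (gen F) (λ i → G (+ toℕ i) · X (+ toℕ i)) ⟩
    range n (λ b → gen F * (G b · X b))
      ≈⟨ range-cong n row ⟩
    range n (λ b → range n (λ c → (F (c ℤ.- b) ℤ.* G b) · X c))
      ≈⟨ range-swap n n (λ b c → (F (c ℤ.- b) ℤ.* G b) · X c) ⟩
    range n (λ c → range n (λ b → (F (c ℤ.- b) ℤ.* G b) · X c))
      ≈⟨ range-cong n (λ c → range-· n (λ b → F (c ℤ.- b) ℤ.* G b) (X c)) ⟨
    gen (convolve n F G) ∎
    where
    lemma : ∀ a b → a ≡ a ℤ.+ b ℤ.- b
    lemma = solve-∀
    row : ∀ b → gen F * (G b · X b) ≈ range n (λ c → (F (c ℤ.- b) ℤ.* G b) · X c)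
    row b = begin
      gen F * (G b · X b)
        ≈⟨ *-distribʳ-sum {n} (G b · X b) (λ i → F (+ toℕ i) · X (+ toℕ i)) ⟩
      range n (λ a → (F a · X a) * (G b · X b))
        ≈⟨ range-cong n (λ a → ≈-trans (·-*-interchange (F a) (G b) (X a) (X b)) (·-congʳ (F a ℤ.* G b) (X-+ a b))) ⟩
      range n (λ a → (F a ℤ.* G b) · X (a ℤ.+ b))
        ≈⟨ range-cong n (λ a → ≈-reflexive (cong (λ c → (F c ℤ.* G b) · X (a ℤ.+ b)) (lemma a b))) ⟩
      range n (λ a → (F (a ℤ.+ b ℤ.- b) ℤ.* G b) · X (a ℤ.+ b))
        -- The new index is c = a + b. The summand is n-periodic in it, `F` by assumption and `X`
        -- because xⁿ = 1, so the shift by `b` keeps the full residue system.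
        ≈⟨ range-translate n (λ {x} {y} x≡y → ≈-trans
            (≈-reflexive (cong (λ c → (c ℤ.* G b) · X x) (F-per (mod-- x≡y (mod-refl {x = b})))))
             (·-congʳ (F (y ℤ.- b) ℤ.* G b) (X-cong x≡y))) b ⟩
      range n (λ c → (F (c ℤ.- b) ℤ.* G b) · X c) ∎

  private
    +-congˡ-at : ∀ f {g h} → g ≈ h → f + g ≈ f + h
    +-congˡ-at f g≈h = +-cong (≈-refl {f}) g≈h

    +-congʳ-at : ∀ h {f g} → f ≈ g → f + h ≈ g + h
    +-congʳ-at h f≈g = +-cong f≈g (≈-refl {h})

  module _ (γ : ℤ) where

    monomial : Fin n → Carrier
    monomial α = 𝔽ₗ[x].x^ toℕ α

    ∑[_] : List (Fin n) → Carrier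
    ∑[ αs ] = ∑ (filter (_∈C? γ) αs) monomial

    ∑-∷ : ∀ α αs → Dec (α ∈C γ) → ∑[ α ∷ αs ] ≈ ⟦ α ∈C? γ ⟧ · monomial α + ∑[ αs ]
    ∑-∷ α αs (yes α∈C) = begin
      ∑[ α ∷ αs ]                           ≡⟨ cong (λ xs → ∑ xs monomial) (filter-accept (_∈C? γ) {α} {αs} α∈C) ⟩
      monomial α + ∑[ αs ]                  ≈⟨ +-congʳ-at ∑[ αs ] (≈⇒≈ₘ (𝔽ₗ[x].·-identityˡ (monomial α))) ⟨
      (+ 1) · monomial α + ∑[ αs ]          ≡⟨ cong (λ c → c · monomial α + ∑[ αs ]) (⟦⟧-true (α ∈C? γ) α∈C) ⟨
      ⟦ α ∈C? γ ⟧ · monomial α + ∑[ αs ]    ∎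
    ∑-∷ α αs (no α∉C) = begin
      ∑[ α ∷ αs ]                           ≡⟨ cong (λ xs → ∑ xs monomial) (filter-reject (_∈C? γ) {α} {αs} α∉C) ⟩
      ∑[ αs ]                               ≈⟨ +-identityˡ ∑[ αs ] ⟨
      0# + ∑[ αs ]                          ≈⟨ +-congʳ-at ∑[ αs ] (≈⇒≈ₘ (𝔽ₗ[x].·-zeroˡ (monomial α))) ⟨
      (+ 0) · monomial α + ∑[ αs ]          ≡⟨ cong (λ c → c · monomial α + ∑[ αs ]) (⟦⟧-false (α ∈C? γ) α∉C) ⟨
      ⟦ α ∈C? γ ⟧ · monomial α + ∑[ αs ]    ∎

    ∑-tabulate : ∀ {k} (f : Fin k → Fin n) →
                 ∑[ tabulate f ] ≈ sum {k} (λ i → ⟦ f i ∈C? γ ⟧ · monomial (f i))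
    ∑-tabulate {zero}  f = ≈-refl {0#}
    ∑-tabulate {suc k} f = ≈-trans (∑-∷ (f Fin.zero) (tabulate (f ∘ Fin.suc)) (f Fin.zero ∈C? γ))
      (+-congˡ-at (⟦ f Fin.zero ∈C? γ ⟧ · monomial (f Fin.zero)) (∑-tabulate (f ∘ Fin.suc)))

    χ-gen : ∀ (F : ℤ → ℤ) → (∀ α → ⟦ α ∈C? γ ⟧ ≡ F (+ toℕ α)) → χ[ γ ] ≈ gen F
    χ-gen F indicator = ≈-trans (∑-tabulate (λ i → i)) (sum-cong-≋ {n} (λ i →
      ≈-trans (≈-reflexive (cong (_· monomial i) (indicator i)))
              (·-congʳ (F (+ toℕ i)) (x^-mod (mod-sym (residue-mod n (+ toℕ i)))))))

-- Quadratic classes modulo p and cyclotomic numbers of order two.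

module QuadraticCharacter where

  open import Data.Integer.Base using (_+_; _*_; -_; _-_)
  open IntegerSum

  σ : Sign → ℤ
  σ Sign.+ = + 1
  σ Sign.- = - + 1

  σ-* : ∀ δ ε → σ δ * σ ε ≡ σ (δ Sign.* ε)
  σ-* Sign.+ Sign.+ = refl
  σ-* Sign.+ Sign.- = refl
  σ-* Sign.- Sign.+ = refl
  σ-* Sign.- Sign.- = refl

  σ-square : ∀ δ x → σ δ * (σ δ * x) ≡ x
  σ-square Sign.+ = lemma
    where
    lemma : ∀ x → + 1 * (+ 1 * x) ≡ x
    lemma = solve-∀
  σ-square Sign.- = lemma
    where
    lemma : ∀ x → - + 1 * (- + 1 * x) ≡ x
    lemma = solve-∀

  -- The difference is 2, and `p` exceeds 2.
  opposite-classes : ∀ {p k} → p ≡ 4 ℕ.* k ℕ.+ 3 → ¬ (+ 1 ≡ - + 1 [mod p ])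
  opposite-classes {p} {k} p≡4k+3 e =
    ℕₚ.<⇒≱ (subst (2 <_) (sym p≡4k+3) (ℕₚ.m≤n+m 3 (4 ℕ.* k))) (ℕ∣.∣⇒≤ (ℤ∣.∣⇒∣ᵤ (mod⇒∣ e)))

  ∣⇒∣^ : ∀ {a d} → 1 ≤ d → ∀ x → a ℤ∣.∣ x → a ℤ∣.∣ x ℤ.^ d
  ∣⇒∣^ {d = suc d} _ x a∣x = ℤ∣.∣m⇒∣m*n (x ℤ.^ d) a∣x

  -- In the application `d` is φ(pˢ)/2 rather than (p - 1)/2. It is an odd multiple of the latter,
  -- so `x ^ d` modulo `p` is still the Legendre symbol. The hypothesis `euler` is supplied later by
  -- the orbits of `l`.
  module CyclotomicNumbers
    (p d k : ℕ) .{{_ : NonZero p}} (pr : Prime p) (p≡4k+3 : p ≡ 4 ℕ.* k ℕ.+ 3)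
    (1≤d : 1 ≤ d) (-1^d≡-1 : (- + 1) ℤ.^ d ≡ - + 1)
    (euler : ∀ x → ¬ (+ p ℤ∣.∣ x) → ∃[ ε ] x ℤ.^ d ≡ σ ε [mod p ]) where

    1≢-1 : ¬ (+ 1 ≡ - + 1 [mod p ])
    1≢-1 = opposite-classes {k = k} p≡4k+3

    p∤1 : ¬ (+ p ℤ∣.∣ + 1)
    p∤1 p∣1 = ℕₚ.<⇒≱ (subst (1 <_) (sym p≡4k+3) (ℕₚ.≤-trans (s≤s (s≤s z≤n)) (ℕₚ.m≤n+m 3 (4 ℕ.* k))))
        (ℕ∣.∣⇒≤ (ℤ∣.∣⇒∣ᵤ p∣1))

    σ-injective : ∀ δ ε → σ δ ≡ σ ε [mod p ] → δ ≡ ε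
    σ-injective Sign.+ Sign.+ e = refl
    σ-injective Sign.+ Sign.- e = contradiction e 1≢-1
    σ-injective Sign.- Sign.+ e = contradiction (mod-sym e) 1≢-1
    σ-injective Sign.- Sign.- e = refl

    ∣⇒^d : ∀ {x} → + p ℤ∣.∣ x → + p ℤ∣.∣ x ℤ.^ d
    ∣⇒^d {x} = ∣⇒∣^ 1≤d x

    ^d⇒∤ : ∀ {x} δ → x ℤ.^ d ≡ σ δ [mod p ] → ¬ (+ p ℤ∣.∣ x)
    ^d⇒∤ {x} δ e p∣x = p∤1 (subst (+ p ℤ∣.∣_) (trans (cong (σ δ *_) (sym (ℤₚ.*-identityʳ (σ δ)))) (σ-square δ (+ 1)))
      (ℤ∣.∣n⇒∣m*n (σ δ) (∣-mod (mod-sym e) (∣⇒^d p∣x))))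

    -- Indicator function of the integers with Legendre symbol ε (Euler's criterion).
    H : Sign → ℤ → ℤ
    H ε x = ⟦ mod? p (x ℤ.^ d) (σ ε) ⟧

    Z : ℤ → ℤ
    Z = lift p (λ _ → + 1)

    H-periodic : ∀ ε → Periodic p (H ε)
    H-periodic ε {x} {y} x≡y = ⟦⟧-cong (mod? p (x ℤ.^ d) (σ ε)) (mod? p (y ℤ.^ d) (σ ε))
      (mod-trans (mod-sym (mod-^ d x≡y))) (mod-trans (mod-^ d x≡y))

    Z-∣ : ∀ {x} → + p ℤ∣.∣ x → Z x ≡ + 1
    Z-∣ (ℤ∣.divides u e) = trans (cong Z e) (lift-multiple p (λ _ → + 1) u)

    Z-∤ : ∀ {x} → ¬ (+ p ℤ∣.∣ x) → Z x ≡ + 0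
    Z-∤ = lift-nonmultiple p (λ _ → + 1)

    H-∣ : ∀ ε {x} → + p ℤ∣.∣ x → H ε x ≡ + 0
    H-∣ ε {x} p∣x = ⟦⟧-false (mod? p (x ℤ.^ d) (σ ε)) (λ e → ^d⇒∤ ε e p∣x)

    same : Sign → Sign → ℤ
    same Sign.+ Sign.+ = + 1
    same Sign.+ Sign.- = + 0
    same Sign.- Sign.+ = + 0
    same Sign.- Sign.- = + 1

    H-value : ∀ ε {x} δ → x ℤ.^ d ≡ σ δ [mod p ] → H ε x ≡ same ε δ
    H-value Sign.+ {x} Sign.+ e = ⟦⟧-true (mod? p (x ℤ.^ d) _) e
    H-value Sign.+ {x} Sign.- e = ⟦⟧-false (mod? p (x ℤ.^ d) _) λ f → 1≢-1 (mod-trans (mod-sym f) e)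
    H-value Sign.- {x} Sign.+ e = ⟦⟧-false (mod? p (x ℤ.^ d) _) λ f → 1≢-1 (mod-trans (mod-sym e) f)
    H-value Sign.- {x} Sign.- e = ⟦⟧-true (mod? p (x ℤ.^ d) _) e

    data Class (x : ℤ) : Set where
      multiple : + p ℤ∣.∣ x → Class x
      unit     : ∀ ε → x ℤ.^ d ≡ σ ε [mod p ] → Class x

    classify : ∀ x → Class x
    classify x = decide (+ p ℤ∣.∣? x)
      where
      decide : Dec (+ p ℤ∣.∣ x) → Class x
      decide (yes p∣x) = multiple p∣x
      decide (no p∤x)  = unit (proj₁ (euler x p∤x)) (proj₂ (euler x p∤x))

    unit⇒comaximal : ∀ {x} δ → x ℤ.^ d ≡ σ δ [mod p ] → Comaximal x (+ p)
    unit⇒comaximal δ e = ∤⇒comaximal pr (^d⇒∤ δ e)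

    H-multiplicative : ∀ ε {w} δ → w ℤ.^ d ≡ σ δ [mod p ] → ∀ x → H ε (w * x) ≡ H (δ Sign.* ε) x
    H-multiplicative ε {w} δ e x = ⟦⟧-cong (mod? p ((w * x) ℤ.^ d) (σ ε)) (mod? p (x ℤ.^ d) (σ (δ Sign.* ε)))
      (λ f → mod-trans (mod-reflexive (sym (σ-square δ (x ℤ.^ d))))
        (mod-trans (mod-* (mod-refl {x = σ δ}) (mod-trans (mod-sym expand) f)) (mod-reflexive (σ-* δ ε))))
      (λ f → mod-trans expand (mod-trans (mod-* (mod-refl {x = σ δ}) (mod-trans f (mod-reflexive (sym (σ-* δ ε)))))
        (mod-reflexive (σ-square δ (σ ε)))))
      where
      expand : (w * x) ℤ.^ d ≡ σ δ * x ℤ.^ d [mod p ]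
      expand = mod-trans (mod-reflexive (^-distribʳ-* w x d)) (mod-* e (mod-refl {x = x ℤ.^ d}))

    -- This is where -1 being a nonresidue, in the form `(-1)^d = -1`, enters the counting: negation
    -- exchanges the two classes.
    H-neg : ∀ ε x → H ε (- x) ≡ H (opposite ε) x
    H-neg ε x = trans (cong (H ε) (sym (ℤₚ.-1*i≡-i x))) (H-multiplicative ε Sign.- (mod-reflexive -1^d≡-1) x)

    H-total : ∀ x → H Sign.+ x + H Sign.- x + Z x ≡ + 1
    H-total x with classify x
    ... | multiple p∣x rewrite H-∣ Sign.+ p∣x | H-∣ Sign.- p∣x | Z-∣ p∣x = refl
    ... | unit Sign.+ e rewrite H-value Sign.+ Sign.+ e | H-value Sign.- Sign.+ e | Z-∤ (^d⇒∤ Sign.+ e) = refl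
    ... | unit Sign.- e rewrite H-value Sign.+ Sign.- e | H-value Sign.- Sign.- e | Z-∤ (^d⇒∤ Sign.- e) = refl

    open ≡.≡-Reasoning

    -- The size (p - 1)/2 of each quadratic class, for p = 4k + 3.
    h : ℤ
    h = + (2 ℕ.* k ℕ.+ 1)

    h≡2k+1 : h ≡ + 2 * + k + + 1
    h≡2k+1 = trans (ℤₚ.pos-+ (2 ℕ.* k) 1) (cong (_+ + 1) (ℤₚ.pos-* 2 k))

    double-injective : ∀ {x y} → x + x ≡ y + y → x ≡ y
    double-injective {x} {y} e = ℤₚ.*-cancelˡ-≡ (+ 2) x y (trans (lemma x) (trans e (sym (lemma y))))
      where
      lemma : ∀ x → + 2 * x ≡ x + x
      lemma = solve-∀

    range-H-opposite : range p (H Sign.-) ≡ range p (H Sign.+)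
    range-H-opposite = trans (range-cong p (λ x → sym (H-neg Sign.+ x)))
      (trans (range-cong p (λ x → cong (H Sign.+) (sym (ℤₚ.-1*i≡-i x))))
        (range-scale p (H-periodic Sign.+) { - + 1} (- + 1 , + 0 , refl)))

    -- Negation exchanges the two classes, and together with a single multiple of `p` they fill a
    -- residue system; hence twice the class size plus 1 is `p`.
    range-H : ∀ ε → range p (H ε) ≡ h
    range-H Sign.- = trans range-H-opposite (range-H Sign.+)
    range-H Sign.+ = double-injective (ℤ+.∙-cancelʳ (+ 1) _ _ (begin
      range p (H Sign.+) + range p (H Sign.+) + + 1         ≡⟨ cong₂
          (λ x y → range p (H Sign.+) + x + y) range-H-opposite (range-lift-1 p) ⟨
      range p (H Sign.+) + range p (H Sign.-) + range p Z   ≡⟨ cong (_+ range p Z)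
          (range-distrib p (H Sign.+) (H Sign.-)) ⟨
      range p (λ x → H Sign.+ x + H Sign.- x) + range p Z   ≡⟨ range-distrib p (λ x → H Sign.+ x + H Sign.- x) Z ⟨
      range p (λ x → H Sign.+ x + H Sign.- x + Z x)         ≡⟨ range-cong p H-total ⟩
      range p (λ _ → + 1)                                   ≡⟨ range-1 p ⟩
      + p                                                   ≡⟨ cong +_ p≡4k+3 ⟩
      + (4 ℕ.* k ℕ.+ 3)                                     ≡⟨ trans (ℤₚ.pos-+ (4 ℕ.* k) 3)
          (cong (_+ + 3) (ℤₚ.pos-* 4 k)) ⟩
      + 4 * + k + + 3                                       ≡⟨ lemma (+ k) ⟩
      (+ 2 * + k + + 1) + (+ 2 * + k + + 1) + + 1           ≡⟨ cong (λ x → x + x + + 1) h≡2k+1 ⟨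
      h + h + + 1                                           ∎))
      where
      lemma : ∀ k → + 4 * k + + 3 ≡ (+ 2 * k + + 1) + (+ 2 * k + + 1) + + 1
      lemma = solve-∀

    -- The number of ways to write 1 modulo `p` as a sum of an element of class `ε` and one of class
    -- `δ`: up to signs of the arguments, the cyclotomic numbers of order two.
    J : Sign → Sign → ℤ
    J ε δ = convolve p (H ε) (H δ) (+ 1)

    convolve-periodic : ∀ ε δ c → Periodic p (λ b → H ε (c - b) * H δ b)
    convolve-periodic ε δ c x≡y = cong₂ _*_ (H-periodic ε (mod-- (mod-refl {x = c}) x≡y)) (H-periodic δ x≡y)

    -- Dividing u + v = w by `w` multiplies the classes of u and v by that of `w`.
    convolve-unit : ∀ ε δ {w} θ → w ℤ.^ d ≡ σ θ [mod p ] → convolve p (H ε) (H δ) w ≡ J (θ Sign.* ε) (θ Sign.* δ)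
    convolve-unit ε δ {w} θ e = begin
      range p (λ b → H ε (w - b) * H δ b)
        ≡⟨ range-scale p (convolve-periodic ε δ w) (unit⇒comaximal θ e) ⟨
      range p (λ b → H ε (w - w * b) * H δ (w * b))
        ≡⟨ range-cong p (λ b → cong₂ _*_ (trans (cong (H ε) (lemma w b))
            (H-multiplicative ε θ e (+ 1 - b))) (H-multiplicative δ θ e b)) ⟩
      J (θ Sign.* ε) (θ Sign.* δ) ∎
      where
      lemma : ∀ w b → w - w * b ≡ w * (+ 1 - b)
      lemma = solve-∀

    convolve-multiple : ∀ ε δ {c} → + p ℤ∣.∣ c → convolve p (H ε) (H δ) c ≡ range p (λ b → H (opposite ε) b * H δ b)
    convolve-multiple ε δ {c} p∣c = range-cong p λ b → cong (_* H δ b)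
      (trans (H-periodic ε (mod-trans (mod-- (∣⇒mod0 p∣c) (mod-refl {x = b}))
          (mod-reflexive (ℤₚ.+-identityˡ (- b))))) (H-neg ε b))

    H-idempotent : ∀ ε b → H ε b * H ε b ≡ H ε b
    H-idempotent ε b with mod? p (b ℤ.^ d) (σ ε)
    ... | yes _ = refl
    ... | no _  = refl

    H-disjoint : ∀ ε b → H (opposite ε) b * H ε b ≡ + 0
    H-disjoint ε b with classify b
    ... | multiple p∣b = trans (cong (H (opposite ε) b *_) (H-∣ ε p∣b)) (ℤₚ.*-zeroʳ (H (opposite ε) b))
    ... | unit δ e = trans (cong₂ _*_ (H-value (opposite ε) δ e) (H-value ε δ e)) (table ε δ)
      where
      table : ∀ ε δ → same (opposite ε) δ * same ε δ ≡ + 0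
      table Sign.+ Sign.+ = refl
      table Sign.+ Sign.- = refl
      table Sign.- Sign.+ = refl
      table Sign.- Sign.- = refl

    J-sym : ∀ ε δ → J ε δ ≡ J δ ε
    J-sym ε δ = begin
      range p (λ b → H ε (+ 1 - b) * H δ b)
        ≡⟨ range-reflect p (convolve-periodic ε δ (+ 1)) (+ 1) ⟨
      range p (λ b → H ε (+ 1 - (+ 1 - b)) * H δ (+ 1 - b))
        ≡⟨ range-cong p (λ b → trans (cong (λ x → H ε x * H δ (+ 1 - b)) (lemma b))
            (ℤₚ.*-comm (H ε b) (H δ (+ 1 - b)))) ⟩
      range p (λ b → H δ (+ 1 - b) * H ε b) ∎
      where
      lemma : ∀ b → + 1 - (+ 1 - b) ≡ b
      lemma = solve-∀

    -- Sort the `b` of class `δ` by the class of `1 - b`. The case that `p` divides `1 - b` leaves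
    -- only `b ≡ 1`, which is counted by the term `H δ (+ 1)`.
    J-row : ∀ δ → J Sign.+ δ + J Sign.- δ + H δ (+ 1) ≡ h
    J-row δ = begin
      J Sign.+ δ + J Sign.- δ + H δ (+ 1)
        ≡⟨ cong (λ x → J Sign.+ δ + J Sign.- δ + x)
            (trans (sym (ℤₚ.*-identityˡ (H δ (+ 1))))
                (cong (_* H δ (+ 1)) (sym (trans (range-reflect p (lift-1-periodic p) (+ 1)) (range-lift-1 p))))) ⟩
      J Sign.+ δ + J Sign.- δ + range p (λ b → Z (+ 1 - b)) * H δ (+ 1)
        ≡⟨ cong (λ x → J Sign.+ δ + J Sign.- δ + x) (range-*ʳ p (H δ (+ 1)) (λ b → Z (+ 1 - b))) ⟨
      J Sign.+ δ + J Sign.- δ + range p (λ b → Z (+ 1 - b) * H δ (+ 1))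
        ≡⟨ cong₂ _+_ (range-distrib p (λ b → H Sign.+ (+ 1 - b) * H δ b)
            (λ b → H Sign.- (+ 1 - b) * H δ b)) (range-cong p diagonal) ⟨
      range p (λ b → H Sign.+ (+ 1 - b) * H δ b + H Sign.- (+ 1 - b) * H δ b) + range p (λ b → Z (+ 1 - b) * H δ b)
        ≡⟨ range-distrib p (λ b → H Sign.+ (+ 1 - b) * H δ b + H Sign.- (+ 1 - b) * H δ b)
            (λ b → Z (+ 1 - b) * H δ b) ⟨
      range p (λ b → H Sign.+ (+ 1 - b) * H δ b + H Sign.- (+ 1 - b) * H δ b + Z (+ 1 - b) * H δ b)
        ≡⟨ range-cong p (λ b → trans (lemma (H Sign.+ (+ 1 - b)) (H Sign.- (+ 1 - b)) (Z (+ 1 - b)) (H δ b))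
             (trans (cong (_* H δ b) (H-total (+ 1 - b))) (ℤₚ.*-identityˡ (H δ b)))) ⟩
      range p (H δ)
        ≡⟨ range-H δ ⟩
      h ∎
      where
      lemma : ∀ a b c x → a * x + b * x + c * x ≡ (a + b + c) * x
      lemma = solve-∀
      diagonal : ∀ b → Z (+ 1 - b) * H δ b ≡ Z (+ 1 - b) * H δ (+ 1)
      diagonal b with + p ℤ∣.∣? (+ 1 - b)
      ... | yes p∣1-b = cong (Z (+ 1 - b) *_) (H-periodic δ (mod-sym (∣⇒mod p∣1-b)))
      ... | no p∤1-b = trans (cong (_* H δ b) (Z-∤ p∤1-b)) (sym (cong (_* H δ (+ 1)) (Z-∤ p∤1-b)))

    weighted : ∀ ε δ b → H Sign.+ b * convolve p (H ε) (H δ) b ≡ H Sign.+ b * J ε δ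
    weighted ε δ b with mod? p (b ℤ.^ d) (σ Sign.+)
    ... | yes e = cong (+ 1 *_) (convolve-unit ε δ Sign.+ e)
    ... | no _ = refl

    range-weighted : ∀ ε δ → range p (λ b → H Sign.+ b * convolve p (H ε) (H δ) b) ≡ h * J ε δ
    range-weighted ε δ = trans (range-cong p (weighted ε δ))
      (trans (range-*ʳ p (J ε δ) (H Sign.+)) (cong (_* J ε δ) (range-H Sign.+)))

    -- Both sides, multiplied by h, count the solutions of u + v = w in quadratic
    -- residues; the right one reads the equation as u = w - v, where -v is a nonresidue.
    J-++≡J-−+ : J Sign.+ Sign.+ ≡ J Sign.- Sign.+
    J-++≡J-−+ = ℤₚ.*-cancelˡ-≡ h _ _ {{ℕ.≢-nonZero (ℕₚ.m+1+n≢0 (2 ℕ.* k))}} (begin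
      h * J Sign.+ Sign.+
        ≡⟨ range-weighted Sign.+ Sign.+ ⟨
      range p (λ w → H Sign.+ w * range p (λ b → H Sign.+ (w - b) * H Sign.+ b))
        ≡⟨ range-cong p (λ w → range-*ˡ p (H Sign.+ w) (λ b → H Sign.+ (w - b) * H Sign.+ b)) ⟨
      range p (λ w → range p (λ b → H Sign.+ w * (H Sign.+ (w - b) * H Sign.+ b)))
        ≡⟨ range-swap p p (λ w b → H Sign.+ w * (H Sign.+ (w - b) * H Sign.+ b)) ⟩
      range p (λ b → range p (λ w → H Sign.+ w * (H Sign.+ (w - b) * H Sign.+ b)))
        ≡⟨ range-cong p (λ b → trans (range-cong p (λ w → trans
             (cong (λ x → H Sign.+ w * (x * H Sign.+ b)) (trans (cong (H Sign.+) (flip w b)) (H-neg Sign.+ (b - w))))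
             (reorder (H Sign.+ w) (H Sign.- (b - w)) (H Sign.+ b))))
             (range-*ˡ p (H Sign.+ b) (λ w → H Sign.- (b - w) * H Sign.+ w))) ⟩
      range p (λ b → H Sign.+ b * range p (λ w → H Sign.- (b - w) * H Sign.+ w))
        ≡⟨ range-weighted Sign.- Sign.+ ⟩
      h * J Sign.- Sign.+ ∎)
      where
      flip : ∀ w b → w - b ≡ - (b - w)
      flip = solve-∀
      reorder : ∀ x y z → x * (y * z) ≡ z * (y * x)
      reorder = solve-∀

    -- In the row of residues the two entries agree and 1 itself is a residue, so twice the entry
    -- plus 1 is `h`, that is 2k + 1.
    J-++ : J Sign.+ Sign.+ ≡ + k
    J-++ = double-injective (ℤ+.∙-cancelʳ (+ 1) _ _ (begin
      J Sign.+ Sign.+ + J Sign.+ Sign.+ + + 1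
        ≡⟨ cong₂ (λ x y → J Sign.+ Sign.+ + x + y) J-++≡J-−+
            (sym (H-value Sign.+ Sign.+ (mod-reflexive (ℤₚ.^-zeroˡ d)))) ⟩
      J Sign.+ Sign.+ + J Sign.- Sign.+ + H Sign.+ (+ 1)   ≡⟨ J-row Sign.+ ⟩
      h                                                    ≡⟨ h≡2k+1 ⟩
      + 2 * + k + + 1                                      ≡⟨ lemma (+ k) ⟩
      + k + + k + + 1                                      ∎))
      where
      lemma : ∀ k → + 2 * k + + 1 ≡ k + k + + 1
      lemma = solve-∀

    J-−+ : J Sign.- Sign.+ ≡ + k
    J-−+ = trans (sym J-++≡J-−+) J-++

    J-+− : J Sign.+ Sign.- ≡ + k
    J-+− = trans (J-sym Sign.+ Sign.-) J-−+

    -- In the row of nonresidues the term for `b ≡ 1` vanishes, so this entry is h - k. The missing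
    -- 1 is the difference between the coefficients (p + 1)/4 and (p - 3)/4.
    J-−− : J Sign.- Sign.- ≡ + (k ℕ.+ 1)
    J-−− = ℤ+.∙-cancelˡ (+ k) _ _ (begin
      + k + J Sign.- Sign.-                                ≡⟨ cong (_+ J Sign.- Sign.-) J-+− ⟨
      J Sign.+ Sign.- + J Sign.- Sign.-                    ≡⟨ ℤₚ.+-identityʳ _ ⟨
      J Sign.+ Sign.- + J Sign.- Sign.- + + 0
        ≡⟨ cong (λ x → J Sign.+ Sign.- + J Sign.- Sign.- + x) (H-value Sign.- Sign.+ (mod-reflexive (ℤₚ.^-zeroˡ d))) ⟨
      J Sign.+ Sign.- + J Sign.- Sign.- + H Sign.- (+ 1)   ≡⟨ J-row Sign.- ⟩
      h                                                    ≡⟨ h≡2k+1 ⟩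
      + 2 * + k + + 1                                      ≡⟨ lemma (+ k) ⟩
      + k + (+ k + + 1)                                    ≡⟨ cong (λ x → + k + x) (ℤₚ.pos-+ k 1) ⟨
      + k + + (k ℕ.+ 1)                                    ∎)
      where
      lemma : ∀ k → + 2 * k + + 1 ≡ k + (k + + 1)
      lemma = solve-∀

    -- After division by a unit `c`, both summands are residues if `c` has class `ε`, and
    -- nonresidues otherwise. A multiple of `p` is never reached, because the negative of an element
    -- of class `ε` lies in the other class.
    convolve-same : ∀ ε c → convolve p (H ε) (H ε) c ≡ + k * H ε c + + (k ℕ.+ 1) * H (opposite ε) c
    convolve-same ε c with classify c
    ... | multiple p∣c = trans (trans (convolve-multiple ε ε p∣c) (trans (range-cong p (H-disjoint ε)) (range-0 p)))
        (sym (trans (cong₂ (λ x y → + k * x + + (k ℕ.+ 1) * y) (H-∣ ε p∣c) (H-∣ (opposite ε) p∣c))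
                    (zeros (+ k) (+ (k ℕ.+ 1)))))
      where
      zeros : ∀ a b → a * + 0 + b * + 0 ≡ + 0
      zeros = solve-∀
    ... | unit θ e = trans (convolve-unit ε ε θ e) (trans (table ε θ)
        (sym (cong₂ (λ x y → + k * x + + (k ℕ.+ 1) * y) (H-value ε θ e) (H-value (opposite ε) θ e))))
      where
      first : ∀ a b → a ≡ a * + 1 + b * + 0
      first = solve-∀
      second : ∀ a b → b ≡ a * + 0 + b * + 1
      second = solve-∀
      table : ∀ ε θ → J (θ Sign.* ε) (θ Sign.* ε) ≡ + k * same ε θ + + (k ℕ.+ 1) * same (opposite ε) θ
      table Sign.+ Sign.+ = trans J-++ (first (+ k) (+ (k ℕ.+ 1)))
      table Sign.+ Sign.- = trans J-−− (second (+ k) (+ (k ℕ.+ 1)))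
      table Sign.- Sign.+ = trans J-−− (second (+ k) (+ (k ℕ.+ 1)))
      table Sign.- Sign.- = trans J-++ (first (+ k) (+ (k ℕ.+ 1)))

    -- For a unit `c` division leaves one residue and one nonresidue, hence `k` solutions in either
    -- order. At a multiple of `p` every element of the second class pairs with its negative, which
    -- gives `h` solutions.
    convolve-opposite : ∀ ε c → convolve p (H ε) (H (opposite ε)) c ≡ + k * (H Sign.+ c + H Sign.- c) + h * Z c
    convolve-opposite ε c with classify c
    ... | multiple p∣c = trans (trans (convolve-multiple ε (opposite ε) p∣c)
        (trans (range-cong p (H-idempotent (opposite ε))) (range-H (opposite ε))))
        (sym (trans (cong₂ _+_ (cong₂ (λ x y → + k * (x + y)) (H-∣ Sign.+ p∣c) (H-∣ Sign.- p∣c))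
            (cong (h *_) (Z-∣ p∣c)))
                    (lemma (+ k) h)))
      where
      lemma : ∀ a b → a * (+ 0 + + 0) + b * + 1 ≡ b
      lemma = solve-∀
    ... | unit θ e = trans (convolve-unit ε (opposite ε) θ e) (trans (trans (table ε θ) (lemma (+ k) h))
        (sym (cong₂ _+_ (cong (+ k *_) H-sum) (cong (h *_) (Z-∤ (^d⇒∤ θ e))))))
      where
      lemma : ∀ a b → a ≡ a * + 1 + b * + 0
      lemma = solve-∀
      table : ∀ ε θ → J (θ Sign.* ε) (θ Sign.* opposite ε) ≡ + k
      table Sign.+ Sign.+ = J-+−
      table Sign.+ Sign.- = J-−+
      table Sign.- Sign.+ = J-−+
      table Sign.- Sign.- = J-+−
      H-sum : H Sign.+ c + H Sign.- c ≡ + 1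
      H-sum = trans (cong₂ _+_ (H-value Sign.+ θ e) (H-value Sign.- θ e)) (sum θ)
        where
        sum : ∀ θ → same Sign.+ θ + same Sign.- θ ≡ + 1
        sum Sign.+ = refl
        sum Sign.- = refl

-- Euler's function at prime powers, and parity.

module Totient where

  open import Data.Integer.Base using (_+_; _*_; -_; _-_)
  open IntegerSum
  open import Algebra.Properties.CommutativeMonoid.Sum ℤₚ.+-0-commutativeMonoid using (sum)

  length-filter : ∀ {P : ℕ → Set} (P? : Decidable P) f m →
                  + length (filter P? (applyUpTo f m)) ≡ sum {m} (λ i → ⟦ P? (f (toℕ i)) ⟧)
  length-filter P? f zero    = refl
  length-filter P? f (suc m) with P? (f 0)
  ... | yes _ = cong (λ x → + 1 + x) (length-filter P? (f ∘ suc) m)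
  ... | no _  = trans (length-filter P? (f ∘ suc) m) (sym (ℤₚ.+-identityˡ _))

  -- `φ` counts over 1,...,m; since coprimality to `m` is m-periodic, a shift by one moves the count
  -- to 0,...,m-1.
  φ-range : ∀ m .{{_ : NonZero m}} → + φ m ≡ range m (λ z → ⟦ coprime? ∣ z ∣ m ⟧)
  φ-range m = begin
    + φ m                                                ≡⟨ cong
        (λ ks → + length (filter (λ k → coprime? k m) ks)) (map-upTo suc m) ⟩
    + length (filter (λ k → coprime? k m) (applyUpTo suc m))  ≡⟨ length-filter (λ k → coprime? k m) suc m ⟩
    range m (λ z → F (+ 1 + z))                          ≡⟨ range-cong m (λ z → cong F (ℤₚ.+-comm (+ 1) z)) ⟩
    range m (λ z → F (z + + 1))                          ≡⟨ range-translate m F-periodic (+ 1) ⟩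
    range m F                                            ∎
    where
    open ≡.≡-Reasoning
    F : ℤ → ℤ
    F z = ⟦ coprime? ∣ z ∣ m ⟧
    F-periodic : Periodic m F
    F-periodic {x} {y} x≡y = ⟦⟧-cong (coprime? ∣ x ∣ m) (coprime? ∣ y ∣ m) (transport (mod-sym x≡y)) (transport x≡y)
      where
      transport : ∀ {x y} → x ≡ y [mod m ] → Coprime ∣ y ∣ m → Coprime ∣ x ∣ m
      transport x≡y c = comaximal⇒coprime (comaximal-mod x≡y (comaximal-∣∣ (coprime⇒comaximal c)))

  -- Indicator function of the units modulo pᵉ, so constantly 1 for e = 0.
  U : ℕ → ℕ → ℤ → ℤ
  U p zero    _ = + 1
  U p (suc _) x = + 1 - lift p (λ _ → + 1) x

  U-periodic : ∀ p .{{_ : NonZero p}} e → Periodic p (U p e)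
  U-periodic p zero    _   = refl
  U-periodic p (suc e) x≡y = cong (λ z → + 1 - z) (lift-1-periodic p x≡y)

  U-unit : ∀ p e x → (1 ≤ e → ¬ (+ p ℤ∣.∣ x)) → U p e x ≡ + 1
  U-unit p zero    x _   = refl
  U-unit p (suc e) x p∤x = cong (λ z → + 1 - z) (lift-nonmultiple p (λ _ → + 1) (p∤x (s≤s z≤n)))

  U-nonunit : ∀ p .{{_ : NonZero p}} e x → 1 ≤ e → + p ℤ∣.∣ x → U p e x ≡ + 0
  U-nonunit p (suc e) x _ (ℤ∣.divides u eq) =
    cong (λ z → + 1 - z) (trans (cong (lift p (λ _ → + 1)) eq) (lift-multiple p (λ _ → + 1) u))

  coprime-indicator : ∀ {p} → Prime p → ∀ e z → ⟦ coprime? ∣ z ∣ (p ^ e) ⟧ ≡ U p e z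
  coprime-indicator {p} pr zero    z = ⟦⟧-true (coprime? ∣ z ∣ 1) (Coprimality.sym (Coprimality.1-coprimeTo ∣ z ∣))
  coprime-indicator {p} pr (suc e) z = decide (+ p ℤ∣.∣? z)
    where
    instance
      _ : NonZero p
      _ = prime⇒nonZero pr
    decide : Dec (+ p ℤ∣.∣ z) → ⟦ coprime? ∣ z ∣ (p ^ suc e) ⟧ ≡ U p (suc e) z
    decide (yes p∣z) = trans (⟦⟧-false (coprime? ∣ z ∣ (p ^ suc e))
        (λ c → ℕ.nonTrivial⇒≢1 {{prime⇒nonTrivial pr}} (c (ℤ∣.∣⇒∣ᵤ p∣z , ℕ∣.m∣m*n (p ^ e)))))
      (sym (U-nonunit p (suc e) z (s≤s z≤n) p∣z))
    decide (no p∤z) = trans (⟦⟧-true (coprime? ∣ z ∣ (p ^ suc e))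
        (comaximal⇒coprime (comaximal-pow (suc e) (∤⇒comaximal pr p∤z))))
      (sym (U-unit p (suc e) z (λ _ → p∤z)))

  φ-prime-power : ∀ {p} → Prime p → ∀ e → + φ (p ^ e) ≡ range (p ^ e) (U p e)
  φ-prime-power {p} pr e = trans (φ-range (p ^ e) {{ℕₚ.m^n≢0 p e {{prime⇒nonZero pr}}}})
                                 (range-cong (p ^ e) (coprime-indicator pr e))

  -- Each of the pᵉ blocks of length `p` contains exactly one multiple of `p`.
  φ-formula : ∀ {p} → Prime p → ∀ e m → p ≡ suc m → φ (p ^ suc e) ≡ p ^ e ℕ.* m
  φ-formula {p} pr e m p≡1+m = ℤₚ.+-injective (begin
    + φ (p ^ suc e)                                ≡⟨ φ-prime-power pr (suc e) ⟩
    range (p ℕ.* p ^ e) (U p (suc e))              ≡⟨ cong (λ n → range n (U p (suc e))) (ℕₚ.*-comm p (p ^ e)) ⟩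
    range (p ^ e ℕ.* p) (U p (suc e))              ≡⟨ range-periodic (p ^ e) p (U-periodic p (suc e)) ⟩
    + (p ^ e) * range p (U p (suc e))              ≡⟨ cong (+ (p ^ e) *_) count ⟩
    + (p ^ e) * + m                                ≡⟨ ℤₚ.pos-* (p ^ e) m ⟨
    + (p ^ e ℕ.* m)                                ∎)
    where
    open ≡.≡-Reasoning
    instance
      _ : NonZero p
      _ = prime⇒nonZero pr
    L : ℤ → ℤ
    L = lift p (λ _ → + 1)
    lemma : ∀ a b → a + b - b ≡ a
    lemma = solve-∀
    count : range p (U p (suc e)) ≡ + m
    count = begin
      range p (U p (suc e))                          ≡⟨ lemma (range p (U p (suc e))) (range p L) ⟨
      range p (U p (suc e)) + range p L - range p L  ≡⟨ cong (_- range p L) (range-distrib p (U p (suc e)) L) ⟨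
      range p (λ x → + 1 - L x + L x) - range p L    ≡⟨ cong (_- range p L) (range-cong p (λ x → cancel (L x))) ⟩
      range p (λ _ → + 1) - range p L                ≡⟨ cong₂ _-_ (range-1 p) (range-lift-1 p) ⟩
      + p - + 1                                      ≡⟨ cong (λ x → + x - + 1) p≡1+m ⟩
      + suc m - + 1                                  ≡⟨⟩
      + m                                            ∎
      where
      cancel : ∀ x → + 1 - x + x ≡ + 1
      cancel = solve-∀

  -1^2c≡1 : ∀ c → (- + 1) ℤ.^ (2 ℕ.* c) ≡ + 1
  -1^2c≡1 c = trans (sym (ℤₚ.^-*-assoc (- + 1) 2 c)) (ℤₚ.^-zeroˡ c)

  -1^odd≡-1 : ∀ c → (- + 1) ℤ.^ (2 ℕ.* c ℕ.+ 1) ≡ - + 1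
  -1^odd≡-1 c = trans (ℤₚ.^-distribˡ-+-* (- + 1) (2 ℕ.* c) 1) (cong (_* (- + 1)) (-1^2c≡1 c))

  -1^odd^e≡-1 : ∀ {p} → (- + 1) ℤ.^ p ≡ - + 1 → ∀ e → (- + 1) ℤ.^ (p ^ e) ≡ - + 1
  -1^odd^e≡-1 {p} odd zero    = refl
  -1^odd^e≡-1 {p} odd (suc e) = trans (sym (ℤₚ.^-*-assoc (- + 1) p (p ^ e)))
    (trans (cong (ℤ._^ (p ^ e)) odd) (-1^odd^e≡-1 odd e))

  -- A common divisor of `d` and `m` divides gcd(2d, m) = 2, and it is not 2 because `d` is odd,
  -- which is encoded as `(-1)^d = -1`.
  half-coprime : ∀ {d m} → (- + 1) ℤ.^ d ≡ - + 1 → gcd (d ℕ.+ d) m ≡ 2 → Coprime d m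
  half-coprime {d} {m} odd gcd≡2 {x} (x∣d , x∣m)
    with irreducible[2] (subst (x ∣_) gcd≡2 (gcd-greatest (ℕ∣.∣m∣n⇒∣m+n x∣d x∣d) x∣m))
  ... | inj₁ x≡1 = x≡1
  ... | inj₂ refl with ℕ∣.divides c refl ← x∣d =
    contradiction (trans (sym odd) (trans (cong ((- + 1) ℤ.^_) (ℕₚ.*-comm c 2)) (-1^2c≡1 c))) λ ()

-- Cyclotomic cosets and their indicator functions.

module CosetProduct where

  open import Data.Integer.Base using (_+_; _*_; -_; _-_)
  open IntegerSum
  open Order
  open QuadraticCharacter
  open Totient

  ∣^ : ∀ {p e} → 1 ≤ e → p ∣ p ^ e
  ∣^ {p} {suc e} _ = ℕ∣.m∣m*n (p ^ e)

  ^-split : ∀ p {i s} → i ≤ s → p ^ (s ∸ i) ℕ.* p ^ i ≡ p ^ s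
  ^-split p {i} {s} i≤s = trans (sym (ℕₚ.^-distribˡ-+-* p (s ∸ i) i)) (cong (p ^_) (ℕₚ.m∸n+n≡m i≤s))

  distinct-primes : ∀ {p q} → Prime p → Prime q → p ≢ q → Comaximal (+ p) (+ q)
  distinct-primes {p} {q} pr qr p≢q with prime-comaximal qr (+ p)
  ... | inj₂ c = c
  ... | inj₁ q∣p with prime⇒irreducible pr (ℤ∣.∣⇒∣ᵤ q∣p)
  ...   | inj₁ q≡1 = contradiction q≡1 (ℕ.nonTrivial⇒≢1 {{prime⇒nonTrivial qr}})
  ...   | inj₂ q≡p = contradiction (sym q≡p) p≢q

  comaximal-powers : ∀ {p q} → Comaximal (+ p) (+ q) → ∀ i j → Comaximal (+ (p ^ i)) (+ (q ^ j))
  comaximal-powers {p} {q} c i j = comaximal-pow j (comaximal-sym (comaximal-pow i (comaximal-sym c)))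

  *-involutive : ∀ δ ε → δ Sign.* (δ Sign.* ε) ≡ ε
  *-involutive Sign.+ ε      = refl
  *-involutive Sign.- Sign.+ = refl
  *-involutive Sign.- Sign.- = refl

  *-opposite : ∀ δ ε → δ Sign.* opposite ε ≡ opposite (δ Sign.* ε)
  *-opposite Sign.+ ε      = refl
  *-opposite Sign.- ε = refl

  module Cosets
    (s t p q l : ℕ) (g : ℤ) (k d : ℕ) (pr : Prime p) (qr : Prime q) (p≢q : p ≢ q) (p≡4k+3 : p ≡ 4 ℕ.* k ℕ.+ 3)
    (1≤s : 1 ≤ s) (1≤t : 1 ≤ t) (-1^d≡-1 : (- + 1) ℤ.^ d ≡ - + 1) (φ≡2d : φ (p ^ s) ≡ d ℕ.+ d)
    (l-order-p : IsOrder (p ^ s) (+ l) d) (l-order-q : IsOrder (q ^ t) (+ l) (φ (q ^ t)))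
    (d⊥φ : Coprime d (φ (q ^ t)))
    (g-order-p : IsPrimitiveRoot (p ^ s) g) (g-order-q : IsPrimitiveRoot (q ^ t) g) where

    instance
      p≢0 : NonZero p
      p≢0 = prime⇒nonZero pr
      q≢0 : NonZero q
      q≢0 = prime⇒nonZero qr
      p^s≢0 : NonZero (p ^ s)
      p^s≢0 = ℕₚ.m^n≢0 p s
      q^t≢0 : NonZero (q ^ t)
      q^t≢0 = ℕₚ.m^n≢0 q t

    1≤d : 1 ≤ d
    1≤d = IsOrder.positive l-order-p

    p⊥q : Comaximal (+ p) (+ q)
    p⊥q = distinct-primes pr qr p≢q

    p∣p^s : p ∣ p ^ s
    p∣p^s = ∣^ 1≤s

    q∣q^t : q ∣ q ^ t
    q∣q^t = ∣^ 1≤t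

    base : Sign → ℤ
    base Sign.+ = + 1
    base Sign.- = g

    l-unit-q : ∀ r → Comaximal ((+ l) ℤ.^ r) (+ (q ^ t))
    l-unit-q r = comaximal-^ r (order-unit l-order-q)

    base-unit-q : ∀ ε → Comaximal (base ε) (+ (q ^ t))
    base-unit-q Sign.+ = comaximal-1
    base-unit-q Sign.- = order-unit g-order-q

    ⟨l⟩^d : ∀ r → ((+ l) ℤ.^ r) ℤ.^ d ≡ + 1 [mod p ^ s ]
    ⟨l⟩^d r = mod-trans (mod-reflexive (trans (ℤₚ.^-*-assoc (+ l) r d) (cong ((+ l) ℤ.^_) (ℕₚ.*-comm r d))))
                        (^-multiple {k = + l} {d} (IsOrder.k^d≡1 l-order-p) r)

    a⟨l⟩^d : ∀ a r → (a * (+ l) ℤ.^ r) ℤ.^ d ≡ a ℤ.^ d [mod p ^ s ]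
    a⟨l⟩^d a r = mod-trans (mod-reflexive (^-distribʳ-* a ((+ l) ℤ.^ r) d))
      (mod-trans (mod-* (mod-refl {x = a ℤ.^ d}) (⟨l⟩^d r)) (mod-reflexive (ℤₚ.*-identityʳ _)))

    -- -1 lies in ⟨l⟩ or in g⟨l⟩. The first is impossible, since d-th powers would give 1 = (-1)^d =
    -- -1; in the second case the d-th power of -1 = g lʳ is `g^d`.
    g^d≡-1 : g ℤ.^ d ≡ - + 1 [mod p ^ s ]
    g^d≡-1 = decide (half-orbit l-order-p φ≡2d g-order-p (- + 1) (- + 1 , + 0 , refl))
      where
      decide : (∃[ r ] (+ l) ℤ.^ r ≡ - + 1 [mod p ^ s ]) ⊎ (∃[ r ] g * (+ l) ℤ.^ r ≡ - + 1 [mod p ^ s ]) →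
               g ℤ.^ d ≡ - + 1 [mod p ^ s ]
      decide (inj₁ (r , e)) = contradiction
        (mod-weaken p∣p^s (mod-trans (mod-sym (⟨l⟩^d r)) (mod-trans (mod-^ d e) (mod-reflexive -1^d≡-1))))
        (opposite-classes {k = k} p≡4k+3)
      decide (inj₂ (r , e)) = mod-trans (mod-sym (a⟨l⟩^d g r)) (mod-trans (mod-^ d e) (mod-reflexive -1^d≡-1))

    base^d : ∀ ε → base ε ℤ.^ d ≡ σ ε [mod p ^ s ]
    base^d Sign.+ = mod-reflexive (ℤₚ.^-zeroˡ d)
    base^d Sign.- = g^d≡-1

    base⟨l⟩^d : ∀ ε r → (base ε * (+ l) ℤ.^ r) ℤ.^ d ≡ σ ε [mod p ^ s ]
    base⟨l⟩^d ε r = mod-trans (a⟨l⟩^d (base ε) r) (base^d ε)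

    orbit : ∀ x → ¬ (+ p ℤ∣.∣ x) → ∃[ ε ] ∃[ r ] base ε * (+ l) ℤ.^ r ≡ x [mod p ^ s ]
    orbit x p∤x = decide (half-orbit l-order-p φ≡2d g-order-p x (comaximal-pow s (∤⇒comaximal pr p∤x)))
      where
      decide : (∃[ r ] (+ l) ℤ.^ r ≡ x [mod p ^ s ]) ⊎ (∃[ r ] g * (+ l) ℤ.^ r ≡ x [mod p ^ s ]) →
               ∃[ ε ] ∃[ r ] base ε * (+ l) ℤ.^ r ≡ x [mod p ^ s ]
      decide (inj₁ (r , e)) = Sign.+ , r , mod-trans (mod-reflexive (ℤₚ.*-identityˡ _)) e
      decide (inj₂ (r , e)) = Sign.- , r , e

    abstract
      euler : ∀ x → ¬ (+ p ℤ∣.∣ x) → ∃[ ε ] x ℤ.^ d ≡ σ ε [mod p ]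
      euler x p∤x =
        let ε , r , e = orbit x p∤x
        in ε , mod-weaken p∣p^s (mod-trans (mod-sym (mod-^ d e)) (base⟨l⟩^d ε r))

    open CyclotomicNumbers p d k pr p≡4k+3 1≤d -1^d≡-1 euler public

    -- `x` lies in one of the two ⟨l⟩-cosets modulo pˢ, and its d-th power read modulo `p` tells
    -- which. So a condition modulo `p` alone decides membership modulo pˢ.
    orbit-of : ∀ ε x → x ℤ.^ d ≡ σ ε [mod p ] → ∃[ r ] base ε * (+ l) ℤ.^ r ≡ x [mod p ^ s ]
    orbit-of ε x x^d≡ε =
      let ε′ , r , e = orbit x (^d⇒∤ ε x^d≡ε)
          ε′≡ε = σ-injective ε′ ε (mod-trans (mod-weaken p∣p^s
              (mod-trans (mod-sym (base⟨l⟩^d ε′ r)) (mod-^ d e))) x^d≡ε)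
      in r , subst (λ δ → base δ * (+ l) ℤ.^ r ≡ x [mod p ^ s ]) ε′≡ε e

    orbit-q : ∀ ε x → ¬ (+ q ℤ∣.∣ x) → ∃[ r ] base ε * (+ l) ℤ.^ r ≡ x [mod q ^ t ]
    orbit-q ε x q∤x = primitive-orbit l-order-q (base ε) (base-unit-q ε) x (comaximal-pow t (∤⇒comaximal qr q∤x))

    n : ℕ
    n = p ^ s ℕ.* q ^ t

    instance
      n≢0 : NonZero n
      n≢0 = ℕₚ.m*n≢0 (p ^ s) (q ^ t)

    open Cyclotomic l n using (_∈C_; _∈C?_)

    -- Indicator function of q-adic valuation exactly `j` when `j < t`; for `j = t` it becomes the
    -- indicator of all multiples of qᵗ, since `U q 0` is constant.
    Q : ℕ → ℤ → ℤ
    Q j = lift (q ^ j) (U q (t ∸ j))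

    product : ℕ → ℕ → (ℤ → ℤ) → ℤ → ℤ
    product i j W z = lift (p ^ i) W z * Q j z

    module Membership (i j : ℕ) (i≤s : i ≤ s) (j≤t : j ≤ t) (ε : Sign)
      (γ : ℤ) (γ≡ : γ ≡ + (p ^ i ℕ.* q ^ j) * base ε) where

      N : ℕ
      N = p ^ i ℕ.* q ^ j

      instance
        p^i≢0 : NonZero (p ^ i)
        p^i≢0 = ℕₚ.m^n≢0 p i
        q^j≢0 : NonZero (q ^ j)
        q^j≢0 = ℕₚ.m^n≢0 q j
        N≢0 : NonZero N
        N≢0 = ℕₚ.m*n≢0 (p ^ i) (q ^ j)

      -- For i = s or j = t the cofactor is unconstrained at the corresponding prime.
      Condition : ℤ → Set
      Condition x = (1 ≤ s ∸ i → x ℤ.^ d ≡ σ ε [mod p ]) × (1 ≤ t ∸ j → ¬ (+ q ℤ∣.∣ x))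

      condition? : ∀ x → Dec (Condition x)
      condition? x = ((1 ℕₚ.≤? (s ∸ i)) →-dec mod? p (x ℤ.^ d) (σ ε)) ×-dec ((1 ℕₚ.≤? (t ∸ j)) →-dec ¬? (+ q ℤ∣.∣? x))

      n-split : n ≡ (p ^ (s ∸ i) ℕ.* q ^ (t ∸ j)) ℕ.* N
      n-split = trans (cong₂ ℕ._*_ (sym (^-split p i≤s)) (sym (^-split q j≤t)))
        (ℕ*.interchange (p ^ (s ∸ i)) (p ^ i) (q ^ (t ∸ j)) (q ^ j))

      ∈C⇒multiple : ∀ {α} → α ∈C γ → ∃[ x ] + toℕ α ≡ x * + N × Condition x
      ∈C⇒multiple {α} (r , Quotient.mk≈ₘ h e) = x , α≡x*N , in-p , in-q
        where
        y : ℤ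
        y = base ε * (+ l) ℤ.^ r
        cofactor : ℕ
        cofactor = p ^ (s ∸ i) ℕ.* q ^ (t ∸ j)
        -- This is γ lʳ + h n divided by `N`. It agrees with `y` modulo n / N, which is divisible by
        -- `p` if `i < s` and by `q` if `j < t`.
        x : ℤ
        x = y + h * + cofactor
        lemma : ∀ N b L h c → N * b * L + h * (c * N) ≡ (b * L + h * c) * N
        lemma = solve-∀
        α≡x*N : + toℕ α ≡ x * + N
        α≡x*N = trans e (trans (cong₂ (λ c z → c * (+ l) ℤ.^ r + h * z) γ≡
            (trans (cong +_ n-split) (ℤₚ.pos-* cofactor N)))
          (lemma (+ N) (base ε) ((+ l) ℤ.^ r) h (+ cofactor)))
        x≡y : x ≡ y [mod cofactor ]
        x≡y = Quotient.mk≈ₘ h refl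
        in-p : 1 ≤ s ∸ i → x ℤ.^ d ≡ σ ε [mod p ]
        in-p 1≤s∸i = mod-trans (mod-^ d (mod-weaken (ℕ∣.∣-trans (∣^ 1≤s∸i) (ℕ∣.m∣m*n (q ^ (t ∸ j)))) x≡y))
          (mod-weaken p∣p^s (base⟨l⟩^d ε r))
        in-q : 1 ≤ t ∸ j → ¬ (+ q ℤ∣.∣ x)
        in-q 1≤t∸j q∣x = comaximal⇒∤ qr (comaximal-∣ q∣q^t (comaximal-* (base-unit-q ε) (l-unit-q r)))
          (∣-mod (mod-sym (mod-weaken (ℕ∣.∣-trans (∣^ 1≤t∸j) (ℕ∣.n∣m*n (p ^ (s ∸ i)))) x≡y)) q∣x)

      multiple⇒∈C : ∀ {α} x → + toℕ α ≡ x * + N → Condition x → α ∈C γ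
      multiple⇒∈C {α} x α≡x*N (in-p , in-q) =
        let u , u-orbit = exponent-p (1 ℕₚ.≤? (s ∸ i))
            v , v-orbit = exponent-q (1 ℕₚ.≤? (t ∸ j))
            r , r≡u , r≡v = exponent-crt {k = + l} (coprime⇒comaximal d⊥φ) (IsOrder.k^d≡1 l-order-p)
                (IsOrder.k^d≡1 l-order-q) u v
        in r , mod-trans (mod-reflexive α≡x*N) (mod-trans
             (mod-combine (comaximal-powers p⊥q s t)
               (mod-trans u-orbit (mod-* (mod-* (mod-refl {x = base ε}) (mod-sym r≡u)) (mod-refl {x = + N})))
               (mod-trans v-orbit (mod-* (mod-* (mod-refl {x = base ε}) (mod-sym r≡v)) (mod-refl {x = + N}))))
             (mod-reflexive (trans (lemma (base ε) ((+ l) ℤ.^ r) (+ N)) (cong (_* (+ l) ℤ.^ r) (sym γ≡)))))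
        where
        instance
          _ : NonZero d
          _ = ℕ.>-nonZero 1≤d
          _ : NonZero (φ (q ^ t))
          _ = ℕ.>-nonZero (IsOrder.positive l-order-q)
        lemma : ∀ b L N → b * L * N ≡ N * b * L
        lemma = solve-∀
        top : ∀ {m M} y z → m ∣ M → y * + M ≡ z * + M [mod m ]
        top y z m∣M = mod-trans (∣⇒mod0 (ℤ∣.∣n⇒∣m*n y (ℤ∣.∣ᵤ⇒∣ m∣M))) (mod-sym (∣⇒mod0 (ℤ∣.∣n⇒∣m*n z (ℤ∣.∣ᵤ⇒∣ m∣M))))
        exponent-p : Dec (1 ≤ s ∸ i) → ∃[ u ] x * + N ≡ base ε * (+ l) ℤ.^ u * + N [mod p ^ s ]
        exponent-p (yes 1≤s∸i) =
          let u , e = orbit-of ε x (in-p 1≤s∸i) in u , mod-* (mod-sym e) (mod-refl {x = + N})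
        -- For `i = s` both sides are 0 modulo pˢ, so any exponent serves.
        exponent-p (no 1≰s∸i) = 0 , top x (base ε * (+ l) ℤ.^ 0)
            (ℕ∣.∣-trans (ℕ∣.∣-reflexive (cong (p ^_) s≡i)) (ℕ∣.m∣m*n (q ^ j)))
          where
          s≡i : s ≡ i
          s≡i = ℕₚ.≤-antisym (ℕₚ.m∸n≡0⇒m≤n (ℕₚ.n<1⇒n≡0 (ℕₚ.≰⇒> 1≰s∸i))) i≤s
        exponent-q : Dec (1 ≤ t ∸ j) → ∃[ v ] x * + N ≡ base ε * (+ l) ℤ.^ v * + N [mod q ^ t ]
        exponent-q (yes 1≤t∸j) =
          let v , e = orbit-q ε x (in-q 1≤t∸j) in v , mod-* (mod-sym e) (mod-refl {x = + N})
        exponent-q (no 1≰t∸j) = 0 , top x (base ε * (+ l) ℤ.^ 0)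
            (ℕ∣.∣-trans (ℕ∣.∣-reflexive (cong (q ^_) t≡j)) (ℕ∣.n∣m*n (p ^ i)))
          where
          t≡j : t ≡ j
          t≡j = ℕₚ.≤-antisym (ℕₚ.m∸n≡0⇒m≤n (ℕₚ.n<1⇒n≡0 (ℕₚ.≰⇒> 1≰t∸j))) j≤t

      -- The weight is tested at x qʲ because removing pⁱ from x pⁱ qʲ leaves the power of `q` in
      -- place. It stays general to cover both `i < s`, with a quadratic class, and `i = s`, with
      -- the constant 1.
      module Indicator (W : ℤ → ℤ)
        (W-true : ∀ x → (1 ≤ s ∸ i → x ℤ.^ d ≡ σ ε [mod p ]) → W (x * + (q ^ j)) ≡ + 1)
        (W-false : ∀ x → ¬ (1 ≤ s ∸ i → x ℤ.^ d ≡ σ ε [mod p ]) → W (x * + (q ^ j)) ≡ + 0) where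

        product-at : ∀ x → product i j W (x * + N) ≡ W (x * + (q ^ j)) * U q (t ∸ j) (x * + (p ^ i))
        product-at x = cong₂ _*_
          (trans (cong (lift (p ^ i) W) (trans (cong (x *_) (ℤₚ.pos-* (p ^ i) (q ^ j)))
              (lemma₁ x (+ (p ^ i)) (+ (q ^ j))))) (lift-multiple (p ^ i) W _))
          (trans (cong (Q j) (trans (cong (x *_) (ℤₚ.pos-* (p ^ i) (q ^ j)))
              (lemma₂ x (+ (p ^ i)) (+ (q ^ j))))) (lift-multiple (q ^ j) (U q (t ∸ j)) _))
          where
          lemma₁ : ∀ x a b → x * (a * b) ≡ x * b * a
          lemma₁ = solve-∀
          lemma₂ : ∀ x a b → x * (a * b) ≡ x * a * b
          lemma₂ = solve-∀

        p^i⊥q : Comaximal (+ (p ^ i)) (+ q)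
        p^i⊥q = comaximal-sym (comaximal-pow i (comaximal-sym p⊥q))

        product-true : ∀ x → Condition x → product i j W (x * + N) ≡ + 1
        product-true x (in-p , in-q) = trans (product-at x) (cong₂ _*_ (W-true x in-p)
          (U-unit q (t ∸ j) (x * + (p ^ i)) (λ 1≤t∸j q∣ → in-q 1≤t∸j (comaximal-∣* {x = x} p^i⊥q q∣))))

        product-false : ∀ x → ¬ Condition x → product i j W (x * + N) ≡ + 0
        product-false x ¬c = trans (product-at x) (decide ((1 ℕₚ.≤? (s ∸ i)) →-dec mod? p (x ℤ.^ d) (σ ε)))
          where
          V : ℤ
          V = U q (t ∸ j) (x * + (p ^ i))
          vanish : (1 ≤ s ∸ i → x ℤ.^ d ≡ σ ε [mod p ]) → Dec (1 ≤ t ∸ j) → Dec (+ q ℤ∣.∣ x) → V ≡ + 0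
          vanish in-p (yes 1≤t∸j) (yes q∣x) = U-nonunit q (t ∸ j) _ 1≤t∸j (ℤ∣.∣m⇒∣m*n (+ (p ^ i)) q∣x)
          vanish in-p (yes 1≤t∸j) (no q∤x) = contradiction (in-p , λ _ → q∤x) ¬c
          vanish in-p (no 1≰t∸j) _ = contradiction (in-p , λ 1≤t∸j → contradiction 1≤t∸j 1≰t∸j) ¬c
          decide : Dec (1 ≤ s ∸ i → x ℤ.^ d ≡ σ ε [mod p ]) → W (x * + (q ^ j)) * V ≡ + 0
          decide (no ¬in-p) = cong (_* V) (W-false x ¬in-p)
          decide (yes in-p) = trans (cong (W (x * + (q ^ j)) *_) (vanish in-p (1 ℕₚ.≤? (t ∸ j)) (+ q ℤ∣.∣? x)))
                                    (ℤₚ.*-zeroʳ (W (x * + (q ^ j))))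

        indicator : ∀ α → ⟦ α ∈C? γ ⟧ ≡ product i j W (+ toℕ α)
        indicator α = decide (+ (p ^ i) ℤ∣.∣? + toℕ α) (+ (q ^ j) ℤ∣.∣? + toℕ α)
          where
          outside : ¬ (+ N ℤ∣.∣ + toℕ α) → ⟦ α ∈C? γ ⟧ ≡ + 0
          outside N∤α = ⟦⟧-false (α ∈C? γ) λ α∈C →
            let x , e , _ = ∈C⇒multiple α∈C in N∤α (ℤ∣.divides x e)
          inside : ∀ x → + toℕ α ≡ x * + N → Dec (Condition x) → ⟦ α ∈C? γ ⟧ ≡ product i j W (+ toℕ α)
          inside x e (yes c) = trans (⟦⟧-true (α ∈C? γ) (multiple⇒∈C x e c))
              (sym (trans (cong (product i j W) e) (product-true x c)))
          inside x e (no ¬c) = trans (⟦⟧-false (α ∈C? γ) λ α∈C →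
              let y , e′ , c = ∈C⇒multiple α∈C
              in ¬c (subst Condition (ℤₚ.*-cancelʳ-≡ y x (+ N) {{ℕ.≢-nonZero (ℕ.≢-nonZero⁻¹ N)}}
                  (trans (sym e′) e)) c))
            (sym (trans (cong (product i j W) e) (product-false x ¬c)))
          decide : Dec (+ (p ^ i) ℤ∣.∣ + toℕ α) → Dec (+ (q ^ j) ℤ∣.∣ + toℕ α) → ⟦ α ∈C? γ ⟧ ≡ product i j W (+ toℕ α)
          decide (no p^i∤α) _ = trans (outside (λ N∣α → p^i∤α (ℤ∣.∣-trans (ℤ∣.∣ᵤ⇒∣ (ℕ∣.m∣m*n (q ^ j))) N∣α)))
            (sym (cong (_* Q j (+ toℕ α)) (lift-nonmultiple (p ^ i) W p^i∤α)))
          decide (yes _) (no q^j∤α) = trans (outside (λ N∣α → q^j∤α (ℤ∣.∣-trans (ℤ∣.∣ᵤ⇒∣ (ℕ∣.n∣m*n (p ^ i))) N∣α)))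
            (sym (trans (cong (lift (p ^ i) W (+ toℕ α) *_) (lift-nonmultiple (q ^ j) (U q (t ∸ j)) q^j∤α))
                (ℤₚ.*-zeroʳ (lift (p ^ i) W (+ toℕ α)))))
          decide (yes p^i∣α) (yes q^j∣α) = both (comaximal-∣∣⇒*∣ (comaximal-powers p⊥q i j) p^i∣α q^j∣α)
            where
            both : + N ℤ∣.∣ + toℕ α → ⟦ α ∈C? γ ⟧ ≡ product i j W (+ toℕ α)
            both (ℤ∣.divides x e) = inside x e (condition? x)

    -- The Legendre symbol of q and the factored indicator functions.

    q-not-multiple : ¬ (+ p ℤ∣.∣ + q)
    q-not-multiple = comaximal⇒∤ pr (comaximal-sym p⊥q)

    κ : Sign
    κ = proj₁ (euler (+ q) q-not-multiple)

    q^d≡κ : (+ q) ℤ.^ d ≡ σ κ [mod p ]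
    q^d≡κ = proj₂ (euler (+ q) q-not-multiple)

    -- The class of qʲ x when x has class ε.
    twist : ℕ → Sign → Sign
    twist zero    ε = ε
    twist (suc j) ε = κ Sign.* twist j ε

    H-twist : ∀ j ε x → H (twist j ε) (x * + (q ^ j)) ≡ H ε x
    H-twist zero    ε x = cong (H ε) (ℤₚ.*-identityʳ x)
    H-twist (suc j) ε x = begin
      H (κ Sign.* twist j ε) (x * + (q ℕ.* q ^ j))
        ≡⟨ cong (H (κ Sign.* twist j ε)) (trans (cong (x *_) (ℤₚ.pos-* q (q ^ j))) (lemma x (+ q) (+ (q ^ j)))) ⟩
      H (κ Sign.* twist j ε) (+ q * (x * + (q ^ j)))
        ≡⟨ H-multiplicative (κ Sign.* twist j ε) κ q^d≡κ (x * + (q ^ j)) ⟩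
      H (κ Sign.* (κ Sign.* twist j ε)) (x * + (q ^ j))
        ≡⟨ cong (λ δ → H δ (x * + (q ^ j))) (*-involutive κ (twist j ε)) ⟩
      H (twist j ε) (x * + (q ^ j))
        ≡⟨ H-twist j ε x ⟩
      H ε x ∎
      where
      open ≡.≡-Reasoning
      lemma : ∀ x a b → x * (a * b) ≡ a * (x * b)
      lemma = solve-∀

    -- Indicator function of the coset of pⁱ qʲ (for +) or of pⁱ qʲ g (for -).
    A : ℕ → ℕ → Sign → ℤ → ℤ
    A i j ε = product i j (H (twist j ε))

    open Setup p q l s t g using (R; χ[_]; χ; χ*; _≈_; _·_; ∑-between; ∑) renaming (_+_ to _+ᴿ_; _*_ to _*ᴿ_)
    open GeneratingFunction l n using (gen; gen-cong; gen-+; gen-*; gen-linear; ·-congʳ; χ-gen)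

    χ-A : ∀ {i j} → i < s → j ≤ t → ∀ ε γ → γ ≡ + (p ^ i ℕ.* q ^ j) * base ε → χ[ γ ] ≈ gen (A i j ε)
    χ-A {i} {j} i<s j≤t ε γ γ≡ = χ-gen γ (A i j ε) indicator
      where
      open Membership i j (ℕₚ.<⇒≤ i<s) j≤t ε γ γ≡
      open Indicator (H (twist j ε))
        (λ x c → trans (H-twist j ε x) (⟦⟧-true (mod? p (x ℤ.^ d) (σ ε)) (c (ℕₚ.m<n⇒0<n∸m i<s))))
        (λ x ¬c → trans (H-twist j ε x) (⟦⟧-false (mod? p (x ℤ.^ d) (σ ε)) (λ e → ¬c (λ _ → e))))

    χ*-gen : ∀ {i j} → i < s → j ≤ t → χ* i j ≈ gen (A i j Sign.-)
    χ*-gen {i} {j} i<s j≤t = χ-A i<s j≤t Sign.- (+ (p ^ i ℕ.* q ^ j) * g) refl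

    χ-gen-A : ∀ {i j} → i < s → j ≤ t → χ i j ≈ gen (A i j Sign.+)
    χ-gen-A {i} {j} i<s j≤t = χ-A i<s j≤t Sign.+ (+ (p ^ i ℕ.* q ^ j)) (sym (ℤₚ.*-identityʳ _))

    -- Indicator function of the multiples of pⁱ with the same q-part as qʲ.
    D : ℕ → ℕ → ℤ → ℤ
    D i j = product i j (λ _ → + 1)

    χ-D : ∀ {j} → j ≤ t → χ s j ≈ gen (D s j)
    χ-D {j} j≤t = χ-gen (+ (p ^ s ℕ.* q ^ j)) (D s j) indicator
      where
      open Membership s j ℕₚ.≤-refl j≤t Sign.+ (+ (p ^ s ℕ.* q ^ j)) (sym (ℤₚ.*-identityʳ _))
      open Indicator (λ _ → + 1) (λ _ _ → refl)
        -- For `i = s` the condition at `p` has the false premise `1 ≤ s ∸ s`, so it always holds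
        -- and this case cannot occur.
        (λ x ¬c → contradiction (λ 1≤0 → contradiction (subst (1 ≤_) (ℕₚ.n∸n≡0 s) 1≤0) (λ ())) ¬c)

    -- Convolution of the coset indicators.

    U-periodic-power : ∀ e → Periodic (q ^ e) (U q e)
    U-periodic-power zero    _   = refl
    U-periodic-power (suc e) x≡y = U-periodic q (suc e) (mod-weaken (ℕ∣.m∣m*n (q ^ e)) x≡y)

    Q-periodic : ∀ {j} → j ≤ t → Periodic (q ^ t) (Q j)
    Q-periodic {j} j≤t = subst (λ m → Periodic m (Q j)) (^-split q j≤t)
      (lift-periodic (q ^ (t ∸ j)) (q ^ j) {{ℕₚ.m^n≢0 q j}} (U-periodic-power (t ∸ j)))

    P-periodic : ∀ {i} → i < s → ∀ δ → Periodic (p ^ s) (lift (p ^ i) (H δ))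
    P-periodic {i} i<s δ = subst (λ m → Periodic m (lift (p ^ i) (H δ))) (^-split p (ℕₚ.<⇒≤ i<s))
      (lift-periodic (p ^ (s ∸ i)) (p ^ i) {{ℕₚ.m^n≢0 p i}}
        (λ e → H-periodic δ (mod-weaken (∣^ (ℕₚ.m<n⇒0<n∸m i<s)) e)))

    A-periodic : ∀ {i j} → i < s → j ≤ t → ∀ ε → Periodic n (A i j ε)
    A-periodic {i} {j} i<s j≤t ε e = cong₂ _*_
      (P-periodic i<s (twist j ε) (mod-weaken (ℕ∣.m∣m*n (q ^ t)) e))
      (Q-periodic j≤t (mod-weaken (ℕ∣.n∣m*n (p ^ s)) e))

    -- `Q j` depends only on the residue modulo qʲ⁺¹. If `Q j′ b` is nonzero, then `b` is divisible
    -- by that power, as `j < j′`, and subtracting it changes nothing.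
    Q-absorb : ∀ {j j′} → j < j′ → ∀ c b → Q j (c - b) * Q j′ b ≡ Q j c * Q j′ b
    Q-absorb {j} {j′} j<j′ c b = decide (+ (q ^ j′) ℤ∣.∣? b)
      where
      Q-periodic-next : Periodic (q ^ suc j) (Q j)
      Q-periodic-next = lift-periodic q (q ^ j) {{ℕₚ.m^n≢0 q j}} (U-periodic q (t ∸ j))
      decide : Dec (+ (q ^ j′) ℤ∣.∣ b) → Q j (c - b) * Q j′ b ≡ Q j c * Q j′ b
      decide (no q^j′∤b) = trans (trans (cong (Q j (c - b) *_) Q≡0) (ℤₚ.*-zeroʳ (Q j (c - b))))
                                 (sym (trans (cong (Q j c *_) Q≡0) (ℤₚ.*-zeroʳ (Q j c))))
        where
        Q≡0 : Q j′ b ≡ + 0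
        Q≡0 = lift-nonmultiple (q ^ j′) (U q (t ∸ j′)) q^j′∤b
      decide (yes q^j′∣b) = cong (_* Q j′ b) (Q-periodic-next (mod-trans
        (mod-- (mod-refl {x = c}) (∣⇒mod0 (ℤ∣.∣-trans (ℤ∣.∣ᵤ⇒∣ (^-monoʳ-∣ j<j′)) q^j′∣b)))
        (mod-reflexive (ℤₚ.+-identityʳ c))))
        where
        ^-monoʳ-∣ : ∀ {a b} → a ≤ b → q ^ a ∣ q ^ b
        ^-monoʳ-∣ {a} {b} a≤b = subst (q ^ a ∣_) (^-split q a≤b) (ℕ∣.n∣m*n (q ^ (b ∸ a)))

    Q-range : ∀ {j} → j ≤ t → range (q ^ t) (Q j) ≡ + φ (q ^ (t ∸ j))
    Q-range {j} j≤t = begin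
      range (q ^ t) (Q j)                    ≡⟨ cong (λ m → range m (Q j)) (^-split q j≤t) ⟨
      range (q ^ (t ∸ j) ℕ.* q ^ j) (Q j)    ≡⟨ range-lift (q ^ (t ∸ j)) (q ^ j) {{ℕₚ.m^n≢0 q j}} (U q (t ∸ j)) ⟩
      range (q ^ (t ∸ j)) (U q (t ∸ j))      ≡⟨ φ-prime-power qr (t ∸ j) ⟨
      + φ (q ^ (t ∸ j))                      ∎
      where open ≡.≡-Reasoning

    -- The cofactors of pⁱ run modulo pˢ⁻ⁱ, but `H` has period `p`: the convolution modulo `p` is
    -- repeated pˢ⁻ⁱ⁻¹ times.
    P-convolve : ∀ {i} → i < s → ∀ δ δ′ c → convolve (p ^ s) (lift (p ^ i) (H δ)) (lift (p ^ i) (H δ′)) c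
                 ≡ + (p ^ (s ∸ i ∸ 1)) * lift (p ^ i) (convolve p (H δ) (H δ′)) c
    P-convolve {i} i<s δ δ′ c = begin
      convolve (p ^ s) (lift (p ^ i) (H δ)) (lift (p ^ i) (H δ′)) c
        ≡⟨ cong (λ m → convolve m (lift (p ^ i) (H δ)) (lift (p ^ i) (H δ′)) c) (^-split p (ℕₚ.<⇒≤ i<s)) ⟨
      convolve (p ^ (s ∸ i) ℕ.* p ^ i) (lift (p ^ i) (H δ)) (lift (p ^ i) (H δ′)) c
        ≡⟨ convolve-lift (p ^ (s ∸ i)) (p ^ i) {{ℕₚ.m^n≢0 p i}} (H δ) (H δ′) c ⟩
      lift (p ^ i) (convolve (p ^ (s ∸ i)) (H δ) (H δ′)) c
        ≡⟨ lift-cong (p ^ i) (λ u → trans (cong (λ m → convolve m (H δ) (H δ′) u) p^[s∸i])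
             (range-periodic (p ^ e) p (convolve-periodic δ δ′ u))) c ⟩
      lift (p ^ i) (λ u → + (p ^ e) * convolve p (H δ) (H δ′) u) c
        ≡⟨ lift-* (p ^ i) (+ (p ^ e)) (convolve p (H δ) (H δ′)) c ⟩
      + (p ^ e) * lift (p ^ i) (convolve p (H δ) (H δ′)) c ∎
      where
      open ≡.≡-Reasoning
      e : ℕ
      e = s ∸ i ∸ 1
      p^[s∸i] : p ^ (s ∸ i) ≡ p ^ e ℕ.* p
      p^[s∸i] = trans (cong (p ^_) (sym (ℕₚ.m+[n∸m]≡n (ℕₚ.m<n⇒0<n∸m i<s)))) (ℕₚ.*-comm p (p ^ e))

    A-convolve : ∀ {i j j′} → i < s → j < j′ → j′ ≤ t → ∀ ε ε′ c → convolve n (A i j ε) (A i j′ ε′) c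
      ≡ (+ (p ^ (s ∸ i ∸ 1)) * lift (p ^ i) (convolve p (H (twist j ε)) (H (twist j′ ε′))) c) *
          (Q j c * + φ (q ^ (t ∸ j′)))
    A-convolve {i} {j} {j′} i<s j<j′ j′≤t ε ε′ c = begin
      range n (λ b → (P (c - b) * Q j (c - b)) * (P′ b * Q j′ b))
        ≡⟨ range-cong n (λ b → ℤ*.interchange (P (c - b)) (Q j (c - b)) (P′ b) (Q j′ b)) ⟩
      range n (λ b → (P (c - b) * P′ b) * (Q j (c - b) * Q j′ b))
        ≡⟨ range-crt (p ^ s) (q ^ t) {λ b → P (c - b) * P′ b} {λ b → Q j (c - b) * Q j′ b}
             (comaximal-sym (comaximal-powers p⊥q s t))
             (λ x≡y → cong₂ _*_ (P-periodic i<s (twist j ε) (mod-- (mod-refl {x = c}) x≡y))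
                 (P-periodic i<s (twist j′ ε′) x≡y))
             (λ x≡y → cong₂ _*_ (Q-periodic (ℕₚ.≤-trans (ℕₚ.<⇒≤ j<j′) j′≤t) (mod-- (mod-refl {x = c}) x≡y))
                 (Q-periodic j′≤t x≡y)) ⟩
      convolve (p ^ s) P P′ c * range (q ^ t) (λ b → Q j (c - b) * Q j′ b)
        ≡⟨ cong₂ _*_ (P-convolve i<s (twist j ε) (twist j′ ε′) c)
             (trans (range-cong (q ^ t) (Q-absorb j<j′ c))
                 (trans (range-*ˡ (q ^ t) (Q j c) (Q j′)) (cong (Q j c *_) (Q-range j′≤t)))) ⟩
      _ ∎
      where
      open ≡.≡-Reasoning
      P P′ : ℤ → ℤ
      P = lift (p ^ i) (H (twist j ε))
      P′ = lift (p ^ i) (H (twist j′ ε′))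

    twist-opposite : ∀ j ε → twist j (opposite ε) ≡ opposite (twist j ε)
    twist-opposite zero    ε = refl
    twist-opposite (suc j) ε = trans (cong (κ Sign.*_) (twist-opposite j ε)) (*-opposite κ (twist j ε))

    lift-H-opposite : ∀ i j c → lift (p ^ i) (H (opposite (twist j Sign.-))) c ≡ lift (p ^ i) (H (twist j Sign.+)) c
    lift-H-opposite i j c = cong (λ δ → lift (p ^ i) (H δ) c) (sym (twist-opposite j Sign.-))

    A-convolve-same : ∀ {i j j′} → i < s → j < j′ → j′ ≤ t → twist j′ Sign.- ≡ twist j Sign.- → ∀ {a b} →
      a ≡ + k * + (p ^ (s ∸ i ∸ 1)) * + φ (q ^ (t ∸ j′)) → b ≡ + (k ℕ.+ 1) * + (p ^ (s ∸ i ∸ 1)) * + φ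
          (q ^ (t ∸ j′)) →
      ∀ c → convolve n (A i j Sign.-) (A i j′ Sign.-) c ≡ a * A i j Sign.- c + b * A i j Sign.+ c
    A-convolve-same {i} {j} {j′} i<s j<j′ j′≤t tw {a} {b} a≡ b≡ c = begin
      convolve n (A i j Sign.-) (A i j′ Sign.-) c
        ≡⟨ A-convolve i<s j<j′ j′≤t Sign.- Sign.- c ⟩
      (π * lift (p ^ i) (convolve p (H δ) (H (twist j′ Sign.-))) c) * (Q j c * f)
        ≡⟨ cong (λ δ′ → (π * lift (p ^ i) (convolve p (H δ) (H δ′)) c) * (Q j c * f)) tw ⟩
      (π * lift (p ^ i) (convolve p (H δ) (H δ)) c) * (Q j c * f)
        ≡⟨ cong (λ x → (π * x) * (Q j c * f)) expand ⟩
      (π * (+ k * X + + (k ℕ.+ 1) * Y)) * (Q j c * f)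
        ≡⟨ lemma π (+ k) (+ (k ℕ.+ 1)) X Y (Q j c) f ⟩
      (+ k * π * f) * (X * Q j c) + (+ (k ℕ.+ 1) * π * f) * (Y * Q j c)
        ≡⟨ cong₂ (λ x y → x * (X * Q j c) + y * (Y * Q j c)) a≡ b≡ ⟨
      a * A i j Sign.- c + b * A i j Sign.+ c ∎
      where
      open ≡.≡-Reasoning
      δ : Sign
      δ = twist j Sign.-
      π f X Y : ℤ
      π = + (p ^ (s ∸ i ∸ 1))
      f = + φ (q ^ (t ∸ j′))
      X = lift (p ^ i) (H δ) c
      Y = lift (p ^ i) (H (twist j Sign.+)) c
      lemma : ∀ π k k′ X Y Q f → (π * (k * X + k′ * Y)) * (Q * f) ≡ (k * π * f) * (X * Q) + (k′ * π * f) * (Y * Q)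
      lemma = solve-∀
      expand : lift (p ^ i) (convolve p (H δ) (H δ)) c ≡ + k * X + + (k ℕ.+ 1) * Y
      expand = trans (lift-cong (p ^ i) (convolve-same δ) c)
        (trans (lift-+ (p ^ i) (λ x → + k * H δ x) (λ x → + (k ℕ.+ 1) * H (opposite δ) x) c)
          (cong₂ _+_ (lift-* (p ^ i) (+ k) (H δ) c)
            (trans (lift-* (p ^ i) (+ (k ℕ.+ 1)) (H (opposite δ)) c)
                (cong (+ (k ℕ.+ 1) *_) (lift-H-opposite i j c)))))

    H-pair : ∀ ε c → H Sign.+ c + H Sign.- c ≡ H ε c + H (opposite ε) c
    H-pair Sign.+ c = refl
    H-pair Sign.- c = ℤₚ.+-comm (H Sign.+ c) (H Sign.- c)

    lift-Z : ∀ i c → lift (p ^ i) Z c ≡ lift (p ^ suc i) (λ _ → + 1) c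
    lift-Z i c = lift-lift p (p ^ i) {{p≢0}} {{ℕₚ.m^n≢0 p i}} (λ _ → + 1) c

    -- The term of `convolve-opposite` at multiples of `p` concerns cofactors of pⁱ; by `lift-Z` it
    -- becomes the function `D (suc i) j` on the multiples of pⁱ⁺¹.
    A-convolve-opposite : ∀ {i j j′} → i < s → j < j′ → j′ ≤ t → twist j′ Sign.- ≡ opposite
        (twist j Sign.-) → ∀ {a b} →
      a ≡ + k * + (p ^ (s ∸ i ∸ 1)) * + φ (q ^ (t ∸ j′)) → b ≡ h * + (p ^ (s ∸ i ∸ 1)) * + φ (q ^ (t ∸ j′)) →
      ∀ c → convolve n (A i j Sign.-) (A i j′ Sign.-) c ≡ a * (A i j Sign.+ c + A i j Sign.- c) + b * D (suc i) j c
    A-convolve-opposite {i} {j} {j′} i<s j<j′ j′≤t tw {a} {b} a≡ b≡ c = begin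
      convolve n (A i j Sign.-) (A i j′ Sign.-) c
        ≡⟨ A-convolve i<s j<j′ j′≤t Sign.- Sign.- c ⟩
      (π * lift (p ^ i) (convolve p (H δ) (H (twist j′ Sign.-))) c) * (Q j c * f)
        ≡⟨ cong (λ δ′ → (π * lift (p ^ i) (convolve p (H δ) (H δ′)) c) * (Q j c * f)) tw ⟩
      (π * lift (p ^ i) (convolve p (H δ) (H (opposite δ))) c) * (Q j c * f)
        ≡⟨ cong (λ x → (π * x) * (Q j c * f)) expand ⟩
      (π * (+ k * (X + Y) + h * W)) * (Q j c * f)
        ≡⟨ lemma π (+ k) h X Y W (Q j c) f ⟩
      (+ k * π * f) * (Y * Q j c + X * Q j c) + (h * π * f) * (W * Q j c)
        ≡⟨ cong₂ (λ x y → x * (Y * Q j c + X * Q j c) + y * (W * Q j c)) a≡ b≡ ⟨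
      a * (A i j Sign.+ c + A i j Sign.- c) + b * D (suc i) j c ∎
      where
      open ≡.≡-Reasoning
      δ : Sign
      δ = twist j Sign.-
      π f X Y W : ℤ
      π = + (p ^ (s ∸ i ∸ 1))
      f = + φ (q ^ (t ∸ j′))
      X = lift (p ^ i) (H δ) c
      Y = lift (p ^ i) (H (twist j Sign.+)) c
      W = lift (p ^ suc i) (λ _ → + 1) c
      lemma : ∀ π k h X Y W Q f → (π * (k * (X + Y) + h * W)) * (Q * f) ≡ (k * π * f) * (Y * Q + X * Q) +
          (h * π * f) * (W * Q)
      lemma = solve-∀
      expand : lift (p ^ i) (convolve p (H δ) (H (opposite δ))) c ≡ + k * (X + Y) + h * W
      expand = trans (lift-cong (p ^ i) (λ u → trans (convolve-opposite δ u)
          (cong (λ x → + k * x + h * Z u) (H-pair δ u))) c)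
        (trans (lift-+ (p ^ i) (λ x → + k * (H δ x + H (opposite δ) x)) (λ x → h * Z x) c)
          (cong₂ _+_
            (trans (lift-* (p ^ i) (+ k) (λ x → H δ x + H (opposite δ) x) c)
              (cong (+ k *_) (trans (lift-+ (p ^ i) (H δ) (H (opposite δ)) c)
                  (cong (λ y → X + y) (lift-H-opposite i j c)))))
            (trans (lift-* (p ^ i) h Z c) (cong (h *_) (lift-Z i c)))))

    -- The cofactor of pᵇ is a residue, a nonresidue or again divisible by `p`.
    D-split : ∀ b j c → D b j c ≡ (A b j Sign.+ c + A b j Sign.- c) + D (suc b) j c
    D-split b j c = trans (cong (_* Q j c) expand) (lemma X Y W (Q j c))
      where
      X Y W : ℤ
      X = lift (p ^ b) (H (twist j Sign.+)) c
      Y = lift (p ^ b) (H (twist j Sign.-)) c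
      W = lift (p ^ suc b) (λ _ → + 1) c
      lemma : ∀ X Y W Q → (X + Y + W) * Q ≡ (X * Q + Y * Q) + W * Q
      lemma = solve-∀
      total : ∀ u → + 1 ≡ H (twist j Sign.+) u + H (twist j Sign.-) u + Z u
      total u = trans (sym (H-total u)) (cong (_+ Z u)
        (trans (H-pair (twist j Sign.+) u) (cong (λ δ → H (twist j Sign.+) u + H δ u)
            (sym (twist-opposite j Sign.+)))))
      expand : lift (p ^ b) (λ _ → + 1) c ≡ X + Y + W
      expand = trans (lift-cong (p ^ b) total c)
        (trans (lift-+ (p ^ b) (λ u → H (twist j Sign.+) u + H (twist j Sign.-) u) Z c)
          (cong₂ _+_ (lift-+ (p ^ b) (H (twist j Sign.+)) (H (twist j Sign.-)) c) (lift-Z b c)))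

    -- Products of coset sums in the quotient ring.

    private
      module R = CommutativeRing R
    open SetoidReasoning R.setoid

    χ*χ*-gen : ∀ {i j j′} → i < s → j ≤ t → j′ ≤ t → χ* i j *ᴿ χ* i j′ ≈ gen
        (convolve n (A i j Sign.-) (A i j′ Sign.-))
    χ*χ*-gen {i} {j} {j′} i<s j≤t j′≤t = R.trans (R.*-cong (χ*-gen i<s j≤t) (χ*-gen i<s j′≤t))
      (gen-* {A i j Sign.-} (A i j′ Sign.-) (A-periodic i<s j≤t Sign.-))

    χ*χ*-same : ∀ {i j j′} → i < s → j < j′ → j′ ≤ t → twist j′ Sign.- ≡ twist j Sign.- → ∀ {a b} →
      a ≡ + k * + (p ^ (s ∸ i ∸ 1)) * + φ (q ^ (t ∸ j′)) → b ≡ + (k ℕ.+ 1) * + (p ^ (s ∸ i ∸ 1)) * + φ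
          (q ^ (t ∸ j′)) →
      χ* i j *ᴿ χ* i j′ ≈ a · χ* i j +ᴿ b · χ i j
    χ*χ*-same {i} {j} {j′} i<s j<j′ j′≤t tw {a} {b} a≡ b≡ = begin
      χ* i j *ᴿ χ* i j′                                         ≈⟨ χ*χ*-gen i<s j≤t j′≤t ⟩
      gen (convolve n (A i j Sign.-) (A i j′ Sign.-))           ≈⟨ gen-cong (A-convolve-same i<s j<j′ j′≤t tw a≡ b≡) ⟩
      gen (λ c → a * A i j Sign.- c + b * A i j Sign.+ c)       ≈⟨ gen-linear a b (A i j Sign.-) (A i j Sign.+) ⟩
      a · gen (A i j Sign.-) +ᴿ b · gen (A i j Sign.+)          ≈⟨ R.+-cong (·-congʳ a (χ*-gen i<s j≤t))
          (·-congʳ b (χ-gen-A i<s j≤t)) ⟨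
      a · χ* i j +ᴿ b · χ i j                                   ∎
      where
      j≤t : j ≤ t
      j≤t = ℕₚ.≤-trans (ℕₚ.<⇒≤ j<j′) j′≤t

    ∑-∷ʳ : ∀ {X : Set} xs y (f : X → R.Carrier) → ∑ (xs ++ y ∷ []) f ≈ ∑ xs f +ᴿ f y
    ∑-∷ʳ []       y f = R.+-comm (f y) R.0#
    ∑-∷ʳ (x ∷ xs) y f = R.trans (R.+-cong (R.refl {f x}) (∑-∷ʳ xs y f)) (R.sym (R.+-assoc (f x) (∑ xs f) (f y)))

    ∑-between-suc : ∀ {i b} → i < b → ∀ f → ∑-between i (suc b) f ≈ ∑-between i b f +ᴿ f b
    ∑-between-suc {i} {b} i<b f = begin
      ∑ (filter (i ℕₚ.<?_) (upTo (suc b))) f             ≡⟨ cong (λ ks → ∑ (filter (i ℕₚ.<?_) ks) f) (upTo-∷ʳ b) ⟨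
      ∑ (filter (i ℕₚ.<?_) (upTo b ++ b ∷ [])) f         ≡⟨ cong (λ ks → ∑ ks f)
          (filter-++ (i ℕₚ.<?_) (upTo b) (b ∷ [])) ⟩
      ∑ (filter (i ℕₚ.<?_) (upTo b) ++ filter (i ℕₚ.<?_) (b ∷ [])) f
        ≡⟨ cong (λ ks → ∑ (filter (i ℕₚ.<?_) (upTo b) ++ ks) f) (filter-accept (i ℕₚ.<?_) {b} {[]} i<b) ⟩
      ∑ (filter (i ℕₚ.<?_) (upTo b) ++ b ∷ []) f         ≈⟨ ∑-∷ʳ (filter (i ℕₚ.<?_) (upTo b)) b f ⟩
      ∑-between i b f +ᴿ f b                             ∎

    ∑-between-empty : ∀ i f → ∑-between i (suc i) f ≈ R.0#
    ∑-between-empty i f = R.reflexive (cong (λ ks → ∑ ks f) (filter-none (i ℕₚ.<?_)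
      (applyUpTo⁺₁ id (suc i) (λ k<1+i i<k → ℕₚ.<⇒≱ k<1+i i<k))))

    pair : ℕ → ℕ → R.Carrier
    pair j k = χ k j +ᴿ χ* k j

    gen-D-split : ∀ {b j} → b < s → j ≤ t → gen (D b j) ≈ pair j b +ᴿ gen (D (suc b) j)
    gen-D-split {b} {j} b<s j≤t = begin
      gen (D b j)
        ≈⟨ gen-cong (D-split b j) ⟩
      gen (λ c → (A b j Sign.+ c + A b j Sign.- c) + D (suc b) j c)
        ≈⟨ gen-+ (λ c → A b j Sign.+ c + A b j Sign.- c) (D (suc b) j) ⟩
      gen (λ c → A b j Sign.+ c + A b j Sign.- c) +ᴿ gen (D (suc b) j)
        ≈⟨ R.+-cong (R.trans (gen-+ (A b j Sign.+) (A b j Sign.-))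
            (R.sym (R.+-cong (χ-gen-A b<s j≤t) (χ*-gen b<s j≤t)))) (R.refl {gen (D (suc b) j)}) ⟩
      pair j b +ᴿ gen (D (suc b) j) ∎

    telescope-step : ∀ {i j b} → i < b → b < s → j ≤ t →
      ∑-between i (suc b) (pair j) +ᴿ gen (D (suc b) j) ≈ ∑-between i b (pair j) +ᴿ gen (D b j)
    telescope-step {i} {j} {b} i<b b<s j≤t = begin
      ∑-between i (suc b) (pair j) +ᴿ gen (D (suc b) j)
        ≈⟨ R.+-cong (∑-between-suc i<b (pair j)) (R.refl {gen (D (suc b) j)}) ⟩
      (∑-between i b (pair j) +ᴿ pair j b) +ᴿ gen (D (suc b) j)
        ≈⟨ R.+-assoc (∑-between i b (pair j)) (pair j b) (gen (D (suc b) j)) ⟩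
      ∑-between i b (pair j) +ᴿ (pair j b +ᴿ gen (D (suc b) j))
        ≈⟨ R.+-cong (R.refl {∑-between i b (pair j)}) (gen-D-split b<s j≤t) ⟨
      ∑-between i b (pair j) +ᴿ gen (D b j) ∎

    -- The left side does not depend on `b`: raising `b` by one trades `gen (D b j)` for `pair j b`
    -- and the next `D`. At `b = suc i` the sum is empty, and at `b = s` the remaining `D` is the
    -- coset of pˢ qʲ.
    telescope : ∀ {i j} → j ≤ t → ∀ m {b} → suc i ℕ.+ m ≡ b → b ≤ s →
      ∑-between i b (pair j) +ᴿ gen (D b j) ≈ gen (D (suc i) j)
    telescope {i} {j} j≤t zero {b} 1+i≡b _ = subst (λ b → ∑-between i b (pair j) +ᴿ gen (D b j) ≈ gen (D (suc i) j))
      (trans (sym (ℕₚ.+-identityʳ (suc i))) 1+i≡b)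
      (R.trans (R.+-cong (∑-between-empty i (pair j)) (R.refl {gen (D (suc i) j)}))
          (R.+-identityˡ (gen (D (suc i) j))))
    telescope {i} {j} j≤t (suc m) {suc b} eq b<s =
      R.trans (telescope-step (subst (i <_) e (s≤s (ℕₚ.m≤m+n i m))) b<s j≤t) (telescope j≤t m e (ℕₚ.<⇒≤ b<s))
      where
      e : suc i ℕ.+ m ≡ b
      e = ℕₚ.suc-injective (trans (sym (ℕₚ.+-suc (suc i) m)) eq)

    gen-D : ∀ {i j} → i < s → j ≤ t → gen (D (suc i) j) ≈ ∑-between i s (pair j) +ᴿ χ s j
    gen-D {i} {j} i<s j≤t = R.trans (R.sym (telescope j≤t (s ∸ suc i) (ℕₚ.m+[n∸m]≡n i<s) ℕₚ.≤-refl))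
      (R.+-cong (R.refl {∑-between i s (pair j)}) (R.sym (χ-D j≤t)))

    χ*χ*-opposite : ∀ {i j j′} → i < s → j < j′ → j′ ≤ t → twist j′ Sign.- ≡ opposite (twist j Sign.-) → ∀ {a b} →
      a ≡ + k * + (p ^ (s ∸ i ∸ 1)) * + φ (q ^ (t ∸ j′)) → b ≡ h * + (p ^ (s ∸ i ∸ 1)) * + φ (q ^ (t ∸ j′)) →
      χ* i j *ᴿ χ* i j′ ≈ a · (χ i j +ᴿ χ* i j) +ᴿ b · (∑-between i s (pair j) +ᴿ χ s j)
    χ*χ*-opposite {i} {j} {j′} i<s j<j′ j′≤t tw {a} {b} a≡ b≡ = begin
      χ* i j *ᴿ χ* i j′
        ≈⟨ χ*χ*-gen i<s j≤t j′≤t ⟩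
      gen (convolve n (A i j Sign.-) (A i j′ Sign.-))
        ≈⟨ gen-cong (A-convolve-opposite i<s j<j′ j′≤t tw a≡ b≡) ⟩
      gen (λ c → a * (A i j Sign.+ c + A i j Sign.- c) + b * D (suc i) j c)
        ≈⟨ gen-linear a b (λ c → A i j Sign.+ c + A i j Sign.- c) (D (suc i) j) ⟩
      a · gen (λ c → A i j Sign.+ c + A i j Sign.- c) +ᴿ b · gen (D (suc i) j)
        ≈⟨ R.+-cong (·-congʳ a (R.trans (gen-+ (A i j Sign.+) (A i j Sign.-))
            (R.sym (R.+-cong (χ-gen-A i<s j≤t) (χ*-gen i<s j≤t)))))
                    (·-congʳ b (gen-D i<s j≤t)) ⟩
      a · (χ i j +ᴿ χ* i j) +ᴿ b · (∑-between i s (pair j) +ᴿ χ s j) ∎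
      where
      j≤t : j ≤ t
      j≤t = ℕₚ.≤-trans (ℕₚ.<⇒≤ j<j′) j′≤t

    -- If q = x², then `q^d` is the square of `x^d`, which is ±1.
    residue⇒κ : QuadraticResidue p q → κ ≡ Sign.+
    residue⇒κ (_ , x , x*x≡q) =
      let δ , x^d≡δ = euler x (λ p∣x → q-not-multiple (∣-mod (mod-sym x*x≡q) (ℤ∣.∣m⇒∣m*n x p∣x)))
      in σ-injective κ Sign.+ (mod-trans (mod-sym q^d≡κ) (mod-trans (mod-sym (mod-^ d x*x≡q))
           (mod-trans (mod-reflexive (^-distribʳ-* x x d))
               (mod-trans (mod-* x^d≡δ x^d≡δ) (mod-reflexive (trans (σ-* δ δ) (square δ)))))))
      where
      square : ∀ δ → σ (δ Sign.* δ) ≡ + 1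
      square Sign.+ = refl
      square Sign.- = refl

    -- Since d is odd, q = lʳ is the square of l^(r (d + 1) / 2).
    κ⇒residue : ∀ c → d ≡ 2 ℕ.* c ℕ.+ 1 → κ ≡ Sign.+ → QuadraticResidue p q
    κ⇒residue c d≡2c+1 κ≡+ = comaximal⇒coprime (comaximal-sym p⊥q) ,
      root (orbit-of Sign.+ (+ q) (subst (λ δ → (+ q) ℤ.^ d ≡ σ δ [mod p ]) κ≡+ q^d≡κ))
      where
      root : ∃[ r ] + 1 * (+ l) ℤ.^ r ≡ + q [mod p ^ s ] → ∃[ x ] x * x ≡ + q [mod p ]
      root (r , e) = (+ l) ℤ.^ m , mod-weaken p∣p^s
          (mod-trans (mod-reflexive (trans (sym (ℤₚ.^-distribˡ-+-* (+ l) m m))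
              (trans (cong ((+ l) ℤ.^_) m+m) (ℤₚ.^-distribˡ-+-* (+ l) (d ℕ.* r) r))))
        (mod-trans (mod-* (^-multiple {k = + l} {d} (IsOrder.k^d≡1 l-order-p) r) (mod-refl {x = (+ l) ℤ.^ r})) e))
        where
        m : ℕ
        m = (c ℕ.+ 1) ℕ.* r
        m+m : m ℕ.+ m ≡ d ℕ.* r ℕ.+ r
        m+m = trans (ring c r) (cong (λ z → z ℕ.* r ℕ.+ r) (sym d≡2c+1))
          where
          ring : ∀ c r → (c ℕ.+ 1) ℕ.* r ℕ.+ (c ℕ.+ 1) ℕ.* r ≡ (2 ℕ.* c ℕ.+ 1) ℕ.* r ℕ.+ r
          ring = ℕRing.solve-∀

    twist-trivial : κ ≡ Sign.+ → ∀ j ε → twist j ε ≡ ε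
    twist-trivial κ≡+ zero    ε = refl
    twist-trivial κ≡+ (suc j) ε = trans (cong (Sign._* twist j ε) κ≡+) (twist-trivial κ≡+ j ε)

    -- Twists cancel in pairs, since κ² = 1.
    twist-even : ∀ c j ε → twist (c ℕ.* 2 ℕ.+ j) ε ≡ twist j ε
    twist-even zero    j ε = refl
    twist-even (suc c) j ε = trans (*-involutive κ (twist (c ℕ.* 2 ℕ.+ j) ε)) (twist-even c j ε)

    twist-odd : κ ≡ Sign.- → ∀ c j ε → twist (suc (c ℕ.* 2) ℕ.+ j) ε ≡ opposite (twist j ε)
    twist-odd κ≡- c j ε = trans (cong (Sign._* twist (c ℕ.* 2 ℕ.+ j) ε) κ≡-) (cong opposite (twist-even c j ε))

  -- Numerical parameters and the three cases.

  ¬2∣⇒odd : ∀ m → 2 ∤ m → ∃[ c ] m ≡ suc (c ℕ.* 2)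
  ¬2∣⇒odd m 2∤m = m / 2 , decide (m % 2) refl (m%n<n m 2)
    where
    decide : ∀ r → m % 2 ≡ r → r < 2 → m ≡ suc (m / 2 ℕ.* 2)
    decide zero          m%2≡0 _ = contradiction (ℕ∣.m%n≡0⇒n∣m m 2 m%2≡0) 2∤m
    decide (suc zero)    m%2≡1 _ = trans (m≡m%n+[m/n]*n m 2) (cong (ℕ._+ m / 2 ℕ.* 2) m%2≡1)
    decide (suc (suc r)) _ (s≤s (s≤s ()))

  [m+m]/2≡m : ∀ m → (m ℕ.+ m) / 2 ≡ m
  [m+m]/2≡m m = trans (cong (_/ 2) (lemma m)) (m*n/n≡m m 2)
    where
    lemma : ∀ m → m ℕ.+ m ≡ m ℕ.* 2
    lemma = ℕRing.solve-∀

  module Products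
    (s t p q l : ℕ) (g : ℤ) (1≤s : 1 ≤ s) (1≤t : 1 ≤ t) (pr : Prime p) (qr : Prime q) (p≢q : p ≢ q)
        (p%4≡3 : p % 4 ≡ 3)
    (l-order-p : IsOrder (p ^ s) (+ l) (φ (p ^ s) / 2)) (l-order-q : IsOrder (q ^ t) (+ l) (φ (q ^ t)))
    (gcd≡2 : gcd (φ (p ^ s)) (φ (q ^ t)) ≡ 2)
    (g-order-p : IsPrimitiveRoot (p ^ s) g) (g-order-q : IsPrimitiveRoot (q ^ t) g) where

    k : ℕ
    k = p / 4

    p≡3+k*4 : p ≡ 3 ℕ.+ k ℕ.* 4
    p≡3+k*4 = trans (m≡m%n+[m/n]*n p 4) (cong (ℕ._+ k ℕ.* 4) p%4≡3)

    p≡4k+3 : p ≡ 4 ℕ.* k ℕ.+ 3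
    p≡4k+3 = trans p≡3+k*4 (lemma k)
      where
      lemma : ∀ k → 3 ℕ.+ k ℕ.* 4 ≡ 4 ℕ.* k ℕ.+ 3
      lemma = ℕRing.solve-∀

    -- The value of φ(pᵉ)/2 for `e ≥ 1`, with (p - 1)/2 = 2k + 1; it is odd, since `p` and 2k + 1
    -- are.
    half : ℕ → ℕ
    half e = p ^ (e ∸ 1) ℕ.* (2 ℕ.* k ℕ.+ 1)

    φ≡half+half : ∀ e → 1 ≤ e → φ (p ^ e) ≡ half e ℕ.+ half e
    φ≡half+half (suc e) _ = trans (φ-formula pr e (k ℕ.* 4 ℕ.+ 2) (trans p≡3+k*4 (lemma₁ k))) (lemma₂ (p ^ e) k)
      where
      lemma₁ : ∀ k → 3 ℕ.+ k ℕ.* 4 ≡ suc (k ℕ.* 4 ℕ.+ 2)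
      lemma₁ = ℕRing.solve-∀
      lemma₂ : ∀ x k → x ℕ.* (k ℕ.* 4 ℕ.+ 2) ≡ x ℕ.* (2 ℕ.* k ℕ.+ 1) ℕ.+ x ℕ.* (2 ℕ.* k ℕ.+ 1)
      lemma₂ = ℕRing.solve-∀

    φ/2≡half : ∀ e → 1 ≤ e → φ (p ^ e) / 2 ≡ half e
    φ/2≡half e 1≤e = trans (cong (_/ 2) (φ≡half+half e 1≤e)) ([m+m]/2≡m (half e))

    d : ℕ
    d = half s

    -1^d≡-1 : (- + 1) ℤ.^ d ≡ - + 1
    -1^d≡-1 = trans (sym (ℤₚ.^-*-assoc (- + 1) (p ^ (s ∸ 1)) (2 ℕ.* k ℕ.+ 1)))
      (trans (cong (ℤ._^ (2 ℕ.* k ℕ.+ 1)) (-1^odd^e≡-1 {p} -1^p≡-1 (s ∸ 1))) (-1^odd≡-1 k))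
      where
      lemma : ∀ k → 3 ℕ.+ k ℕ.* 4 ≡ 2 ℕ.* (2 ℕ.* k ℕ.+ 1) ℕ.+ 1
      lemma = ℕRing.solve-∀
      -1^p≡-1 : (- + 1) ℤ.^ p ≡ - + 1
      -1^p≡-1 = trans (cong ((- + 1) ℤ.^_) (trans p≡3+k*4 (lemma k))) (-1^odd≡-1 (2 ℕ.* k ℕ.+ 1))

    d-odd : ∃[ c ] d ≡ 2 ℕ.* c ℕ.+ 1
    d-odd =
      let c , d≡1+c*2 = ¬2∣⇒odd d (λ (ℕ∣.divides c d≡c*2) → contradiction
            (trans (sym -1^d≡-1) (trans (cong ((- + 1) ℤ.^_) (trans d≡c*2 (ℕₚ.*-comm c 2))) (-1^2c≡1 c))) λ ())
      in c , trans d≡1+c*2 (lemma c)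
      where
      lemma : ∀ c → suc (c ℕ.* 2) ≡ 2 ℕ.* c ℕ.+ 1
      lemma = ℕRing.solve-∀

    open Cosets s t p q l g k d pr qr p≢q p≡4k+3 1≤s 1≤t -1^d≡-1 (φ≡half+half s 1≤s)
      (subst (IsOrder (p ^ s) (+ l)) (φ/2≡half s 1≤s) l-order-p) l-order-q
      (half-coprime { d} -1^d≡-1 (trans (cong (λ m → gcd m (φ (q ^ t))) (sym (φ≡half+half s 1≤s))) gcd≡2))
      g-order-p g-order-q

    open Setup p q l s t g using (χ; χ*; _≈_; _·_; ∑-between) renaming (_+_ to _+ᴿ_; _*_ to _*ᴿ_)

    coefficient : ∀ {x x′} y z → x ≡ x′ → + (x ℕ.* y ℕ.* z) ≡ + x′ * + y * + z
    coefficient {x} y z refl = trans (ℤₚ.pos-* (x ℕ.* y) z) (cong (_* + z) (ℤₚ.pos-* x y))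

    [p-3]/4≡k : (p ∸ 3) / 4 ≡ k
    [p-3]/4≡k = trans (cong (λ m → (m ∸ 3) / 4) p≡3+k*4) (m*n/n≡m k 4)

    [p+1]/4≡k+1 : (p ℕ.+ 1) / 4 ≡ k ℕ.+ 1
    [p+1]/4≡k+1 = trans (cong (λ m → (m ℕ.+ 1) / 4) p≡3+k*4) (trans (cong (_/ 4) (lemma k)) (m*n/n≡m (k ℕ.+ 1) 4))
      where
      lemma : ∀ k → 3 ℕ.+ k ℕ.* 4 ℕ.+ 1 ≡ (k ℕ.+ 1) ℕ.* 4
      lemma = ℕRing.solve-∀

    module _ {i j j′ : ℕ} (i<s : i < s) (j<j′ : j < j′) (j′≤t : j′ ≤ t) where

      π f : ℕ
      π = p ^ (s ∸ i ∸ 1)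
      f = φ (q ^ (t ∸ j′))

      same-class : twist j′ Sign.- ≡ twist j Sign.- → χ* i j *ᴿ χ* i j′ ≈
        (+ ((p ∸ 3) / 4 ℕ.* π ℕ.* f)) · χ* i j +ᴿ (+ ((p ℕ.+ 1) / 4 ℕ.* π ℕ.* f)) · χ i j
      same-class tw = χ*χ*-same i<s j<j′ j′≤t tw (coefficient π f [p-3]/4≡k) (coefficient π f [p+1]/4≡k+1)

      opposite-class : twist j′ Sign.- ≡ opposite (twist j Sign.-) → χ* i j *ᴿ χ* i j′ ≈
        (+ ((p ∸ 3) / 4 ℕ.* π ℕ.* f)) · (χ i j +ᴿ χ* i j)
        +ᴿ (+ (φ (p ^ (s ∸ i)) / 2 ℕ.* f)) · (∑-between i s (λ k → χ k j +ᴿ χ* k j) +ᴿ χ s j)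
      opposite-class tw = χ*χ*-opposite i<s j<j′ j′≤t tw (coefficient π f [p-3]/4≡k)
        -- The class size 2k + 1 times pˢ⁻ⁱ⁻¹ is `half (s ∸ i)`, which explains the coefficient
        -- φ(pˢ⁻ⁱ)/2.
        (trans (cong (λ m → + (m ℕ.* f)) (trans (φ/2≡half (s ∸ i) (ℕₚ.m<n⇒0<n∸m i<s)) (ℕₚ.*-comm π (2 ℕ.* k ℕ.+ 1))))
          (coefficient {2 ℕ.* k ℕ.+ 1} π f refl))

      j′∸j+j : j′ ∸ j ℕ.+ j ≡ j′
      j′∸j+j = ℕₚ.m∸n+n≡m (ℕₚ.<⇒≤ j<j′)

      residue-case : QuadraticResidue p q → twist j′ Sign.- ≡ twist j Sign.-
      residue-case res = trans (twist-trivial (residue⇒κ res) j′ Sign.-)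
          (sym (twist-trivial (residue⇒κ res) j Sign.-))

      even-case : 2 ∣ j′ ∸ j → twist j′ Sign.- ≡ twist j Sign.-
      even-case (ℕ∣.divides c e) = trans (cong (λ m → twist m Sign.-) (trans (sym j′∸j+j) (cong (ℕ._+ j) e)))
        (twist-even c j Sign.-)

      odd-case : QuadraticNonresidue p q → 2 ∤ j′ ∸ j → twist j′ Sign.- ≡ opposite (twist j Sign.-)
      odd-case (_ , ¬square) 2∤ =
        let c , e = ¬2∣⇒odd (j′ ∸ j) 2∤
        in trans (cong (λ m → twist m Sign.-) (trans (sym j′∸j+j) (cong (ℕ._+ j) e)))
            (twist-odd (κ≡- κ refl) c j Sign.-)
        where
        κ≡- : ∀ δ → κ ≡ δ → κ ≡ Sign.-
        κ≡- Sign.- κ≡- = κ≡-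
        κ≡- Sign.+ κ≡+ = contradiction (proj₂ (κ⇒residue (proj₁ d-odd) (proj₂ d-odd) κ≡+)) ¬square

theorem4p9 :
  (s t p q l : ℕ) (g : ℤ) →
  1 ≤ s → 1 ≤ t →
  Prime p → Prime q → Prime l →
  p ≢ q → p ≢ l → q ≢ l →
  2 ∤ p → 2 ∤ q → p % 4 ≡ 3 →
  IsOrder (p ^ s) (+ l) (φ (p ^ s) / 2) →
  IsOrder (q ^ t) (+ l) (φ (q ^ t)) →
  gcd (φ (p ^ s)) (φ (q ^ t)) ≡ 2 →
  IsPrimitiveRoot (p ^ s) g → IsPrimitiveRoot (q ^ t) g →
  (i j j′ : ℕ) → i < s → j < j′ → j′ ≤ t →
  let open Setup p q l s t g
      a = (p ∸ 3) / 4 ℕ.* p ^ (s ∸ i ∸ 1) ℕ.* φ (q ^ (t ∸ j′))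
      b = (p ℕ.+ 1) / 4 ℕ.* p ^ (s ∸ i ∸ 1) ℕ.* φ (q ^ (t ∸ j′))
      c = φ (p ^ (s ∸ i)) / 2 ℕ.* φ (q ^ (t ∸ j′))
  in
  (QuadraticResidue p q →
    χ* i j * χ* i j′ ≈ (+ a) · χ* i j + (+ b) · χ i j)
  × (QuadraticNonresidue p q → 2 ∣ j′ ∸ j →
    χ* i j * χ* i j′ ≈ (+ a) · χ* i j + (+ b) · χ i j)
  × (QuadraticNonresidue p q → 2 ∤ j′ ∸ j →
    χ* i j * χ* i j′ ≈
      (+ a) · (χ i j + χ* i j)
      + (+ c) · ((∑[ i < k < s ] (χ k j + χ* k j)) + χ s j))
theorem4p9 s t p q l g 1≤s 1≤t pr qr _ p≢q _ _ _ _ p%4≡3 l-order-p l-order-q gcd≡2 g-order-p g-order-q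
  i j j′ i<s j<j′ j′≤t =
    (λ residue → same-class i<s j<j′ j′≤t (residue-case i<s j<j′ j′≤t residue))
  , (λ _ even → same-class i<s j<j′ j′≤t (even-case i<s j<j′ j′≤t even))
  , (λ nonresidue odd → opposite-class i<s j<j′ j′≤t (odd-case i<s j<j′ j′≤t nonresidue odd))
  where
  open CosetProduct.Products s t p q l g 1≤s 1≤t pr qr p≢q p%4≡3 l-order-p l-order-q gcd≡2 g-order-p g-order-q
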